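{- For any integer $\gamma \geq 0$, the Hilbert series $\mathcal{H}_{\mathsf{Dendr}_\gamma}(t)$ of the operad $\mathsf{Dendr}_\gamma$ satisfies $$\mathcal{H}_{\mathsf{Dendr}_\gamma}(t) = t + 2\gamma t\, \mathcal{H}_{\mathsf{Dendr}_\gamma}(t) + \gamma^2 t\, \mathcal{H}_{\mathsf{Dendr}_\gamma}(t)^2.$$
   Context: The ground field has characteristic zero; operad means nonsymmetric operad; $[n] = \{1, \dots, n\}$; $a \uparrow a' := \max(a, a')$. The Hilbert series of an operad $\mathcal{O}$ with finite-dimensional components is $\mathcal{H}_{\mathcal{O}}(t) := \sum_{n \geq 1} \dim \mathcal{O}(n)\, t^n$. $\mathbf{Free}(\mathfrak{G})$ is the free operad on a set $\mathfrak{G}$ of binary generators; $(\mathfrak{G}, \mathfrak{R})$ is a presentation of $\mathcal{O}$ if $\mathcal{O} \cong \mathbf{Free}(\mathfrak{G})/\langle \mathfrak{R} \rangle$. Koszul dual: if $\mathcal{O}$ has a presentation $(\mathfrak{G}, \mathfrak{R})$ with $\mathfrak{G}$ in arity $2$ and $\mathfrak{R} \subseteq \mathbf{Free}(\mathfrak{G})(3)$, its Koszul dual is the operad with presentation $(\mathfrak{G}, \mathfrak{R}^\perp)$, where $\mathfrak{R}^\perp$ is the annihilator of $\mathfrak{R}$ in $\mathbf{Free}(\mathfrak{G})(3)$ for the bilinear form with $\langle x \circ_i y, x' \circ_{i'} y' \rangle = 1$ if $x = x', y = y', i = i' = 1$; $= -1$ if $x = x', y = y', i = i' = 2$; and $0$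 otherwise ($x, x', y, y' \in \mathfrak{G}$). $\mathsf{Dias}_\gamma$ is the operad whose arity-$n$ component is spanned by the words of length $n$ on $\{0\} \cup [\gamma]$ with exactly one $0$, with $u \circ_i v := u_1 \dots u_{i-1} \max(u_i, v_1) \dots \max(u_i, v_m) u_{i+1} \dots u_n$. It is presented by generators $\dashv_a, \vdash_a$, $a \in [\gamma]$ (standing for the words $0a$ and $a0$) and the space of relations spanned, for all $a, a' \in [\gamma]$, by $\dashv_a \circ_1 \vdash_{a'} - \vdash_{a'} \circ_2 \dashv_a$; $\dashv_a \circ_1 \dashv_{a \uparrow a'} - \dashv_a \circ_2 \vdash_{a'}$; $\vdash_a \circ_1 \dashv_{a'} - \vdash_a \circ_2 \vdash_{a \uparrow a'}$; $\dashv_{a \uparrow a'} \circ_1 \dashv_a - \dashv_a \circ_2 \dashv_{a'}$; $\vdash_a \circ_1 \vdash_{a'} - \vdash_{a \uparrow a'} \circ_2 \vdash_a$. $\mathsf{Dendr}_\gamma$ is the Koszul dual of $\mathsf{Dias}_\gamma$. -}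

module Defs where

open import Algebra.Apartness.Bundles using (HeytingField; HeytingCommutativeRing)
open import Algebra.Bundles using (CommutativeMonoid; CommutativeRing)
open import Algebra.Module.Bundles using (LeftModule)
import Algebra.Construct.NaturalChoice.Max as Max
import Algebra.Definitions.RawMonoid as RawMonoidDefs
import Algebra.Module.Properties.LeftModule as LeftModuleProperties
import Algebra.Properties.AbelianGroup as AbelianGroupProperties
import Algebra.Properties.CommutativeSemigroup as CommutativeSemigroupProperties
import Algebra.Properties.Ring as RingProperties
open import Data.Bool.Base using (if_then_else_)
open import Data.Empty using (⊥-elim)
open import Data.Fin.Base using (Fin; zero; suc; toℕ)
import Data.Fin.Properties as Fin
open import Data.List.Base using (List; []; _∷_; _++_; map; upTo; length)
open import Data.Nat.Base using (ℕ; zero; suc; _+_; _*_; _∸_; _^_; _≤_; _<_; z≤n; s≤s; s≤s⁻¹)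
import Data.Nat.ListAction as ℕ using (sum)
import Data.Nat.Properties as ℕ
open import Data.Product.Base using (Σ-syntax; ∃-syntax; _×_; _,_; proj₁; proj₂)
open import Function.Base using (_∘_)
open import Level using (Level; 0ℓ; _⊔_) renaming (suc to lsuc)
open import Relation.Binary.Definitions using (DecidableEquality)
open import Relation.Binary.PropositionalEquality as ≡ using (_≡_; cong; cong₂)
import Relation.Binary.Reasoning.Setoid as SetoidReasoning
open import Relation.Nullary using (¬_; yes; no; does)
open import Relation.Nullary.Decidable using (map′)
open import Relation.Unary using (Pred; _∈_)

PowerSeries : Set
PowerSeries = ℕ → ℕ

infixl 6 _⊕_
infixl 7 _⊛_
infixr 8 _•_

𝕥 : PowerSeries
𝕥 1 = 1
𝕥 _ = 0

_⊕_ : PowerSeries → PowerSeries → PowerSeries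
(f ⊕ g) n = f n + g n

_•_ : ℕ → PowerSeries → PowerSeries
(a • f) n = a * f n

_⊛_ : PowerSeries → PowerSeries → PowerSeries
(f ⊛ g) n = ℕ.sum (map (λ i → f i * g (n ∸ i)) (upTo (suc n)))

data Tree (G : Set) : Set where
  leaf : Tree G
  node : G → Tree G → Tree G → Tree G

module _ {G : Set} where

  leaves : Tree G → ℕ
  leaves leaf         = 1
  leaves (node _ l r) = leaves l + leaves r

  -- graft t i s replaces the leaf number i of t by s.  Leaves are numbered
  -- from left to right starting at 0; the value is junk when i ≥ leaves t.
  graft : Tree G → ℕ → Tree G → Tree G
  graft leaf         _ s = s
  graft (node g l r) i s with i ℕ.<? leaves l
  ... | yes _ = node g (graft l i s) r
  ... | no  _ = node g l (graft r (i ∸ leaves l) s)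

  node-injective : ∀ {g h} {l r l′ r′ : Tree G} → node g l r ≡ node h l′ r′ →
                   g ≡ h × l ≡ l′ × r ≡ r′
  node-injective ≡.refl = ≡.refl , ≡.refl , ≡.refl

  tree-≟ : DecidableEquality G → DecidableEquality (Tree G)
  tree-≟ _≟_ leaf         leaf         = yes ≡.refl
  tree-≟ _≟_ leaf         (node _ _ _) = no λ ()
  tree-≟ _≟_ (node _ _ _) leaf         = no λ ()
  tree-≟ _≟_ (node g l r) (node h l′ r′)
    with g ≟ h | tree-≟ _≟_ l l′ | tree-≟ _≟_ r r′
  ... | yes ≡.refl | yes ≡.refl | yes ≡.refl = yes ≡.refl
  ... | no g≢h     | _          | _          = no (g≢h ∘ proj₁ ∘ node-injective)
  ... | yes _      | no l≢l′    | _          = no (l≢l′ ∘ proj₁ ∘ proj₂ ∘ node-injective)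
  ... | yes _      | yes _      | no r≢r′    = no (r≢r′ ∘ proj₂ ∘ proj₂ ∘ node-injective)

  leaves>0 : ∀ t → 0 < leaves t
  leaves>0 leaf         = s≤s z≤n
  leaves>0 (node _ l r) = ℕ.≤-trans (leaves>0 l) (ℕ.m≤m+n (leaves l) (leaves r))

  graft-left : ∀ g l r {i} s → i < leaves l →
               graft (node g l r) i s ≡ node g (graft l i s) r
  graft-left g l r {i} s i< with i ℕ.<? leaves l
  ... | yes _ = ≡.refl
  ... | no i≮ = ⊥-elim (i≮ i<)

  graft-right : ∀ g l r j s →
                graft (node g l r) (leaves l + j) s ≡ node g l (graft r j s)
  graft-right g l r j s with (leaves l + j) ℕ.<? leaves l
  ... | yes < = ⊥-elim (ℕ.m+n≮m (leaves l) j <)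
  ... | no _  = cong (λ k → node g l (graft r k s)) (ℕ.m+n∸m≡n (leaves l) j)

  data Split (l i : ℕ) : Set where
    left  : i < l → Split l i
    right : ∀ j → i ≡ l + j → Split l i

  split : ∀ l i → Split l i
  split l i with i ℕ.<? l
  ... | yes i< = left i<
  ... | no i≮  = right (i ∸ l) (≡.sym (ℕ.m+[n∸m]≡n (ℕ.≮⇒≥ i≮)))

  leaves-graft : ∀ t {i} s → i < leaves t →
                 suc (leaves (graft t i s)) ≡ leaves t + leaves s
  leaves-graft leaf s _ = ≡.refl
  leaves-graft (node g l r) {i} s i< with split (leaves l) i
  ... | left i<l rewrite graft-left g l r s i<l = begin
    suc (leaves (graft l i s) + leaves r) ≡⟨ cong (_+ leaves r) (leaves-graft l s i<l) ⟩
    leaves l + leaves s + leaves r        ≡⟨ ℕ.+-assoc (leaves l) _ _ ⟩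
    leaves l + (leaves s + leaves r)      ≡⟨ cong (leaves l +_) (ℕ.+-comm (leaves s) _) ⟩
    leaves l + (leaves r + leaves s)      ≡⟨ ℕ.+-assoc (leaves l) _ _ ⟨
    leaves l + leaves r + leaves s        ∎
    where open ≡.≡-Reasoning
  ... | right j ≡.refl rewrite graft-right g l r j s = begin
    suc (leaves l + leaves (graft r j s)) ≡⟨ ℕ.+-suc (leaves l) _ ⟨
    leaves l + suc (leaves (graft r j s)) ≡⟨ cong (leaves l +_) (leaves-graft r s (ℕ.+-cancelˡ-< (leaves l) _ _ i<)) ⟩
    leaves l + (leaves r + leaves s)      ≡⟨ ℕ.+-assoc (leaves l) _ _ ⟨
    leaves l + leaves r + leaves s        ∎
    where open ≡.≡-Reasoning

  graft-leaf : ∀ t {i} → i < leaves t → graft t i leaf ≡ t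
  graft-leaf leaf _ = ≡.refl
  graft-leaf (node g l r) {i} i< with split (leaves l) i
  ... | left i<l = ≡.trans (graft-left g l r leaf i<l) (cong (λ t → node g t r) (graft-leaf l i<l))
  ... | right j ≡.refl = ≡.trans (graft-right g l r j leaf)
        (cong (node g l) (graft-leaf r (ℕ.+-cancelˡ-< (leaves l) _ _ i<)))

  private
    i+j<graft : ∀ t {i} s {j} → i < leaves t → j < leaves s → i + j < leaves (graft t i s)
    i+j<graft t {i} s {j} i< j< = s≤s⁻¹ (≡.subst (suc (suc (i + j)) ≤_)
      (≡.sym (leaves-graft t s i<))
      (≡.subst (_≤ leaves t + leaves s) (cong suc (ℕ.+-suc i j)) (ℕ.+-mono-≤ i< j<)))

    j′<graft : ∀ t s {i j j′} → i < leaves t → j < leaves t →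
               suc j′ ≡ j + leaves s → j′ < leaves (graft t i s)
    j′<graft t s i< j< eq = s≤s⁻¹ (≡.subst₂ _<_ (≡.sym eq) (≡.sym (leaves-graft t s i<))
                              (ℕ.+-monoˡ-< (leaves s) j<))

    i<graft : ∀ t s {i j} → i < j → j < leaves t → i < leaves (graft t j s)
    i<graft t s {j = j} i<j j< =
      ℕ.<-≤-trans i<j (ℕ.≤-trans (ℕ.m≤m+n j 0) (ℕ.<⇒≤ (i+j<graft t s j< (leaves>0 s))))

    j′≡graft : ∀ t s {k i j′} → i < leaves t →
               suc j′ ≡ leaves t + k + leaves s → j′ ≡ leaves (graft t i s) + k
    j′≡graft t s {k} {i} {j′} i< eq = ℕ.suc-injective (begin
      suc j′                         ≡⟨ eq ⟩
      leaves t + k + leaves s        ≡⟨ ℕ.+-assoc (leaves t) k _ ⟩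
      leaves t + (k + leaves s)      ≡⟨ cong (leaves t +_) (ℕ.+-comm k _) ⟩
      leaves t + (leaves s + k)      ≡⟨ ℕ.+-assoc (leaves t) _ k ⟨
      leaves t + leaves s + k        ≡⟨ cong (_+ k) (leaves-graft t s i<) ⟨
      suc (leaves (graft t i s) + k) ∎)
      where open ≡.≡-Reasoning

  graft-sequential : ∀ t s u {i j} → i < leaves t → j < leaves s →
                     graft (graft t i s) (i + j) u ≡ graft t i (graft s j u)
  graft-sequential leaf s u {zero} _ _ = ≡.refl
  graft-sequential leaf s u {suc i} (s≤s ()) _
  graft-sequential (node g l r) s u {i} {j} i< j< with split (leaves l) i
  ... | left i<l
    rewrite graft-left g l r s i<l
          | graft-left g (graft l i s) r u (i+j<graft l s i<l j<)
          | graft-left g l r (graft s j u) i<l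
          = cong (λ t → node g t r) (graft-sequential l s u i<l j<)
  ... | right k ≡.refl
    rewrite graft-right g l r k s
          | ℕ.+-assoc (leaves l) k j
          | graft-right g l (graft r k s) (k + j) u
          | graft-right g l r k (graft s j u)
          = cong (node g l) (graft-sequential r s u (ℕ.+-cancelˡ-< (leaves l) _ _ i<) j<)

  graft-parallel : ∀ t s u {i j j′} → i < j → j < leaves t → suc j′ ≡ j + leaves s →
                   graft (graft t i s) j′ u ≡ graft (graft t j u) i s
  graft-parallel leaf s u {j = suc _} _ (s≤s ()) _
  graft-parallel (node g l r) s u {i} {j} {j′} i<j j< eq
    with split (leaves l) i | split (leaves l) j
  ... | left i<l | left j<l
    rewrite graft-left g l r s i<l
          | graft-left g l r u j<l
          | graft-left g (graft l i s) r u (j′<graft l s i<l j<l eq)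
          | graft-left g (graft l j u) r s (i<graft l u i<j j<l)
          = cong (λ t → node g t r) (graft-parallel l s u i<j j<l eq)
  ... | left i<l | right k ≡.refl
    rewrite graft-left g l r s i<l
          | graft-right g l r k u
          | graft-left g l (graft r k u) s i<l
          | j′≡graft l s {k} i<l eq
          = graft-right g (graft l i s) r k u
  ... | right k ≡.refl | left j<l =
    ⊥-elim (ℕ.m+n≮m (leaves l) k (ℕ.<-trans i<j j<l))
  ... | right k ≡.refl | right k₂ ≡.refl
    rewrite graft-right g l r k s
          | graft-right g l r k₂ u
          | graft-right g l (graft r k₂ u) k s
    with split (leaves l) j′
  ...   | left j′<l = ⊥-elim (ℕ.<⇒≱ j′<l (s≤s⁻¹ (≡.subst (suc (leaves l) ≤_) (≡.sym eq) l<)))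
    where
    l< : suc (leaves l) ≤ leaves l + k₂ + leaves s
    l< = ≡.subst (_≤ leaves l + k₂ + leaves s) (ℕ.+-comm (leaves l) 1)
           (ℕ.+-mono-≤ (ℕ.m≤m+n (leaves l) k₂) (leaves>0 s))
  ...   | right k′ ≡.refl rewrite graft-right g l (graft r k s) k′ u =
    cong (node g l) (graft-parallel r s u
      (ℕ.+-cancelˡ-< (leaves l) _ _ i<j) (ℕ.+-cancelˡ-< (leaves l) _ _ j<)
      (ℕ.+-cancelˡ-≡ (leaves l) _ _
        (≡.trans (ℕ.+-suc (leaves l) k′) (≡.trans eq (ℕ.+-assoc (leaves l) k₂ _)))))

TreeOf : Set → ℕ → Set
TreeOf G n = Σ[ t ∈ Tree G ] leaves t ≡ n

module _ {G : Set} where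

  TreeOf-≡ : ∀ {n} {s t : TreeOf G n} → proj₁ s ≡ proj₁ t → s ≡ t
  TreeOf-≡ {s = _ , p} {_ , q} ≡.refl = cong (_ ,_) (ℕ.≡-irrelevant p q)

  treeOf-≟ : DecidableEquality G → ∀ n → DecidableEquality (TreeOf G n)
  treeOf-≟ _≟_ n s t = map′ TreeOf-≡ (cong proj₁) (tree-≟ _≟_ (proj₁ s) (proj₁ t))

  index< : ∀ {n} (t : TreeOf G n) (i : Fin n) → toℕ i < leaves (proj₁ t)
  index< (t , p) i = ≡.subst (toℕ i <_) (≡.sym p) (Fin.toℕ<n i)

  graftOf : ∀ {m n k} → suc k ≡ m + n → Fin m → TreeOf G m → TreeOf G n → TreeOf G k
  graftOf {m} {n} {k} e i (t , p) (s , q) = graft t (toℕ i) s , ℕ.suc-injective (begin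
    suc (leaves (graft t (toℕ i) s)) ≡⟨ leaves-graft t s (index< (t , p) i) ⟩
    leaves t + leaves s              ≡⟨ cong₂ _+_ p q ⟩
    m + n                            ≡⟨ e ⟨
    suc k                            ∎)
    where open ≡.≡-Reasoning

module OverField {c ℓ₁ ℓ₂} (𝕂 : HeytingField c ℓ₁ ℓ₂) where

  open HeytingCommutativeRing (HeytingField.heytingCommutativeRing 𝕂)
    using (commutativeRing)
  module K = CommutativeRing commutativeRing
  open K using (ring)
    renaming (Carrier to 𝕜; _+_ to _+ₖ_; _*_ to _*ₖ_; -_ to -ₖ_; 0# to 0ₖ; 1# to 1ₖ; _≈_ to _≈ₖ_)
  open RawMonoidDefs K.+-rawMonoid using () renaming (_×_ to _×ₖ_)
  private
    module KP = RingProperties ring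
    module K+ = CommutativeSemigroupProperties K.+-commutativeSemigroup
    module K* = CommutativeSemigroupProperties K.*-commutativeSemigroup

  CharacteristicZero : Set ℓ₁
  CharacteristicZero = ∀ n → ¬ (suc n ×ₖ 1ₖ ≈ₖ 0ₖ)

  VectorSpace : ∀ m ℓ → Set (c ⊔ ℓ₁ ⊔ lsuc (m ⊔ ℓ))
  VectorSpace = LeftModule ring

  module _ {m ℓ} (V : VectorSpace m ℓ) where
    open LeftModule V

    linearCombination : ∀ {d} → (Fin d → 𝕜) → (Fin d → Carrierᴹ) → Carrierᴹ
    linearCombination a v = sum λ i → a i *ₗ v i
      where open RawMonoidDefs (LeftModule.+ᴹ-rawMonoid V)

    record IsBasis {d} (b : Fin d → Carrierᴹ) : Set (c ⊔ ℓ₁ ⊔ m ⊔ ℓ) where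
      field
        independent : ∀ a → linearCombination a b ≈ᴹ 0ᴹ → ∀ i → a i ≈ₖ 0ₖ
        spanning    : ∀ x → ∃[ a ] linearCombination a b ≈ᴹ x

    HasDimension : ℕ → Set (c ⊔ ℓ₁ ⊔ m ⊔ ℓ)
    HasDimension d = Σ[ b ∈ (Fin d → Carrierᴹ) ] IsBasis b

    data Span {r} (S : Pred Carrierᴹ r) : Pred Carrierᴹ (c ⊔ m ⊔ ℓ ⊔ r) where
      gen  : ∀ {x} → x ∈ S → x ∈ Span S
      zero : 0ᴹ ∈ Span S
      add  : ∀ {x y} → x ∈ Span S → y ∈ Span S → x +ᴹ y ∈ Span S
      scal : ∀ a {x} → x ∈ Span S → a *ₗ x ∈ Span S
      resp : ∀ {x y} → x ≈ᴹ y → x ∈ Span S → y ∈ Span S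

    infixl 6 _-ᴹ_
    _-ᴹ_ : Carrierᴹ → Carrierᴹ → Carrierᴹ
    x -ᴹ y = x +ᴹ -ᴹ y

    -1*ₗ : ∀ x → (-ₖ 1ₖ) *ₗ x ≈ᴹ -ᴹ x
    -1*ₗ x = LeftModuleProperties.inverseˡ-uniqueᴹ V _ _ (begin
      (-ₖ 1ₖ) *ₗ x +ᴹ x       ≈⟨ +ᴹ-congˡ (*ₗ-identityˡ x) ⟨
      (-ₖ 1ₖ) *ₗ x +ᴹ 1ₖ *ₗ x ≈⟨ *ₗ-distribʳ x _ _ ⟨
      (-ₖ 1ₖ +ₖ 1ₖ) *ₗ x      ≈⟨ *ₗ-congʳ (K.-‿inverseˡ 1ₖ) ⟩
      0ₖ *ₗ x                 ≈⟨ *ₗ-zeroˡ x ⟩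
      0ᴹ                      ∎)
      where open SetoidReasoning ≈ᴹ-setoid

    record IsSubspace {r} (N : Pred Carrierᴹ r) : Set (c ⊔ m ⊔ ℓ ⊔ r) where
      field
        0∈   : 0ᴹ ∈ N
        +∈   : ∀ {x y} → x ∈ N → y ∈ N → x +ᴹ y ∈ N
        *∈   : ∀ a {x} → x ∈ N → a *ₗ x ∈ N
        ∈-resp : ∀ {x y} → x ≈ᴹ y → x ∈ N → y ∈ N

    module _ {r} {N : Pred Carrierᴹ r} (N-subspace : IsSubspace N) where
      open IsSubspace N-subspace
      open SetoidReasoning ≈ᴹ-setoid
      private
        module G = AbelianGroupProperties +ᴹ-abelianGroup
        module C = CommutativeSemigroupProperties
          (CommutativeMonoid.commutativeSemigroup +ᴹ-commutativeMonoid)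

        _~_ : Carrierᴹ → Carrierᴹ → Set r
        x ~ y = x -ᴹ y ∈ N

        ≈⇒~ : ∀ {x y} → x ≈ᴹ y → x ~ y
        ≈⇒~ {x} {y} x≈y = ∈-resp (≈ᴹ-sym (≈ᴹ-trans (+ᴹ-congʳ x≈y) (-ᴹ‿inverseʳ y))) 0∈

        -∈ : ∀ {x} → x ∈ N → -ᴹ x ∈ N
        -∈ {x} p = ∈-resp (-1*ₗ x) (*∈ (-ₖ 1ₖ) p)

        ~-sym : ∀ {x y} → x ~ y → y ~ x
        ~-sym {x} {y} p = ∈-resp (begin
          -ᴹ (x +ᴹ -ᴹ y)     ≈⟨ G.⁻¹-∙-comm x (-ᴹ y) ⟨
          -ᴹ x +ᴹ -ᴹ (-ᴹ y)  ≈⟨ +ᴹ-congˡ (G.⁻¹-involutive y) ⟩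
          -ᴹ x +ᴹ y          ≈⟨ +ᴹ-comm _ _ ⟩
          y +ᴹ -ᴹ x          ∎) (-∈ p)

        ~-trans : ∀ {x y z} → x ~ y → y ~ z → x ~ z
        ~-trans {x} {y} {z} p q = ∈-resp (begin
          (x +ᴹ -ᴹ y) +ᴹ (y +ᴹ -ᴹ z) ≈⟨ +ᴹ-assoc _ _ _ ⟩
          x +ᴹ (-ᴹ y +ᴹ (y +ᴹ -ᴹ z)) ≈⟨ +ᴹ-congˡ (+ᴹ-assoc _ _ _) ⟨
          x +ᴹ ((-ᴹ y +ᴹ y) +ᴹ -ᴹ z) ≈⟨ +ᴹ-congˡ (+ᴹ-congʳ (-ᴹ‿inverseˡ y)) ⟩
          x +ᴹ (0ᴹ +ᴹ -ᴹ z)          ≈⟨ +ᴹ-congˡ (+ᴹ-identityˡ _) ⟩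
          x +ᴹ -ᴹ z                  ∎) (+∈ p q)

        ~-+ : ∀ {x y u v} → x ~ y → u ~ v → (x +ᴹ u) ~ (y +ᴹ v)
        ~-+ {x} {y} {u} {v} p q = ∈-resp (begin
          (x +ᴹ -ᴹ y) +ᴹ (u +ᴹ -ᴹ v) ≈⟨ C.interchange _ _ _ _ ⟩
          (x +ᴹ u) +ᴹ (-ᴹ y +ᴹ -ᴹ v) ≈⟨ +ᴹ-congˡ (G.⁻¹-∙-comm y v) ⟩
          (x +ᴹ u) +ᴹ -ᴹ (y +ᴹ v)    ∎) (+∈ p q)

        ~-neg : ∀ {x y} → x ~ y → (-ᴹ x) ~ (-ᴹ y)
        ~-neg {x} {y} p = ∈-resp (≈ᴹ-sym (G.⁻¹-∙-comm x (-ᴹ y))) (-∈ p)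

        ~-* : ∀ {a b x y} → a ≈ₖ b → x ~ y → (a *ₗ x) ~ (b *ₗ y)
        ~-* {a} {b} {x} {y} a≈b p = ~-trans (∈-resp (begin
          a *ₗ (x +ᴹ -ᴹ y)               ≈⟨ *ₗ-distribˡ a _ _ ⟩
          a *ₗ x +ᴹ a *ₗ (-ᴹ y)          ≈⟨ +ᴹ-congˡ (*ₗ-congˡ (-1*ₗ y)) ⟨
          a *ₗ x +ᴹ a *ₗ ((-ₖ 1ₖ) *ₗ y)  ≈⟨ +ᴹ-congˡ (*ₗ-assoc a _ y) ⟨
          a *ₗ x +ᴹ (a *ₖ -ₖ 1ₖ) *ₗ y    ≈⟨ +ᴹ-congˡ (*ₗ-congʳ (K.*-comm a _)) ⟩
          a *ₗ x +ᴹ (-ₖ 1ₖ *ₖ a) *ₗ y    ≈⟨ +ᴹ-congˡ (*ₗ-assoc _ a y) ⟩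
          a *ₗ x +ᴹ (-ₖ 1ₖ) *ₗ (a *ₗ y)  ≈⟨ +ᴹ-congˡ (-1*ₗ _) ⟩
          a *ₗ x +ᴹ -ᴹ (a *ₗ y)          ∎) (*∈ a p)) (≈⇒~ (*ₗ-congʳ a≈b))

      quotient : VectorSpace m r
      quotient = record
        { Carrierᴹ = Carrierᴹ
        ; _≈ᴹ_ = _~_
        ; _+ᴹ_ = _+ᴹ_
        ; _*ₗ_ = _*ₗ_
        ; 0ᴹ = 0ᴹ
        ; -ᴹ_ = -ᴹ_
        ; isLeftModule = record
          { isLeftSemimodule = record
            { +ᴹ-isCommutativeMonoid = record
              { isMonoid = record
                { isSemigroup = record
                  { isMagma = record
                    { isEquivalence = record
                      { refl = ≈⇒~ ≈ᴹ-refl ; sym = ~-sym ; trans = ~-trans }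
                    ; ∙-cong = ~-+ }
                  ; assoc = λ x y z → ≈⇒~ (+ᴹ-assoc x y z) }
                ; identity = (λ x → ≈⇒~ (+ᴹ-identityˡ x)) , (λ x → ≈⇒~ (+ᴹ-identityʳ x)) }
              ; comm = λ x y → ≈⇒~ (+ᴹ-comm x y) }
            ; isPreleftSemimodule = record
              { *ₗ-cong = ~-*
              ; *ₗ-zeroˡ = λ x → ≈⇒~ (*ₗ-zeroˡ x)
              ; *ₗ-distribʳ = λ x a b → ≈⇒~ (*ₗ-distribʳ x a b)
              ; *ₗ-identityˡ = λ x → ≈⇒~ (*ₗ-identityˡ x)
              ; *ₗ-assoc = λ a b x → ≈⇒~ (*ₗ-assoc a b x)
              ; *ₗ-zeroʳ = λ a → ≈⇒~ (*ₗ-zeroʳ a)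
              ; *ₗ-distribˡ = λ a x y → ≈⇒~ (*ₗ-distribˡ a x y) } }
          ; -ᴹ‿cong = ~-neg
          ; -ᴹ‿inverse = (λ x → ≈⇒~ (-ᴹ‿inverseˡ x)) , (λ x → ≈⇒~ (-ᴹ‿inverseʳ x)) } }

      ≈⇒≈-quotient : ∀ {x y} → x ≈ᴹ y → LeftModule._≈ᴹ_ quotient x y
      ≈⇒≈-quotient = ≈⇒~

  -- A list of pairs (c , x) stands for the sum of the c x.
  Formal : Set → Set c
  Formal X = List (𝕜 × X)

  module _ {X : Set} where

    eval : (X → 𝕜) → Formal X → 𝕜
    eval f []            = 0ₖ
    eval f ((a , x) ∷ v) = a *ₖ f x +ₖ eval f v

    infixr 7 _·_
    _·_ : 𝕜 → Formal X → Formal X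
    a · v = map (λ (b , x) → a *ₖ b , x) v

    eval-cong : ∀ {f g : X → 𝕜} → (∀ x → f x ≈ₖ g x) → ∀ v → eval f v ≈ₖ eval g v
    eval-cong f≈g []            = K.refl
    eval-cong f≈g ((a , x) ∷ v) = K.+-cong (K.*-congˡ (f≈g x)) (eval-cong f≈g v)

    eval-++ : ∀ f v w → eval f (v ++ w) ≈ₖ eval f v +ₖ eval f w
    eval-++ f []            w = K.sym (K.+-identityˡ _)
    eval-++ f ((a , x) ∷ v) w = K.trans (K.+-congˡ (eval-++ f v w)) (K.sym (K.+-assoc _ _ _))

    eval-· : ∀ f a v → eval f (a · v) ≈ₖ a *ₖ eval f v
    eval-· f a []            = K.sym (K.zeroʳ a)
    eval-· f a ((b , x) ∷ v) =
      K.trans (K.+-cong (K.*-assoc a b (f x)) (eval-· f a v)) (K.sym (K.distribˡ a _ _))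

    eval-const0 : ∀ v → eval (λ _ → 0ₖ) v ≈ₖ 0ₖ
    eval-const0 []            = K.refl
    eval-const0 ((a , x) ∷ v) = K.trans (K.+-cong (K.zeroʳ a) (eval-const0 v)) (K.+-identityˡ _)

    eval-+ : ∀ f g v → eval (λ x → f x +ₖ g x) v ≈ₖ eval f v +ₖ eval g v
    eval-+ f g []            = K.sym (K.+-identityˡ _)
    eval-+ f g ((a , x) ∷ v) =
      K.trans (K.+-cong (K.distribˡ a _ _) (eval-+ f g v)) (K+.interchange _ _ _ _)

    eval-* : ∀ a f v → eval (λ x → a *ₖ f x) v ≈ₖ a *ₖ eval f v
    eval-* a f []            = K.sym (K.zeroʳ a)
    eval-* a f ((b , x) ∷ v) =
      K.trans (K.+-cong (K*.x∙yz≈y∙xz b a (f x)) (eval-* a f v)) (K.sym (K.distribˡ a _ _))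

  eval-swap : ∀ {X Y : Set} (h : X → Y → 𝕜) v w →
              eval (λ x → eval (h x) w) v ≈ₖ eval (λ y → eval (λ x → h x y) v) w
  eval-swap h []            w = K.sym (eval-const0 w)
  eval-swap h ((a , x) ∷ v) w = begin
    a *ₖ eval (h x) w +ₖ eval (λ x → eval (h x) w) v
      ≈⟨ K.+-cong (K.sym (eval-* a (h x) w)) (eval-swap h v w) ⟩
    eval (λ y → a *ₖ h x y) w +ₖ eval (λ y → eval (λ x → h x y) v) w
      ≈⟨ eval-+ _ _ w ⟨
    eval (λ y → a *ₖ h x y +ₖ eval (λ x → h x y) v) w ∎
    where open SetoidReasoning K.setoid

  bilinear : ∀ {X Y Z : Set} → (X → Y → Z) → Formal X → Formal Y → Formal Z
  bilinear g []            w = []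
  bilinear g ((a , x) ∷ v) w = map (λ (b , y) → a *ₖ b , g x y) w ++ bilinear g v w

  eval-bilinear : ∀ {X Y Z : Set} (g : X → Y → Z) f v w →
                  eval f (bilinear g v w) ≈ₖ eval (λ x → eval (λ y → f (g x y)) w) v
  eval-bilinear g f []            w = K.refl
  eval-bilinear {X} {Y} {Z} g f ((a , x) ∷ v) w =
    K.trans (eval-++ f (map (λ (b , y) → a *ₖ b , g x y) w) _)
            (K.+-cong (row w) (eval-bilinear g f v w))
    where
    row : ∀ w → eval f (map (λ (b , y) → a *ₖ b , g x y) w) ≈ₖ a *ₖ eval (λ y → f (g x y)) w
    row []            = K.sym (K.zeroʳ a)
    row ((b , y) ∷ w) =
      K.trans (K.+-cong (K.*-assoc a b _) (row w)) (K.sym (K.distribˡ a _ _))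

  module FreeSpace {X : Set} (_≟_ : DecidableEquality X) where

    δ : X → X → 𝕜
    δ x y = if does (x ≟ y) then 1ₖ else 0ₖ

    coeff : Formal X → X → 𝕜
    coeff v x = eval (δ x) v

    infix 4 _≋_
    _≋_ : Formal X → Formal X → Set ℓ₁
    v ≋ w = ∀ x → coeff v x ≈ₖ coeff w x

    private
      remove : X → Formal X → Formal X
      remove x [] = []
      remove x ((a , y) ∷ v) with x ≟ y
      ... | yes _ = remove x v
      ... | no  _ = (a , y) ∷ remove x v

      remove-length : ∀ x v → length (remove x v) ≤ length v
      remove-length x [] = z≤n
      remove-length x ((a , y) ∷ v) with x ≟ y
      ... | yes _ = ℕ.m≤n⇒m≤1+n (remove-length x v)
      ... | no  _ = s≤s (remove-length x v)

      eval-remove : ∀ f x v → eval f v ≈ₖ coeff v x *ₖ f x +ₖ eval f (remove x v)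
      eval-remove f x [] = K.sym (K.trans (K.+-identityʳ _) (K.zeroˡ _))
      eval-remove f x ((a , y) ∷ v) with x ≟ y
      ... | yes ≡.refl = begin
        a *ₖ f x +ₖ eval f v
          ≈⟨ K.+-cong (K.*-congʳ (K.sym (K.*-identityʳ a))) (eval-remove f x v) ⟩
        (a *ₖ 1ₖ) *ₖ f x +ₖ (coeff v x *ₖ f x +ₖ eval f (remove x v))
          ≈⟨ K.+-assoc _ _ _ ⟨
        (a *ₖ 1ₖ) *ₖ f x +ₖ coeff v x *ₖ f x +ₖ eval f (remove x v)
          ≈⟨ K.+-congʳ (K.distribʳ (f x) _ _) ⟨
        (a *ₖ 1ₖ +ₖ coeff v x) *ₖ f x +ₖ eval f (remove x v) ∎
        where open SetoidReasoning K.setoid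
      ... | no _ = begin
        a *ₖ f y +ₖ eval f v
          ≈⟨ K.+-congˡ (eval-remove f x v) ⟩
        a *ₖ f y +ₖ (coeff v x *ₖ f x +ₖ eval f (remove x v))
          ≈⟨ K+.x∙yz≈y∙xz _ _ _ ⟩
        coeff v x *ₖ f x +ₖ (a *ₖ f y +ₖ eval f (remove x v))
          ≈⟨ K.+-congʳ (K.*-congʳ (K.trans (K.+-congʳ (K.zeroʳ a)) (K.+-identityˡ _))) ⟨
        (a *ₖ 0ₖ +ₖ coeff v x) *ₖ f x +ₖ (a *ₖ f y +ₖ eval f (remove x v)) ∎
        where open SetoidReasoning K.setoid

      drop0 : ∀ {a b s t} → a ≈ₖ 0ₖ → s ≈ₖ a *ₖ b +ₖ t → s ≈ₖ t
      drop0 a≈0 eq = K.trans eq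
        (K.trans (K.+-congʳ (K.trans (K.*-congʳ a≈0) (K.zeroˡ _))) (K.+-identityˡ _))

      eval-zero : ∀ f l v → length v ≤ l → (∀ x → coeff v x ≈ₖ 0ₖ) → eval f v ≈ₖ 0ₖ
      eval-zero f l [] _ _ = K.refl
      eval-zero f (suc l) v@((a , x) ∷ v′) (s≤s len) v≋0 =
        K.trans (drop0 (v≋0 x) (eval-remove f x v))
                (eval-zero f l (remove x v) shorter
                  λ y → K.trans (K.sym (drop0 (v≋0 x) (eval-remove (δ y) x v))) (v≋0 y))
        where
        shorter : length (remove x v) ≤ l
        shorter with x ≟ x
        ... | yes _  = ℕ.≤-trans (remove-length x v′) len
        ... | no x≢x = ⊥-elim (x≢x ≡.refl)

      eval-diff : ∀ (f : X → 𝕜) v w → eval f (v ++ (-ₖ 1ₖ) · w) ≈ₖ eval f v +ₖ -ₖ eval f w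
      eval-diff f v w = K.trans (eval-++ f v _)
        (K.+-congˡ (K.trans (eval-· f (-ₖ 1ₖ) w) (KP.-1*x≈-x _)))

    eval-resp : ∀ f {v w} → v ≋ w → eval f v ≈ₖ eval f w
    eval-resp f {v} {w} v≋w = KP.x∙y⁻¹≈ε⇒x≈y _ _
      (K.trans (K.sym (eval-diff f v w))
        (eval-zero f _ (v ++ (-ₖ 1ₖ) · w) ℕ.≤-refl λ x →
          K.trans (eval-diff (δ x) v w) (KP.x≈y⇒x∙y⁻¹≈ε (v≋w x))))

    freeSpace : VectorSpace c ℓ₁
    freeSpace = record
      { Carrierᴹ = Formal X
      ; _≈ᴹ_ = _≋_
      ; _+ᴹ_ = _++_
      ; _*ₗ_ = _·_
      ; 0ᴹ = []
      ; -ᴹ_ = (-ₖ 1ₖ) ·_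
      ; isLeftModule = record
        { isLeftSemimodule = record
          { +ᴹ-isCommutativeMonoid = record
            { isMonoid = record
              { isSemigroup = record
                { isMagma = record
                  { isEquivalence = record
                    { refl = λ x → K.refl
                    ; sym = λ p x → K.sym (p x)
                    ; trans = λ p q x → K.trans (p x) (q x) }
                  ; ∙-cong = λ {v} {v′} {w} {w′} p q x → by2 (eval-++ (δ x) v w) (K.+-cong (p x) (q x)) (eval-++ (δ x) v′ w′) }
                ; assoc = λ u v w x →
                    by2 (K.trans (eval-++ (δ x) (u ++ v) w) (K.+-congʳ (eval-++ (δ x) u v)))
                        (K.+-assoc _ _ _)
                        (K.trans (eval-++ (δ x) u (v ++ w)) (K.+-congˡ (eval-++ (δ x) v w))) }
              ; identity = (λ v x → K.refl)
                         , (λ v x → K.trans (eval-++ (δ x) v []) (K.+-identityʳ _)) }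
            ; comm = λ v w x → by2 (eval-++ (δ x) v w) (K.+-comm _ _) (eval-++ (δ x) w v) }
          ; isPreleftSemimodule = record
            { *ₗ-cong = λ {a} {b} {v} {w} a≈b p x → by2 (eval-· (δ x) a v) (K.*-cong a≈b (p x)) (eval-· (δ x) b w)
            ; *ₗ-zeroˡ = λ v x → K.trans (eval-· (δ x) 0ₖ v) (K.zeroˡ _)
            ; *ₗ-distribʳ = λ v a b x →
                by2 (eval-· (δ x) (a +ₖ b) v) (K.distribʳ _ a b)
                    (K.trans (eval-++ (δ x) (a · v) (b · v)) (K.+-cong (eval-· (δ x) a v) (eval-· (δ x) b v)))
            ; *ₗ-identityˡ = λ v x → K.trans (eval-· (δ x) 1ₖ v) (K.*-identityˡ _)
            ; *ₗ-assoc = λ a b v x →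
                by2 (eval-· (δ x) (a *ₖ b) v) (K.*-assoc a b _)
                    (K.trans (eval-· (δ x) a (b · v)) (K.*-congˡ (eval-· (δ x) b v)))
            ; *ₗ-zeroʳ = λ a x → K.refl
            ; *ₗ-distribˡ = λ a v w x →
                by2 (K.trans (eval-· (δ x) a (v ++ w)) (K.*-congˡ (eval-++ (δ x) v w)))
                    (K.distribˡ a _ _)
                    (K.trans (eval-++ (δ x) (a · v) (a · w)) (K.+-cong (eval-· (δ x) a v) (eval-· (δ x) a w))) } }
        ; -ᴹ‿cong = λ {v} {w} p x → by2 (eval-· (δ x) _ v) (K.*-congˡ (p x)) (eval-· (δ x) _ w)
        ; -ᴹ‿inverse = (λ v x → K.trans (eval-++ (δ x) ((-ₖ 1ₖ) · v) v)
                          (K.trans (K.+-congʳ (K.trans (eval-· (δ x) _ v) (KP.-1*x≈-x _)))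
                                   (K.-‿inverseˡ _)))
                     , (λ v x → K.trans (eval-diff (δ x) v v) (K.-‿inverseʳ _)) } }
      where
      by2 : ∀ {a b a′ b′} → a ≈ₖ a′ → a′ ≈ₖ b′ → b ≈ₖ b′ → a ≈ₖ b
      by2 p q r = K.trans p (K.trans q (K.sym r))

  module Graded {m ℓ} (space : ℕ → VectorSpace m ℓ) where

    ∣_∣ : ℕ → Set m
    ∣ n ∣ = LeftModule.Carrierᴹ (space n)

    module _ {n : ℕ} where
      open LeftModule (space n) public
        using (_≈ᴹ_; _+ᴹ_; _*ₗ_; -ᴹ_; 0ᴹ)

  record Operad m ℓ : Set (c ⊔ ℓ₁ ⊔ lsuc (m ⊔ ℓ)) where
    field
      space : ℕ → VectorSpace m ℓ

    open Graded space public

    -- comp e i x y is the partial composition of y in the input i + 1 of x.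
    -- The proof e only records that the arity k of the result is m + n - 1,
    -- so that no transport along equalities of arities is ever needed.
    field
      unit : ∣ 1 ∣
      comp : ∀ {m n k} → suc k ≡ m + n → Fin m → ∣ m ∣ → ∣ n ∣ → ∣ k ∣

      comp-cong : ∀ {m n k} (e : suc k ≡ m + n) i {x x′ : ∣ m ∣} {y y′ : ∣ n ∣} →
                  x ≈ᴹ x′ → y ≈ᴹ y′ → comp e i x y ≈ᴹ comp e i x′ y′
      comp-+ˡ   : ∀ {m n k} (e : suc k ≡ m + n) i (x x′ : ∣ m ∣) (y : ∣ n ∣) →
                  comp e i (x +ᴹ x′) y ≈ᴹ comp e i x y +ᴹ comp e i x′ y
      comp-+ʳ   : ∀ {m n k} (e : suc k ≡ m + n) i (x : ∣ m ∣) (y y′ : ∣ n ∣) →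
                  comp e i x (y +ᴹ y′) ≈ᴹ comp e i x y +ᴹ comp e i x y′
      comp-*ˡ   : ∀ {m n k} (e : suc k ≡ m + n) i a (x : ∣ m ∣) (y : ∣ n ∣) →
                  comp e i (a *ₗ x) y ≈ᴹ a *ₗ comp e i x y
      comp-*ʳ   : ∀ {m n k} (e : suc k ≡ m + n) i a (x : ∣ m ∣) (y : ∣ n ∣) →
                  comp e i x (a *ₗ y) ≈ᴹ a *ₗ comp e i x y

      identityˡ  : ∀ {n} (x : ∣ n ∣) → comp ≡.refl zero unit x ≈ᴹ x
      identityʳ  : ∀ {n} (e : suc n ≡ n + 1) i (x : ∣ n ∣) → comp e i x unit ≈ᴹ x
      sequential : ∀ {m n p a b k}
                   (e₁ : suc a ≡ m + n) (e₂ : suc k ≡ a + p)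
                   (e₃ : suc b ≡ n + p) (e₄ : suc k ≡ m + b)
                   (i : Fin m) (j : Fin n) (i+j : Fin a) → toℕ i+j ≡ toℕ i + toℕ j →
                   (x : ∣ m ∣) (y : ∣ n ∣) (z : ∣ p ∣) →
                   comp e₂ i+j (comp e₁ i x y) z ≈ᴹ comp e₄ i x (comp e₃ j y z)
      parallel   : ∀ {m n p a b k}
                   (e₁ : suc a ≡ m + n) (e₂ : suc k ≡ a + p)
                   (e₃ : suc b ≡ m + p) (e₄ : suc k ≡ b + n)
                   (i j : Fin m) → toℕ i < toℕ j →
                   (j′ : Fin a) → suc (toℕ j′) ≡ toℕ j + n →
                   (i′ : Fin b) → toℕ i′ ≡ toℕ i →
                   (x : ∣ m ∣) (y : ∣ n ∣) (z : ∣ p ∣) →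
                   comp e₂ j′ (comp e₁ i x y) z ≈ᴹ comp e₄ i′ (comp e₃ j x z) y

  IsHilbertSeries : ∀ {m ℓ} → Operad m ℓ → PowerSeries → Set (c ⊔ ℓ₁ ⊔ m ⊔ ℓ)
  IsHilbertSeries O H = H 0 ≡ 0 × (∀ n → 1 ≤ n → HasDimension (Operad.space O n) (H n))

  module _ {m ℓ} (O : Operad m ℓ) where
    open Operad O

    data Ideal {r a} (R : Pred ∣ a ∣ r) : ∀ {n} → Pred ∣ n ∣ (c ⊔ m ⊔ ℓ ⊔ r) where
      gen   : ∀ {x} → x ∈ R → x ∈ Ideal R
      zero  : ∀ {n} → 0ᴹ {n} ∈ Ideal R
      add   : ∀ {n} {x y : ∣ n ∣} → x ∈ Ideal R → y ∈ Ideal R → x +ᴹ y ∈ Ideal R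
      scal  : ∀ {n} b {x : ∣ n ∣} → x ∈ Ideal R → b *ₗ x ∈ Ideal R
      resp  : ∀ {n} {x y : ∣ n ∣} → x ≈ᴹ y → x ∈ Ideal R → y ∈ Ideal R
      compˡ : ∀ {m n k} (e : suc k ≡ m + n) i {x : ∣ m ∣} (y : ∣ n ∣) →
              x ∈ Ideal R → comp e i x y ∈ Ideal R
      compʳ : ∀ {m n k} (e : suc k ≡ m + n) i (x : ∣ m ∣) {y : ∣ n ∣} →
              y ∈ Ideal R → comp e i x y ∈ Ideal R

    module _ {r a} (R : Pred ∣ a ∣ r) where

      ideal-subspace : ∀ n → IsSubspace (space n) (Ideal R)
      ideal-subspace n = record { 0∈ = zero ; +∈ = add ; *∈ = scal ; ∈-resp = resp }

      private
        Q : ℕ → VectorSpace m (c ⊔ m ⊔ ℓ ⊔ r)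
        Q n = quotient (space n) (ideal-subspace n)

        lift : ∀ {n} {x y : ∣ n ∣} → x ≈ᴹ y → LeftModule._≈ᴹ_ (Q n) x y
        lift {n} = ≈⇒≈-quotient (space n) (ideal-subspace n)

        module L {n} = LeftModule (space n)

        comp-subˡ : ∀ {m n k} (e : suc k ≡ m + n) i (x x′ : ∣ m ∣) (y : ∣ n ∣) →
                    comp e i (x +ᴹ -ᴹ x′) y ≈ᴹ comp e i x y +ᴹ -ᴹ comp e i x′ y
        comp-subˡ e i x x′ y = L.≈ᴹ-trans (comp-+ˡ e i x _ y) (L.+ᴹ-congˡ
          (L.≈ᴹ-trans (comp-cong e i (L.≈ᴹ-sym (-1*ₗ (space _) x′)) L.≈ᴹ-refl)
          (L.≈ᴹ-trans (comp-*ˡ e i _ x′ y) (-1*ₗ (space _) _))))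

        comp-subʳ : ∀ {m n k} (e : suc k ≡ m + n) i (x : ∣ m ∣) (y y′ : ∣ n ∣) →
                    comp e i x (y +ᴹ -ᴹ y′) ≈ᴹ comp e i x y +ᴹ -ᴹ comp e i x y′
        comp-subʳ e i x y y′ = L.≈ᴹ-trans (comp-+ʳ e i x y _) (L.+ᴹ-congˡ
          (L.≈ᴹ-trans (comp-cong e i L.≈ᴹ-refl (L.≈ᴹ-sym (-1*ₗ (space _) y′)))
          (L.≈ᴹ-trans (comp-*ʳ e i _ x y′) (-1*ₗ (space _) _))))

      infix 6 _/⟨_⟩
      _/⟨_⟩ : Operad m (c ⊔ m ⊔ ℓ ⊔ r)
      _/⟨_⟩ = record
        { space = Q
        ; unit = unit
        ; comp = comp
        ; comp-cong = λ {m} {n} {k} e i {x} {x′} {y} {y′} p q → LeftModule.≈ᴹ-trans (Q k)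
            {j = comp e i x′ y}
            (resp (comp-subˡ {m} {n} {k} e i x x′ y) (compˡ e i y p))
            (resp (comp-subʳ {m} {n} {k} e i x′ y y′) (compʳ e i x′ q))
        ; comp-+ˡ = λ {m} {n} {k} e i x x′ y → lift (comp-+ˡ {m} {n} {k} e i x x′ y)
        ; comp-+ʳ = λ {m} {n} {k} e i x y y′ → lift (comp-+ʳ {m} {n} {k} e i x y y′)
        ; comp-*ˡ = λ {m} {n} {k} e i b x y → lift (comp-*ˡ {m} {n} {k} e i b x y)
        ; comp-*ʳ = λ {m} {n} {k} e i b x y → lift (comp-*ʳ {m} {n} {k} e i b x y)
        ; identityˡ = λ x → lift (identityˡ x)
        ; identityʳ = λ e i x → lift (identityʳ e i x)
        ; sequential = λ {m} {n} {p} {a} {b} {k} e₁ e₂ e₃ e₄ i j i+j eq x y z → lift (sequential {m} {n} {p} {a} {b} {k} e₁ e₂ e₃ e₄ i j i+j eq x y z)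
        ; parallel = λ {m} {n} {p} {a} {b} {k} e₁ e₂ e₃ e₄ i j i<j j′ eq i′ eq′ x y z →
            lift (parallel {m} {n} {p} {a} {b} {k} e₁ e₂ e₃ e₄ i j i<j j′ eq i′ eq′ x y z)
        }

  module _ {G : Set} (_≟_ : DecidableEquality G) where

    private
      module F n = FreeSpace (treeOf-≟ _≟_ n)

      infix 4 _≈ᶠ_
      _≈ᶠ_ : ∀ {n} → Formal (TreeOf G n) → Formal (TreeOf G n) → Set (c ⊔ ℓ₁)
      v ≈ᶠ w = ∀ f → eval f v ≈ₖ eval f w

      _∘[_,_]_ : ∀ {m n k} → Formal (TreeOf G m) → suc k ≡ m + n → Fin m →
                 Formal (TreeOf G n) → Formal (TreeOf G k)
      v ∘[ e , i ] w = bilinear (graftOf e i) v w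

      𝟙 : Formal (TreeOf G 1)
      𝟙 = (1ₖ , (leaf , ≡.refl)) ∷ []

      ∘-eval : ∀ {m n k} (e : suc k ≡ m + n) i (v : Formal (TreeOf G m)) (w : Formal (TreeOf G n)) f →
               eval f (v ∘[ e , i ] w) ≈ₖ eval (λ s → eval (λ t → f (graftOf e i s t)) w) v
      ∘-eval e i v w f = eval-bilinear (graftOf e i) f v w

      open SetoidReasoning K.setoid

      ∘-cong : ∀ {m n k} (e : suc k ≡ m + n) i {v v′ : Formal (TreeOf G m)} {w w′ : Formal (TreeOf G n)} →
               v ≈ᶠ v′ → w ≈ᶠ w′ →
               v ∘[ e , i ] w ≈ᶠ v′ ∘[ e , i ] w′
      ∘-cong e i {v} {v′} {w} {w′} p q f = begin
        eval f (v ∘[ e , i ] w)                               ≈⟨ ∘-eval e i v w f ⟩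
        eval (λ s → eval (λ t → f (graftOf e i s t)) w) v     ≈⟨ eval-cong (λ s → q _) v ⟩
        eval (λ s → eval (λ t → f (graftOf e i s t)) w′) v    ≈⟨ p _ ⟩
        eval (λ s → eval (λ t → f (graftOf e i s t)) w′) v′   ≈⟨ ∘-eval e i v′ w′ f ⟨
        eval f (v′ ∘[ e , i ] w′)                             ∎

      ∘-+ˡ : ∀ {m n k} (e : suc k ≡ m + n) i (v v′ : Formal (TreeOf G m)) (w : Formal (TreeOf G n)) →
             (v ++ v′) ∘[ e , i ] w ≈ᶠ v ∘[ e , i ] w ++ v′ ∘[ e , i ] w
      ∘-+ˡ e i v v′ w f = begin
        eval f ((v ++ v′) ∘[ e , i ] w)                     ≈⟨ ∘-eval e i (v ++ v′) w f ⟩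
        eval g (v ++ v′)                                    ≈⟨ eval-++ g v v′ ⟩
        eval g v +ₖ eval g v′                               ≈⟨ K.+-cong (∘-eval e i v w f) (∘-eval e i v′ w f) ⟨
        eval f (v ∘[ e , i ] w) +ₖ eval f (v′ ∘[ e , i ] w) ≈⟨ eval-++ f (v ∘[ e , i ] w) _ ⟨
        eval f (v ∘[ e , i ] w ++ v′ ∘[ e , i ] w)          ∎
        where
        g : TreeOf G _ → 𝕜
        g s = eval (λ t → f (graftOf e i s t)) w

      ∘-+ʳ : ∀ {m n k} (e : suc k ≡ m + n) i (v : Formal (TreeOf G m)) (w w′ : Formal (TreeOf G n)) →
             v ∘[ e , i ] (w ++ w′) ≈ᶠ v ∘[ e , i ] w ++ v ∘[ e , i ] w′
      ∘-+ʳ e i v w w′ f = begin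
        eval f (v ∘[ e , i ] (w ++ w′))                     ≈⟨ ∘-eval e i v (w ++ w′) f ⟩
        eval (g (w ++ w′)) v                                ≈⟨ eval-cong (λ s → eval-++ _ w w′) v ⟩
        eval (λ s → g w s +ₖ g w′ s) v                      ≈⟨ eval-+ (g w) (g w′) v ⟩
        eval (g w) v +ₖ eval (g w′) v                       ≈⟨ K.+-cong (∘-eval e i v w f) (∘-eval e i v w′ f) ⟨
        eval f (v ∘[ e , i ] w) +ₖ eval f (v ∘[ e , i ] w′) ≈⟨ eval-++ f (v ∘[ e , i ] w) _ ⟨
        eval f (v ∘[ e , i ] w ++ v ∘[ e , i ] w′)          ∎
        where
        g : Formal (TreeOf G _) → TreeOf G _ → 𝕜
        g w s = eval (λ t → f (graftOf e i s t)) w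

      ∘-*ˡ : ∀ {m n k} (e : suc k ≡ m + n) i a (v : Formal (TreeOf G m)) (w : Formal (TreeOf G n)) →
             (a · v) ∘[ e , i ] w ≈ᶠ a · (v ∘[ e , i ] w)
      ∘-*ˡ e i a v w f = begin
        eval f ((a · v) ∘[ e , i ] w)   ≈⟨ ∘-eval e i (a · v) w f ⟩
        eval g (a · v)                  ≈⟨ eval-· g a v ⟩
        a *ₖ eval g v                   ≈⟨ K.*-congˡ (∘-eval e i v w f) ⟨
        a *ₖ eval f (v ∘[ e , i ] w)    ≈⟨ eval-· f a (v ∘[ e , i ] w) ⟨
        eval f (a · (v ∘[ e , i ] w))   ∎
        where
        g : TreeOf G _ → 𝕜
        g s = eval (λ t → f (graftOf e i s t)) w

      ∘-*ʳ : ∀ {m n k} (e : suc k ≡ m + n) i a (v : Formal (TreeOf G m)) (w : Formal (TreeOf G n)) →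
             v ∘[ e , i ] (a · w) ≈ᶠ a · (v ∘[ e , i ] w)
      ∘-*ʳ e i a v w f = begin
        eval f (v ∘[ e , i ] (a · w))   ≈⟨ ∘-eval e i v (a · w) f ⟩
        eval (g (a · w)) v              ≈⟨ eval-cong (λ s → eval-· _ a w) v ⟩
        eval (λ s → a *ₖ g w s) v       ≈⟨ eval-* a (g w) v ⟩
        a *ₖ eval (g w) v               ≈⟨ K.*-congˡ (∘-eval e i v w f) ⟨
        a *ₖ eval f (v ∘[ e , i ] w)    ≈⟨ eval-· f a (v ∘[ e , i ] w) ⟨
        eval f (a · (v ∘[ e , i ] w))   ∎
        where
        g : Formal (TreeOf G _) → TreeOf G _ → 𝕜
        g w s = eval (λ t → f (graftOf e i s t)) w

      at : ∀ {n} (f : TreeOf G n → 𝕜) {s t} → proj₁ s ≡ proj₁ t → f s ≈ₖ f t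
      at f eq = K.reflexive (cong f (TreeOf-≡ eq))

      ∘-identityˡ : ∀ {n} (v : Formal (TreeOf G n)) → 𝟙 ∘[ ≡.refl , zero ] v ≈ᶠ v
      ∘-identityˡ v f = begin
        eval f (𝟙 ∘[ ≡.refl , zero ] v) ≈⟨ ∘-eval ≡.refl zero 𝟙 v f ⟩
        1ₖ *ₖ eval g v +ₖ 0ₖ            ≈⟨ K.trans (K.+-identityʳ _) (K.*-identityˡ _) ⟩
        eval g v                        ≈⟨ eval-cong (λ t → at f ≡.refl) v ⟩
        eval f v                        ∎
        where
        g : TreeOf G _ → 𝕜
        g t = f (graftOf ≡.refl zero (leaf , ≡.refl) t)

      ∘-identityʳ : ∀ {n} (e : suc n ≡ n + 1) i (v : Formal (TreeOf G n)) → v ∘[ e , i ] 𝟙 ≈ᶠ v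
      ∘-identityʳ e i v f = begin
        eval f (v ∘[ e , i ] 𝟙)                ≈⟨ ∘-eval e i v 𝟙 f ⟩
        eval (λ s → 1ₖ *ₖ g s +ₖ 0ₖ) v         ≈⟨ eval-cong (λ s → K.trans (K.+-identityʳ _) (K.*-identityˡ _)) v ⟩
        eval g v                               ≈⟨ eval-cong (λ s → at f (graft-leaf (proj₁ s) (index< s i))) v ⟩
        eval f v                               ∎
        where
        g : TreeOf G _ → 𝕜
        g s = f (graftOf e i s (leaf , ≡.refl))

      ∘-sequential : ∀ {m n p a b k}
                     (e₁ : suc a ≡ m + n) (e₂ : suc k ≡ a + p)
                     (e₃ : suc b ≡ n + p) (e₄ : suc k ≡ m + b)
                     (i : Fin m) (j : Fin n) (i+j : Fin a) → toℕ i+j ≡ toℕ i + toℕ j →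
                     (u : Formal (TreeOf G m)) (v : Formal (TreeOf G n)) (w : Formal (TreeOf G p)) →
                     (u ∘[ e₁ , i ] v) ∘[ e₂ , i+j ] w ≈ᶠ u ∘[ e₄ , i ] (v ∘[ e₃ , j ] w)
      ∘-sequential e₁ e₂ e₃ e₄ i j i+j eq u v w f = begin
        eval f ((u ∘[ e₁ , i ] v) ∘[ e₂ , i+j ] w)
          ≈⟨ ∘-eval e₂ i+j (u ∘[ e₁ , i ] v) w f ⟩
        eval (λ rs → eval (λ t → f (graftOf e₂ i+j rs t)) w) (u ∘[ e₁ , i ] v)
          ≈⟨ ∘-eval e₁ i u v _ ⟩
        eval (λ r → eval (λ s → eval (λ t → f (graftOf e₂ i+j (graftOf e₁ i r s) t)) w) v) u
          ≈⟨ eval-cong (λ r → eval-cong (λ s → eval-cong (λ t → at f (trees r s t)) w) v) u ⟩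
        eval (λ r → eval (λ s → eval (λ t → f (graftOf e₄ i r (graftOf e₃ j s t))) w) v) u
          ≈⟨ eval-cong (λ r → ∘-eval e₃ j v w _) u ⟨
        eval (λ r → eval (λ st → f (graftOf e₄ i r st)) (v ∘[ e₃ , j ] w)) u
          ≈⟨ ∘-eval e₄ i u (v ∘[ e₃ , j ] w) f ⟨
        eval f (u ∘[ e₄ , i ] (v ∘[ e₃ , j ] w)) ∎
        where
        trees : ∀ r s t → proj₁ (graftOf e₂ i+j (graftOf e₁ i r s) t) ≡
                          proj₁ (graftOf e₄ i r (graftOf e₃ j s t))
        trees r s t = ≡.trans
          (cong (λ h → graft (graft (proj₁ r) (toℕ i) (proj₁ s)) h (proj₁ t)) eq)
          (graft-sequential (proj₁ r) (proj₁ s) (proj₁ t) (index< r i) (index< s j))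

      ∘-parallel : ∀ {m n p a b k}
                   (e₁ : suc a ≡ m + n) (e₂ : suc k ≡ a + p)
                   (e₃ : suc b ≡ m + p) (e₄ : suc k ≡ b + n)
                   (i j : Fin m) → toℕ i < toℕ j →
                   (j′ : Fin a) → suc (toℕ j′) ≡ toℕ j + n →
                   (i′ : Fin b) → toℕ i′ ≡ toℕ i →
                     (u : Formal (TreeOf G m)) (v : Formal (TreeOf G n)) (w : Formal (TreeOf G p)) →
                   (u ∘[ e₁ , i ] v) ∘[ e₂ , j′ ] w ≈ᶠ (u ∘[ e₃ , j ] w) ∘[ e₄ , i′ ] v
      ∘-parallel e₁ e₂ e₃ e₄ i j i<j j′ eq i′ eq′ u v w f = begin
        eval f ((u ∘[ e₁ , i ] v) ∘[ e₂ , j′ ] w)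
          ≈⟨ ∘-eval e₂ j′ (u ∘[ e₁ , i ] v) w f ⟩
        eval (λ rs → eval (λ t → f (graftOf e₂ j′ rs t)) w) (u ∘[ e₁ , i ] v)
          ≈⟨ ∘-eval e₁ i u v _ ⟩
        eval (λ r → eval (λ s → eval (λ t → f (graftOf e₂ j′ (graftOf e₁ i r s) t)) w) v) u
          ≈⟨ eval-cong (λ r → eval-cong (λ s → eval-cong (λ t → at f (trees r s t)) w) v) u ⟩
        eval (λ r → eval (λ s → eval (λ t → f (graftOf e₄ i′ (graftOf e₃ j r t) s)) w) v) u
          ≈⟨ eval-cong (λ r → eval-swap _ v w) u ⟩
        eval (λ r → eval (λ t → eval (λ s → f (graftOf e₄ i′ (graftOf e₃ j r t) s)) v) w) u
          ≈⟨ ∘-eval e₃ j u w _ ⟨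
        eval (λ rt → eval (λ s → f (graftOf e₄ i′ rt s)) v) (u ∘[ e₃ , j ] w)
          ≈⟨ ∘-eval e₄ i′ (u ∘[ e₃ , j ] w) v f ⟨
        eval f ((u ∘[ e₃ , j ] w) ∘[ e₄ , i′ ] v) ∎
        where
        trees : ∀ r s t → proj₁ (graftOf e₂ j′ (graftOf e₁ i r s) t) ≡
                          proj₁ (graftOf e₄ i′ (graftOf e₃ j r t) s)
        trees r s t = ≡.trans
          (graft-parallel (proj₁ r) (proj₁ s) (proj₁ t) i<j (index< r j)
            (≡.trans eq (cong (toℕ j +_) (≡.sym (proj₂ s)))))
          (cong (λ h → graft (graft (proj₁ r) (toℕ j) (proj₁ t)) h (proj₁ s)) (≡.sym eq′))

    Free : Operad c ℓ₁
    Free = record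
      { space = λ n → F.freeSpace n
      ; unit = 𝟙
      ; comp = λ e i v w → v ∘[ e , i ] w
      ; comp-cong = λ {m} {n} {k} e i {v} {v′} {w} {w′} p q x →
          ∘-cong e i {v} {v′} {w} {w′}
            (λ f → F.eval-resp m f {v} {v′} p) (λ f → F.eval-resp n f {w} {w′} q) (F.δ k x)
      ; comp-+ˡ = λ {m} {n} {k} e i v v′ w x → ∘-+ˡ {m} {n} {k} e i v v′ w (F.δ k x)
      ; comp-+ʳ = λ {m} {n} {k} e i v w w′ x → ∘-+ʳ {m} {n} {k} e i v w w′ (F.δ k x)
      ; comp-*ˡ = λ {m} {n} {k} e i a v w x → ∘-*ˡ {m} {n} {k} e i a v w (F.δ k x)
      ; comp-*ʳ = λ {m} {n} {k} e i a v w x → ∘-*ʳ {m} {n} {k} e i a v w (F.δ k x)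
      ; identityˡ = λ {n} v x → ∘-identityˡ v (F.δ n x)
      ; identityʳ = λ {n} e i v x → ∘-identityʳ e i v (F.δ n x)
      ; sequential = λ {m} {n} {p} {a} {b} {k} e₁ e₂ e₃ e₄ i j i+j eq u v w x →
          ∘-sequential {m} {n} {p} {a} {b} {k} e₁ e₂ e₃ e₄ i j i+j eq u v w (F.δ k x)
      ; parallel = λ {m} {n} {p} {a} {b} {k} e₁ e₂ e₃ e₄ i j i<j j′ eq i′ eq′ u v w x →
          ∘-parallel {m} {n} {p} {a} {b} {k} e₁ e₂ e₃ e₄ i j i<j j′ eq i′ eq′ u v w (F.δ k x)
      }

    generator : G → Operad.∣_∣ Free 2
    generator g = (1ₖ , (node g leaf leaf , ≡.refl)) ∷ []

    infix 8 _∘₁_ _∘₂_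
    _∘₁_ _∘₂_ : G → G → Operad.∣_∣ Free 3
    x ∘₁ y = Operad.comp Free ≡.refl zero       (generator x) (generator y)
    x ∘₂ y = Operad.comp Free ≡.refl (suc zero) (generator x) (generator y)

    -- On trees with three leaves, the value is 1 on x ∘₁ y, whose root has a
    -- node as left child, and - 1 on x ∘₂ y, whose root has a leaf as left child.
    sign : TreeOf G 3 → 𝕜
    sign (node _ (node _ _ _) _ , _) = 1ₖ
    sign (node _ leaf         _ , _) = -ₖ 1ₖ

    ⟨_,_⟩ : Operad.∣_∣ Free 3 → Operad.∣_∣ Free 3 → 𝕜
    ⟨ v , w ⟩ = eval (λ s → eval (λ t → if does (treeOf-≟ _≟_ 3 s t) then sign s else 0ₖ) w) v

  record Presentation r : Set (lsuc 0ℓ ⊔ c ⊔ lsuc r) where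
    field
      𝔊   : Set
      _≟_ : DecidableEquality 𝔊
      ℜ   : Pred (Operad.∣_∣ (Free _≟_) 3) r

  presented : ∀ {r} → Presentation r → Operad c (c ⊔ ℓ₁ ⊔ r)
  presented P = _/⟨_⟩ (Free _≟_) ℜ
    where open Presentation P

  infix 9 _^!
  _^! : ∀ {r} → Presentation r → Presentation (c ⊔ ℓ₁ ⊔ r)
  P ^! = record
    { 𝔊   = 𝔊
    ; _≟_ = _≟_
    ; ℜ   = λ f → ∀ g → g ∈ ℜ → ⟨_,_⟩ _≟_ g f ≈ₖ 0ₖ
    }
    where open Presentation P

-- ⊣ a and ⊢ a stand for the words 0a and a0, in the operad of words with exactly
-- one letter 0, where u ∘ᵢ v replaces the i-th letter of u by the word v with each
-- of its letters changed to its maximum with that letter.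
data DiasGenerator (γ : ℕ) : Set where
  ⊣ ⊢ : Fin γ → DiasGenerator γ

_≟ᴰ_ : ∀ {γ} → DecidableEquality (DiasGenerator γ)
⊣ a ≟ᴰ ⊣ b = map′ (cong ⊣) (λ { ≡.refl → ≡.refl }) (a Fin.≟ b)
⊣ a ≟ᴰ ⊢ b = no λ ()
⊢ a ≟ᴰ ⊣ b = no λ ()
⊢ a ≟ᴰ ⊢ b = map′ (cong ⊢) (λ { ≡.refl → ≡.refl }) (a Fin.≟ b)

-- The element a of Fin γ stands for a + 1 ∈ [γ]; this does not affect maxima.
infixl 6 _↑_
_↑_ : ∀ {γ} → Fin γ → Fin γ → Fin γ
_↑_ {γ} = Max._⊔_ (Fin.≤-totalOrder γ)

module _ {c ℓ₁ ℓ₂} (𝕂 : HeytingField c ℓ₁ ℓ₂) (γ : ℕ) where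

  open OverField 𝕂

  private
    𝔽 : Operad c ℓ₁
    𝔽 = Free (_≟ᴰ_ {γ})

    infix 8 _∘¹_ _∘²_
    _∘¹_ _∘²_ : DiasGenerator γ → DiasGenerator γ → Operad.∣_∣ 𝔽 3
    _∘¹_ = _∘₁_ _≟ᴰ_
    _∘²_ = _∘₂_ _≟ᴰ_

    infixl 6 _⊖_
    _⊖_ : Operad.∣_∣ 𝔽 3 → Operad.∣_∣ 𝔽 3 → Operad.∣_∣ 𝔽 3
    _⊖_ = _-ᴹ_ (Operad.space 𝔽 3)

  -- Both sides of each relation evaluate to the same word of length three.
  data DiasRelation : Pred (Operad.∣_∣ 𝔽 3) c where
    rel₁ : ∀ a a′ → DiasRelation (⊣ a ∘¹ ⊢ a′        ⊖ ⊢ a′ ∘² ⊣ a)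
    rel₂ : ∀ a a′ → DiasRelation (⊣ a ∘¹ ⊣ (a ↑ a′)  ⊖ ⊣ a ∘² ⊢ a′)
    rel₃ : ∀ a a′ → DiasRelation (⊢ a ∘¹ ⊣ a′        ⊖ ⊢ a ∘² ⊢ (a ↑ a′))
    rel₄ : ∀ a a′ → DiasRelation (⊣ (a ↑ a′) ∘¹ ⊣ a  ⊖ ⊣ a ∘² ⊣ a′)
    rel₅ : ∀ a a′ → DiasRelation (⊢ a ∘¹ ⊢ a′        ⊖ ⊢ (a ↑ a′) ∘² ⊢ a)

  diasPresentation : Presentation (c ⊔ ℓ₁)
  diasPresentation = record
    { 𝔊   = DiasGenerator γ
    ; _≟_ = _≟ᴰ_
    ; ℜ   = Span (Operad.space 𝔽 3) DiasRelation
    }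

  Dias : Operad c (c ⊔ ℓ₁)
  Dias = presented diasPresentation

  Dendr : Operad c (c ⊔ ℓ₁)
  Dendr = presented (diasPresentation ^!)

{-# OPTIONS --safe #-}
-- Over the sums ≺_b of the ⊣ a with a ≤ b, and ≻_b of the ⊢ a with a ≤ b, the relations of
-- Dendr read
--   (x ≻_c y) ≺_b z = x ≻_c (y ≺_b z)
--   (x ≺_c y) ≺_b z = x ≺_{min(b,c)} (y ≺_b z + y ≻_c z)
--   x ≻_b (y ≻_c z) = (x ≺_c y + x ≻_b y) ≻_{min(b,c)} z.
-- Applied from left to right (the first one from right to left), they rewrite every element
-- of arity n as a combination of binary trees with n nodes whose edges carry labels in [γ]:
-- the tree with left branch (c , l) and right branch (b , r) stands for (l ≻_c •) ≺_b r.
-- Conversely, the same rules define operations by recursion on edge-labelled trees, which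
-- satisfy the relations of Dendr; evaluating an operation on copies of the one-node tree
-- recovers the tree it stands for, so that these trees are linearly independent. Removing
-- the root of an edge-labelled tree gives H = t (1 + γ H)².
module Submission where

open import Defs
open import Algebra.Apartness.Bundles using (HeytingField)
import Algebra.Construct.NaturalChoice.Min as Min
open import Algebra.Module.Bundles using (LeftModule)
import Algebra.Properties.CommutativeSemigroup as CommutativeSemigroupProperties
import Algebra.Properties.Ring as RingProperties
import Algebra.Properties.Semiring.Sum as SemiringSum
import Algebra.Solver.CommutativeMonoid as CommutativeMonoidSolver
open import Data.Bool.Base using (Bool; true; false; if_then_else_)
open import Data.Fin.Base using (Fin; zero; suc; toℕ)
import Data.Fin.Base as Fin using (_≤_)
import Data.Fin.Properties as Fin
open import Data.List.Base using (List; []; _∷_; _++_; map; upTo; applyUpTo; length; lookup; allFin; concatMap; cartesianProductWith)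
open import Data.List.Membership.Propositional using () renaming (_∈_ to _∈ᴸ_)
import Data.List.Membership.Propositional.Properties as Mem
import Data.List.Properties as List
import Data.List.Relation.Unary.All as All
import Data.List.Relation.Unary.All.Properties as All
open import Data.List.Relation.Unary.AllPairs as AllPairs using (_∷_)
import Data.List.Relation.Unary.AllPairs.Properties as AllPairs
open import Data.List.Relation.Unary.Any using (here; index)
import Data.List.Relation.Unary.Any.Properties as Any
open import Data.List.Relation.Unary.Unique.Propositional using (Unique)
import Data.List.Relation.Unary.Unique.Propositional.Properties as Unique
open import Data.Nat.Base using (ℕ; zero; suc; _+_; _*_; _∸_; _^_; _≤_; _<_; z≤n; s≤s; s≤s⁻¹)
import Data.Nat.ListAction as ℕ using (sum)
import Data.Nat.Properties as ℕ
open import Data.Nat.Tactic.RingSolver using (solve-∀)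
open import Data.Product.Base using (Σ-syntax; ∃-syntax; _×_; _,_; proj₁; proj₂)
open import Data.Sum.Base using (_⊎_; inj₁; inj₂)
import Data.Vec.Functional as Vector
open import Function.Base using (_∘_; id; const)
open import Level using (_⊔_)
open import Relation.Binary.Definitions using (DecidableEquality)
open import Relation.Binary.PropositionalEquality as ≡ using (_≡_; _≢_; _≗_; refl; cong; cong₂)
import Relation.Binary.Reasoning.Setoid as SetoidReasoning
open import Relation.Nullary using (¬_; yes; no; does; contradiction)
open import Relation.Nullary.Decidable using (map′; _×-dec_)
open import Relation.Unary using (Pred; _∈_)

-- Power series

-- In the generators `⊣ a` and `⊢ a` the relations of `Dendr` are tangled by the maxima `a ↑ a′`.
-- Sums over `a ≤ b` untangle them because `a ↑ a′ ≤ c` splits into `a ≤ c` and `a′ ≤ c`, while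
-- `a ≤ b` and `a ≤ c` merge into `a ≤ b ⊓ c`. The matrix of the relation `a ≤ b` is unitriangular,
-- so the change of generators can be undone. Confluence of the rewriting is never shown: rewriting
-- yields only that the trees span, and independence comes from the operations on trees. That these
-- satisfy the relations is checked on the whole annihilator at once: its elements are given by
-- three families of coefficients `β`, and an identity linear in `β` can be tested on products of
-- two indicators. Equality of scalars is not assumed decidable, so formal sums are never
-- normalised. An identity between them is stated as an identity between the values of an arbitrary
-- functional `f`; maps between formal sums become nested `eval`s, and summations are exchanged by
-- `eval-swap`.

𝟏 : PowerSeries
𝟏 zero    = 1
𝟏 (suc _) = 0

∑< : ℕ → (ℕ → ℕ) → ℕ
∑< n f = ℕ.sum (map f (upTo n))

∑<-applyUpTo : ∀ f n → ∑< n f ≡ ℕ.sum (applyUpTo f n)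
∑<-applyUpTo f n = cong ℕ.sum (List.map-upTo f n)

∑<-suc : ∀ f n → ∑< (suc n) f ≡ f 0 + ∑< n (f ∘ suc)
∑<-suc f n = ≡.trans (∑<-applyUpTo f (suc n)) (cong (f 0 +_) (≡.sym (∑<-applyUpTo (f ∘ suc) n)))

∑<-cong : ∀ {f g} n → (∀ i → i < n → f i ≡ g i) → ∑< n f ≡ ∑< n g
∑<-cong         zero    eq = refl
∑<-cong {f} {g} (suc n) eq = begin
  ∑< (suc n) f           ≡⟨ ∑<-suc f n ⟩
  f 0 + ∑< n (f ∘ suc)   ≡⟨ cong₂ _+_ (eq 0 (s≤s z≤n)) (∑<-cong n λ i i<n → eq (suc i) (s≤s i<n)) ⟩
  g 0 + ∑< n (g ∘ suc)   ≡⟨ ∑<-suc g n ⟨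
  ∑< (suc n) g           ∎
  where open ≡.≡-Reasoning

∑<-+ : ∀ f g n → ∑< n (λ i → f i + g i) ≡ ∑< n f + ∑< n g
∑<-+ f g zero    = refl
∑<-+ f g (suc n) = begin
  ∑< (suc n) (λ i → f i + g i)                          ≡⟨ ∑<-suc _ n ⟩
  f 0 + g 0 + ∑< n (λ i → f (suc i) + g (suc i))        ≡⟨ cong (f 0 + g 0 +_) (∑<-+ (f ∘ suc) (g ∘ suc) n) ⟩
  f 0 + g 0 + (∑< n (f ∘ suc) + ∑< n (g ∘ suc))         ≡⟨ interchange (f 0) _ _ _ ⟩
  f 0 + ∑< n (f ∘ suc) + (g 0 + ∑< n (g ∘ suc))         ≡⟨ cong₂ _+_ (∑<-suc f n) (∑<-suc g n) ⟨
  ∑< (suc n) f + ∑< (suc n) g                           ∎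
  where
  open ≡.≡-Reasoning
  interchange : ∀ a b c d → a + b + (c + d) ≡ a + c + (b + d)
  interchange = solve-∀

∑<-* : ∀ a f n → ∑< n (λ i → a * f i) ≡ a * ∑< n f
∑<-* a f zero    = ≡.sym (ℕ.*-zeroʳ a)
∑<-* a f (suc n) = begin
  ∑< (suc n) (λ i → a * f i)                ≡⟨ ∑<-suc _ n ⟩
  a * f 0 + ∑< n (λ i → a * f (suc i))      ≡⟨ cong (a * f 0 +_) (∑<-* a (f ∘ suc) n) ⟩
  a * f 0 + a * ∑< n (f ∘ suc)              ≡⟨ ℕ.*-distribˡ-+ a _ _ ⟨
  a * (f 0 + ∑< n (f ∘ suc))                ≡⟨ cong (a *_) (∑<-suc f n) ⟨
  a * ∑< (suc n) f                          ∎
  where open ≡.≡-Reasoning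

∑<-0 : ∀ n → ∑< n (λ _ → 0) ≡ 0
∑<-0 n = ∑<-* 0 (λ _ → 0) n

⊛-cong : ∀ {f f′ g g′} n → (∀ i → i ≤ n → f i ≡ f′ i) → (∀ i → i ≤ n → g i ≡ g′ i) →
         (f ⊛ g) n ≡ (f′ ⊛ g′) n
⊛-cong n p q = ∑<-cong (suc n) λ i i< → cong₂ _*_ (p i (s≤s⁻¹ i<)) (q (n ∸ i) (ℕ.m∸n≤m n i))

⊛-distribʳ : ∀ f g h → (f ⊕ g) ⊛ h ≗ f ⊛ h ⊕ g ⊛ h
⊛-distribʳ f g h n = ≡.trans
  (∑<-cong (suc n) λ i _ → ℕ.*-distribʳ-+ (h (n ∸ i)) (f i) (g i))
  (∑<-+ (λ i → f i * h (n ∸ i)) (λ i → g i * h (n ∸ i)) (suc n))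

⊛-distribˡ : ∀ f g h → f ⊛ (g ⊕ h) ≗ f ⊛ g ⊕ f ⊛ h
⊛-distribˡ f g h n = ≡.trans
  (∑<-cong (suc n) λ i _ → ℕ.*-distribˡ-+ (f i) (g (n ∸ i)) (h (n ∸ i)))
  (∑<-+ (λ i → f i * g (n ∸ i)) (λ i → f i * h (n ∸ i)) (suc n))

•-⊛ : ∀ a f g → (a • f) ⊛ g ≗ a • (f ⊛ g)
•-⊛ a f g n = ≡.trans
  (∑<-cong (suc n) λ i _ → ℕ.*-assoc a (f i) (g (n ∸ i))) (∑<-* a _ (suc n))

⊛-• : ∀ a f g → f ⊛ (a • g) ≗ a • (f ⊛ g)
⊛-• a f g n = ≡.trans
  (∑<-cong (suc n) λ i _ → x*ay (f i) a (g (n ∸ i))) (∑<-* a _ (suc n))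
  where
  x*ay : ∀ x a y → x * (a * y) ≡ a * (x * y)
  x*ay = solve-∀

⊛-identityˡ : ∀ f → 𝟏 ⊛ f ≗ f
⊛-identityˡ f n = begin
  (𝟏 ⊛ f) n                                ≡⟨ ∑<-suc _ n ⟩
  f n + 0 + ∑< n (λ i → 0)                 ≡⟨ cong (f n + 0 +_) (∑<-0 n) ⟩
  f n + 0 + 0                              ≡⟨ ≡.trans (ℕ.+-identityʳ _) (ℕ.+-identityʳ _) ⟩
  f n                                      ∎
  where open ≡.≡-Reasoning

⊛-identityʳ : ∀ f → f ⊛ 𝟏 ≗ f
⊛-identityʳ f zero    = ≡.trans (ℕ.+-identityʳ _) (ℕ.*-identityʳ _)
⊛-identityʳ f (suc n) = begin
  (f ⊛ 𝟏) (suc n)                          ≡⟨ ∑<-suc (λ i → f i * 𝟏 (suc n ∸ i)) (suc n) ⟩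
  f 0 * 0 + ((f ∘ suc) ⊛ 𝟏) n              ≡⟨ cong₂ _+_ (ℕ.*-zeroʳ (f 0)) (⊛-identityʳ (f ∘ suc) n) ⟩
  f (suc n)                                ∎
  where open ≡.≡-Reasoning

-- The term with index 0 vanishes, and from index 1 on the coefficients of `𝕥` are those of `𝟏`.
𝕥-⊛ : ∀ f n → (𝕥 ⊛ f) (suc n) ≡ f n
𝕥-⊛ f n = begin
  (𝕥 ⊛ f) (suc n)                          ≡⟨ ∑<-suc (λ i → 𝕥 i * f (suc n ∸ i)) (suc n) ⟩
  ∑< (suc n) (λ i → 𝕥 (suc i) * f (n ∸ i)) ≡⟨ ∑<-cong (suc n) (λ { zero _ → refl ; (suc _) _ → refl }) ⟩
  (𝟏 ⊛ f) n                                ≡⟨ ⊛-identityˡ f n ⟩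
  f n                                      ∎
  where open ≡.≡-Reasoning

-- The hypothesis says that H = t (1 + γ H)².
square⇒equation : ∀ γ (H : PowerSeries) → H 0 ≡ 0 →
  (∀ n → H (suc n) ≡ ((𝟏 ⊕ γ • H) ⊛ (𝟏 ⊕ γ • H)) n) →
  H ≗ 𝕥 ⊕ (2 * γ) • (𝕥 ⊛ H) ⊕ (γ ^ 2) • (𝕥 ⊛ (H ⊛ H))
square⇒equation γ H H0 eq zero
  rewrite H0 | ℕ.*-zeroʳ (2 * γ) | ℕ.*-zeroʳ (γ ^ 2) = refl
square⇒equation γ H H0 eq (suc n) = begin
  H (suc n)
    ≡⟨ eq n ⟩
  (o ⊛ o) n
    ≡⟨ ⊛-distribʳ 𝟏 (γ • H) o n ⟩
  (𝟏 ⊛ o) n + ((γ • H) ⊛ o) n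
    ≡⟨ cong₂ _+_ (⊛-identityˡ o n) (≡.trans (•-⊛ γ H o n) (cong (γ *_) (⊛-distribˡ H 𝟏 (γ • H) n))) ⟩
  𝟏 n + γ * H n + γ * ((H ⊛ 𝟏) n + (H ⊛ (γ • H)) n)
    ≡⟨ cong (λ k → 𝟏 n + γ * H n + γ * k) (cong₂ _+_ (⊛-identityʳ H n) (⊛-• γ H H n)) ⟩
  𝟏 n + γ * H n + γ * (H n + γ * (H ⊛ H) n)
    ≡⟨ expand (𝟏 n) γ (H n) ((H ⊛ H) n) ⟩
  𝟏 n + (2 * γ) * H n + (γ ^ 2) * (H ⊛ H) n
    ≡⟨ cong₂ _+_ (cong₂ _+_ (𝟏≡𝕥 n) (cong (2 * γ *_) (≡.sym (𝕥-⊛ H n)))) (cong (γ ^ 2 *_) (≡.sym (𝕥-⊛ (H ⊛ H) n))) ⟩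
  𝕥 (suc n) + (2 * γ) * (𝕥 ⊛ H) (suc n) + (γ ^ 2) * (𝕥 ⊛ (H ⊛ H)) (suc n) ∎
  where
  open ≡.≡-Reasoning
  o : PowerSeries
  o = 𝟏 ⊕ γ • H
  expand : ∀ e g h s → e + g * h + g * (h + g * s) ≡ e + 2 * g * h + g * (g * 1) * s
  expand = solve-∀
  𝟏≡𝕥 : ∀ n → 𝟏 n ≡ 𝕥 (suc n)
  𝟏≡𝕥 zero    = refl
  𝟏≡𝕥 (suc _) = refl

-- Lists: injective indexing and lengths

module _ {a} {A : Set a} where

  lookup-injective : ∀ {xs : List A} → Unique xs → ∀ i j → lookup xs i ≡ lookup xs j → i ≡ j
  lookup-injective (x∉ ∷ u) zero    zero    _  = refl
  lookup-injective (x∉ ∷ u) zero    (suc j) eq = contradiction eq (All.lookup x∉ (Mem.∈-lookup j))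
  lookup-injective (x∉ ∷ u) (suc i) zero    eq = contradiction (≡.sym eq) (All.lookup x∉ (Mem.∈-lookup i))
  lookup-injective (x∉ ∷ u) (suc i) (suc j) eq = cong suc (lookup-injective u i j eq)

length-cartesianProductWith : ∀ {A B C : Set} (f : A → B → C) xs ys →
  length (cartesianProductWith f xs ys) ≡ length xs * length ys
length-cartesianProductWith f []       ys = refl
length-cartesianProductWith f (x ∷ xs) ys = ≡.trans (List.length-++ (map (f x) ys))
  (cong₂ _+_ (List.length-map (f x) ys) (length-cartesianProductWith f xs ys))

length-concatMap : ∀ {A B : Set} (f : A → List B) xs →
                   length (concatMap f xs) ≡ ℕ.sum (map (length ∘ f) xs)
length-concatMap f []       = refl
length-concatMap f (x ∷ xs) = ≡.trans (List.length-++ (f x)) (cong (length (f x) +_) (length-concatMap f xs))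

-- Edge-labelled trees

module EdgeValued (γ : ℕ) where

  infix 5 _•ᵗ_
  infix 6 _–_

  mutual
    data EdgeTree : Set where
      _•ᵗ_ : Branch → Branch → EdgeTree

    data Branch : Set where
      ∅   : Branch
      _–_ : Fin γ → EdgeTree → Branch

  mutual
    size : EdgeTree → ℕ
    size (l •ᵗ r) = suc (branchSize l + branchSize r)

    branchSize : Branch → ℕ
    branchSize ∅       = 0
    branchSize (_ – e) = size e

  •ᵗ-injective : ∀ {l r l′ r′} → l •ᵗ r ≡ l′ •ᵗ r′ → l ≡ l′ × r ≡ r′
  •ᵗ-injective refl = refl , refl

  –-injective : ∀ {a b e f} → a – e ≡ b – f → a ≡ b × e ≡ f
  –-injective refl = refl , refl

  mutual
    _≟ᵗ_ : DecidableEquality EdgeTree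
    (l •ᵗ r) ≟ᵗ (l′ •ᵗ r′) =
      map′ (λ (p , q) → cong₂ _•ᵗ_ p q) •ᵗ-injective (l ≟ᵇ l′ ×-dec r ≟ᵇ r′)

    _≟ᵇ_ : DecidableEquality Branch
    ∅       ≟ᵇ ∅       = yes refl
    ∅       ≟ᵇ (_ – _) = no λ ()
    (_ – _) ≟ᵇ ∅       = no λ ()
    (a – e) ≟ᵇ (b – f) =
      map′ (λ (p , q) → cong₂ _–_ p q) –-injective (a Fin.≟ b ×-dec e ≟ᵗ f)

  -- `B k` is meant to list the branches of size `k`, so `i` is the size of the left branch. Sorting
  -- by it makes the number of trees a Cauchy product.
  joinsAt : (ℕ → List Branch) → ℕ → ℕ → List EdgeTree
  joinsAt B n i = cartesianProductWith _•ᵗ_ (B i) (B (n ∸ i))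

  joins : (ℕ → List Branch) → ℕ → List EdgeTree
  joins B n = concatMap (joinsAt B n) (upTo (suc n))

  -- The first argument is fuel: the list is complete once it is at least the size n.
  branches : ℕ → ℕ → List Branch
  branches _       zero    = ∅ ∷ []
  branches zero    (suc n) = []
  branches (suc d) (suc n) = cartesianProductWith _–_ (allFin γ) (joins (branches d) n)

  trees : ℕ → List EdgeTree
  trees zero    = []
  trees (suc n) = joins (branches n) n

  count : PowerSeries
  count n = length (trees n)

  length-joins : ∀ B n → length (joins B n) ≡ ((length ∘ B) ⊛ (length ∘ B)) n
  length-joins B n = ≡.trans (length-concatMap (joinsAt B n) (upTo (suc n)))
    (∑<-cong (suc n) λ i _ → length-cartesianProductWith _•ᵗ_ (B i) (B (n ∸ i)))

  length-branches-suc : ∀ d n → length (branches (suc d) (suc n)) ≡ γ * length (joins (branches d) n)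
  length-branches-suc d n = ≡.trans
    (length-cartesianProductWith _–_ (allFin γ) (joins (branches d) n))
    (cong (_* length (joins (branches d) n)) (List.length-tabulate {n = γ} id))

  length-joins-cong : ∀ B B′ n → (∀ i → i ≤ n → length (B i) ≡ length (B′ i)) →
                      length (joins B n) ≡ length (joins B′ n)
  length-joins-cong B B′ n eq =
    ≡.trans (length-joins B n) (≡.trans (⊛-cong n eq eq) (≡.sym (length-joins B′ n)))

  -- The list for size `suc n` consults only sizes up to `n`, so one unit of fuel per step is enough
  -- and a surplus changes nothing.
  length-branches-fuel : ∀ d d′ n → n ≤ d → n ≤ d′ → length (branches d n) ≡ length (branches d′ n)
  length-branches-fuel d       d′       zero    _         _          = refl
  length-branches-fuel (suc d) (suc d′) (suc n) (s≤s n≤d) (s≤s n≤d′) = begin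
    length (branches (suc d) (suc n))    ≡⟨ length-branches-suc d n ⟩
    γ * length (joins (branches d) n)    ≡⟨ cong (γ *_) (length-joins-cong (branches d) (branches d′) n λ i i≤n →
      length-branches-fuel d d′ i (ℕ.≤-trans i≤n n≤d) (ℕ.≤-trans i≤n n≤d′)) ⟩
    γ * length (joins (branches d′) n)   ≡⟨ length-branches-suc d′ n ⟨
    length (branches (suc d′) (suc n))   ∎
    where open ≡.≡-Reasoning

  -- A branch is empty or a label followed by a tree, whence `1 + γ H`. The fuel `d` is exchanged
  -- for the fuel `n` that is built into `trees (suc n)`.
  length-branches : ∀ d n → n ≤ d → length (branches d n) ≡ (𝟏 ⊕ γ • count) n
  length-branches d       zero    _         = cong suc (≡.sym (ℕ.*-zeroʳ γ))
  length-branches (suc d) (suc n) (s≤s n≤d) = ≡.trans (length-branches-suc d n)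
    (cong (γ *_) (length-joins-cong (branches d) (branches n) n λ i i≤n →
      length-branches-fuel d n i (ℕ.≤-trans i≤n n≤d) i≤n))

  count-equation : count ≗ 𝕥 ⊕ (2 * γ) • (𝕥 ⊛ count) ⊕ (γ ^ 2) • (𝕥 ⊛ (count ⊛ count))
  count-equation = square⇒equation γ count refl λ n → ≡.trans (length-joins (branches n) n)
    (⊛-cong n (length-branches n) (length-branches n))

  ∈-joins⁺ : ∀ {B l r n} → branchSize l + branchSize r ≡ n →
             l ∈ᴸ B (branchSize l) → r ∈ᴸ B (branchSize r) → l •ᵗ r ∈ᴸ joins B n
  ∈-joins⁺ {B} {l} {r} {n} refl l∈ r∈ = Mem.∈-concat⁺′ here′ (Mem.∈-map⁺ (joinsAt B n) (Mem.∈-upTo⁺ (s≤s (ℕ.m≤m+n _ _))))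
    where
    here′ : l •ᵗ r ∈ᴸ joinsAt B n (branchSize l)
    here′ = Mem.∈-cartesianProductWith⁺ _•ᵗ_ l∈
      (≡.subst (λ k → r ∈ᴸ B k) (≡.sym (ℕ.m+n∸m≡n (branchSize l) _)) r∈)

  ∈-joinsAt⁻ : ∀ {B} → (∀ k {b} → b ∈ᴸ B k → branchSize b ≡ k) → ∀ {n i l r} →
               l •ᵗ r ∈ᴸ joinsAt B n i → branchSize l ≡ i × branchSize r ≡ n ∸ i
  ∈-joinsAt⁻ {B} sized {n} {i} e∈
    with _ , _ , l∈ , r∈ , refl ← Mem.∈-cartesianProductWith⁻ _•ᵗ_ (B i) (B (n ∸ i)) e∈ =
    sized i l∈ , sized (n ∸ i) r∈

  ∈-joins⁻ : ∀ {B} → (∀ k {b} → b ∈ᴸ B k → branchSize b ≡ k) → ∀ {n e} → e ∈ᴸ joins B n → size e ≡ suc n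
  ∈-joins⁻ {B} sized {n} {l •ᵗ r} e∈
    with _ , e∈i , i∈ ← Mem.∈-concat⁻′ (map (joinsAt B n) (upTo (suc n))) e∈
    with i , i∈ , refl ← Mem.∈-map⁻ (joinsAt B n) i∈
    with refl , eq ← ∈-joinsAt⁻ {B} sized {n} {i} e∈i =
    cong suc (≡.trans (cong (branchSize l +_) eq) (ℕ.m+[n∸m]≡n (s≤s⁻¹ (Mem.∈-upTo⁻ i∈))))

  ∈-branches⁻ : ∀ d n {b} → b ∈ᴸ branches d n → branchSize b ≡ n
  ∈-branches⁻ d       zero    (here refl) = refl
  ∈-branches⁻ (suc d) (suc n) b∈
    with _ , _ , _ , e∈ , refl ← Mem.∈-cartesianProductWith⁻ _–_ (allFin γ) (joins (branches d) n) b∈ =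
    ∈-joins⁻ (∈-branches⁻ d) e∈

  mutual
    ∈-branches⁺ : ∀ d b → branchSize b ≤ d → b ∈ᴸ branches d (branchSize b)
    ∈-branches⁺ d       ∅              _        = here refl
    ∈-branches⁺ (suc d) (a – e@(_ •ᵗ _)) (s≤s ≤d) =
      Mem.∈-cartesianProductWith⁺ _–_ (Mem.∈-allFin a) (∈-joins-branches d e ≤d)

    ∈-joins-branches : ∀ d e {n} → {{size e ≡ suc n}} → n ≤ d → e ∈ᴸ joins (branches d) n
    ∈-joins-branches d (l •ᵗ r) {{refl}} ≤d = ∈-joins⁺ {branches d} refl
      (∈-branches⁺ d l (ℕ.≤-trans (ℕ.m≤m+n _ _) ≤d))
      (∈-branches⁺ d r (ℕ.≤-trans (ℕ.m≤n+m _ _) ≤d))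

  ∈-trees⁺ : ∀ {n} e → size e ≡ n → e ∈ᴸ trees n
  ∈-trees⁺ e@(_ •ᵗ _) refl = ∈-joins-branches _ e {{refl}} ℕ.≤-refl

  ∈-trees⁻ : ∀ n {e} → e ∈ᴸ trees n → size e ≡ n
  ∈-trees⁻ (suc n) = ∈-joins⁻ (∈-branches⁻ n)

  -- The lists for different `i` are disjoint because `i` can be read off a tree as the size of its
  -- left branch.
  Unique-joins : ∀ {B} → (∀ k {b} → b ∈ᴸ B k → branchSize b ≡ k) → ∀ n →
                 (∀ k → Unique (B k)) → Unique (joins B n)
  Unique-joins {B} sized n u = Unique.concat⁺
    (All.map⁺ (All.universal (λ i → Unique.cartesianProductWith⁺ _•ᵗ_ •ᵗ-injective (u i) (u (n ∸ i))) _))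
    (AllPairs.map⁺ (AllPairs.map (λ {i} {j} i≢j {e} → disjoint i≢j e) (Unique.upTo⁺ (suc n))))
    where
    disjoint : ∀ {i j} → i ≢ j → ∀ e → ¬ (e ∈ᴸ joinsAt B n i × e ∈ᴸ joinsAt B n j)
    disjoint {i} {j} i≢j (l •ᵗ r) (p , q) = i≢j (≡.trans
      (≡.sym (proj₁ (∈-joinsAt⁻ {B} sized {n} {i} p))) (proj₁ (∈-joinsAt⁻ {B} sized {n} {j} q)))

  Unique-branches : ∀ d n → Unique (branches d n)
  Unique-branches d       zero    = All.[] ∷ AllPairs.[]
  Unique-branches zero    (suc n) = AllPairs.[]
  Unique-branches (suc d) (suc n) = Unique.cartesianProductWith⁺ _–_ –-injective
    (Unique.allFin⁺ γ) (Unique-joins (∈-branches⁻ d) n (Unique-branches d))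

  Unique-trees : ∀ n → Unique (trees n)
  Unique-trees zero    = AllPairs.[]
  Unique-trees (suc n) = Unique-joins (∈-branches⁻ n) n (Unique-branches n)

-- Formal sums and initial segments of Fin γ

infixl 7 _⊓_
_⊓_ : ∀ {γ} → Fin γ → Fin γ → Fin γ
_⊓_ {γ} = Min._⊓_ (Fin.≤-totalOrder γ)

⊓-assoc : ∀ {γ} (a b c : Fin γ) → a ⊓ b ⊓ c ≡ a ⊓ (b ⊓ c)
⊓-assoc {γ} = Min.⊓-assoc (Fin.≤-totalOrder γ)

⊓-comm : ∀ {γ} (a b : Fin γ) → a ⊓ b ≡ b ⊓ a
⊓-comm {γ} = Min.⊓-comm (Fin.≤-totalOrder γ)

module FormalSums {c ℓ₁ ℓ₂} (𝕂 : HeytingField c ℓ₁ ℓ₂) where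

  open OverField 𝕂 public
  open K public using ()
    renaming (Carrier to 𝕜; _+_ to _+ₖ_; _*_ to _*ₖ_; -_ to -ₖ_; 0# to 0ₖ; 1# to 1ₖ; _≈_ to _≈ₖ_)
  module KP = RingProperties K.ring
  module K+ = CommutativeSemigroupProperties K.+-commutativeSemigroup
  module K* = CommutativeSemigroupProperties K.*-commutativeSemigroup
  open SemiringSum K.semiring public using (sum; sum-cong-≋; ∑-distrib-+; ∑-comm; *-distribˡ-sum; *-distribʳ-sum)
  open SetoidReasoning K.setoid

  sum-0 : ∀ {n} (h : Fin n → 𝕜) → (∀ i → h i ≈ₖ 0ₖ) → sum h ≈ₖ 0ₖ
  sum-0 {zero}  h h≈0 = K.refl
  sum-0 {suc n} h h≈0 = K.trans (K.+-cong (h≈0 zero) (sum-0 (h ∘ suc) (h≈0 ∘ suc))) (K.+-identityˡ _)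

  eval-sum : ∀ {X : Set} {n} (h : Fin n → X → 𝕜) v →
             eval (λ x → sum λ i → h i x) v ≈ₖ sum (λ i → eval (h i) v)
  eval-sum {n = zero}  h v = eval-const0 v
  eval-sum {n = suc n} h v = K.trans (eval-+ (h zero) _ v) (K.+-congˡ (eval-sum (h ∘ suc) v))

  ⨁ : ∀ {X : Set} {n} → (Fin n → Formal X) → Formal X
  ⨁ = Vector.foldr _++_ []

  eval-⨁ : ∀ {X : Set} {n} f (v : Fin n → Formal X) → eval f (⨁ v) ≈ₖ sum (λ i → eval f (v i))
  eval-⨁ {n = zero}  f v = K.refl
  eval-⨁ {n = suc n} f v = K.trans (eval-++ f (v zero) _) (K.+-congˡ (eval-⨁ f (v ∘ suc)))

  pure : ∀ {X : Set} → X → Formal X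
  pure x = (1ₖ , x) ∷ []

  eval-pure : ∀ {X : Set} f (x : X) → eval f (pure x) ≈ₖ f x
  eval-pure f x = K.trans (K.+-identityʳ _) (K.*-identityˡ _)

  mapᶠ : ∀ {X Y : Set} → (X → Y) → Formal X → Formal Y
  mapᶠ g = map λ (a , x) → a , g x

  eval-mapᶠ : ∀ {X Y : Set} f (g : X → Y) v → eval f (mapᶠ g v) ≡ eval (f ∘ g) v
  eval-mapᶠ f g []            = ≡.refl
  eval-mapᶠ f g ((a , x) ∷ v) = cong (a *ₖ f (g x) +ₖ_) (eval-mapᶠ f g v)

  bind : ∀ {X Y : Set} → Formal X → (X → Formal Y) → Formal Y
  bind []            k = []
  bind ((a , x) ∷ v) k = a · k x ++ bind v k

  eval-bind : ∀ {X Y : Set} f v (k : X → Formal Y) → eval f (bind v k) ≈ₖ eval (eval f ∘ k) v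
  eval-bind f []            k = K.refl
  eval-bind f ((a , x) ∷ v) k =
    K.trans (eval-++ f (a · k x) _) (K.+-cong (eval-· f a (k x)) (eval-bind f v k))

  -- The indicator of `a ≤ b`, that is, the zeta function of the chain `Fin γ`.
  ζ : ∀ {γ} → Fin γ → Fin γ → 𝕜
  ζ zero    _       = 1ₖ
  ζ (suc a) zero    = 0ₖ
  ζ (suc a) (suc b) = ζ a b

  ζ-lower : ∀ {γ} {b c : Fin γ} a → b Fin.≤ c → ζ a b *ₖ ζ a c ≈ₖ ζ a b
  ζ-lower                       zero    _         = K.*-identityˡ _
  ζ-lower {b = zero}            (suc a) _         = K.zeroˡ _
  ζ-lower {b = suc b} {c = suc c} (suc a) (s≤s b≤c) = ζ-lower a b≤c

  ζ-upper : ∀ {γ} {a b : Fin γ} c → a Fin.≤ b → ζ a c *ₖ ζ b c ≈ₖ ζ b c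
  ζ-upper {a = zero}              c       _         = K.*-identityˡ _
  ζ-upper {a = suc a} {b = suc b} zero    _         = K.zeroˡ _
  ζ-upper {a = suc a} {b = suc b} (suc c) (s≤s a≤b) = ζ-upper c a≤b

  ζ-⊓ : ∀ {γ} (a b c : Fin γ) → ζ a b *ₖ ζ a c ≈ₖ ζ a (b ⊓ c)
  ζ-⊓ {γ} a b c with Fin.≤-total b c
  ... | inj₁ b≤c = ζ-lower a b≤c
  ... | inj₂ c≤b = K.trans (K.*-comm _ _) (ζ-lower a c≤b)

  ζ-↑ : ∀ {γ} (a b c : Fin γ) → ζ a c *ₖ ζ b c ≈ₖ ζ (a ↑ b) c
  ζ-↑ a b c with Fin.≤-total b a
  ... | inj₁ b≤a = K.trans (K.*-comm _ _) (ζ-upper c b≤a)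
  ... | inj₂ a≤b = ζ-upper c a≤b

  -- Unitriangularity: on nonzero labels the functions `ζ _ (suc b)` are those of the shorter chain,
  -- and `ζ _ zero`, which is supported at `zero`, then corrects the value there.
  ζ-combination : ∀ {γ} (g : Fin γ → 𝕜) → Σ[ h ∈ (Fin γ → 𝕜) ] ∀ a → sum (λ b → h b *ₖ ζ a b) ≈ₖ g a
  ζ-combination {zero}  g = (λ ()) , λ ()
  ζ-combination {suc γ} g with ζ-combination (g ∘ suc)
  ... | h , eq = h′ , λ
    { zero → begin
        (g zero +ₖ -ₖ sum h) *ₖ 1ₖ +ₖ sum (λ b → h b *ₖ 1ₖ)
          ≈⟨ K.+-cong (K.*-identityʳ _) (sum-cong-≋ λ b → K.*-identityʳ (h b)) ⟩
        g zero +ₖ -ₖ sum h +ₖ sum h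
          ≈⟨ K.+-assoc _ _ _ ⟩
        g zero +ₖ (-ₖ sum h +ₖ sum h)
          ≈⟨ K.+-congˡ (K.-‿inverseˡ _) ⟩
        g zero +ₖ 0ₖ
          ≈⟨ K.+-identityʳ _ ⟩
        g zero ∎
    ; (suc a) → K.trans (K.+-congʳ (K.zeroʳ _)) (K.trans (K.+-identityˡ _) (eq a)) }
    where
    h′ : Fin (suc γ) → 𝕜
    h′ zero    = g zero +ₖ -ₖ sum h
    h′ (suc b) = h b

  -- Δ p a is the difference of p a and of p at the predecessor of a, if any.
  Δ : ∀ {X : Set} {γ} → (Fin γ → Formal X) → Fin γ → Formal X
  Δ p zero    = p zero
  Δ p (suc a) = Δ (λ b → p (suc b) ++ (-ₖ 1ₖ) · p zero) a

  -- Möbius inversion on a chain: the differences up to `b` telescope.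
  sum-ζ-Δ : ∀ {X : Set} {γ} f (p : Fin γ → Formal X) b →
            sum (λ a → ζ a b *ₖ eval f (Δ p a)) ≈ₖ eval f (p b)
  sum-ζ-Δ f p zero    = begin
    1ₖ *ₖ eval f (p zero) +ₖ sum (λ a → 0ₖ *ₖ eval f (Δ p (suc a)))
      ≈⟨ K.+-cong (K.*-identityˡ _) (sum-0 (λ a → 0ₖ *ₖ eval f (Δ p (suc a))) λ a → K.zeroˡ _) ⟩
    eval f (p zero) +ₖ 0ₖ
      ≈⟨ K.+-identityʳ _ ⟩
    eval f (p zero) ∎
  sum-ζ-Δ f p (suc b) = begin
    1ₖ *ₖ eval f (p zero) +ₖ sum (λ a → ζ a b *ₖ eval f (Δ p (suc a)))
      ≈⟨ K.+-cong (K.*-identityˡ _) (sum-ζ-Δ f _ b) ⟩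
    eval f (p zero) +ₖ eval f (p (suc b) ++ (-ₖ 1ₖ) · p zero)
      ≈⟨ K.+-congˡ (K.trans (eval-++ f (p (suc b)) _)
           (K.+-congˡ (K.trans (eval-· f _ (p zero)) (KP.-1*x≈-x _)))) ⟩
    eval f (p zero) +ₖ (eval f (p (suc b)) +ₖ -ₖ eval f (p zero))
      ≈⟨ K+.x∙yz≈y∙xz _ _ _ ⟩
    eval f (p (suc b)) +ₖ (eval f (p zero) +ₖ -ₖ eval f (p zero))
      ≈⟨ K.+-congˡ (K.-‿inverseʳ _) ⟩
    eval f (p (suc b)) +ₖ 0ₖ
      ≈⟨ K.+-identityʳ _ ⟩
    eval f (p (suc b)) ∎

  sum₂ : ∀ {m n} → (Fin m → Fin n → 𝕜) → 𝕜
  sum₂ h = sum λ a → sum λ b → h a b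

  sum₂-cong : ∀ {m n} {g h : Fin m → Fin n → 𝕜} → (∀ a b → g a b ≈ₖ h a b) → sum₂ g ≈ₖ sum₂ h
  sum₂-cong eq = sum-cong-≋ λ a → sum-cong-≋ (eq a)

  sum₂-+ : ∀ {m n} (g h : Fin m → Fin n → 𝕜) → sum₂ (λ a b → g a b +ₖ h a b) ≈ₖ sum₂ g +ₖ sum₂ h
  sum₂-+ g h = K.trans (sum-cong-≋ λ a → ∑-distrib-+ (g a) (h a)) (∑-distrib-+ (sum ∘ g) (sum ∘ h))

  sum₂-* : ∀ {m n} x (g : Fin m → Fin n → 𝕜) → sum₂ (λ a b → x *ₖ g a b) ≈ₖ x *ₖ sum₂ g
  sum₂-* x g = K.sym (K.trans (*-distribˡ-sum x (sum ∘ g)) (sum-cong-≋ λ a → *-distribˡ-sum x (g a)))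

  sum₂-sep : ∀ {m n} (g : Fin m → 𝕜) (h : Fin m → Fin n → 𝕜) →
             sum₂ (λ a b → g a *ₖ h a b) ≈ₖ sum (λ a → g a *ₖ sum (h a))
  sum₂-sep g h = sum-cong-≋ λ a → K.sym (*-distribˡ-sum (g a) (h a))

  sum₂-0 : ∀ {m n} (h : Fin m → Fin n → 𝕜) → (∀ a b → h a b ≈ₖ 0ₖ) → sum₂ h ≈ₖ 0ₖ
  sum₂-0 h h≈0 = sum-0 _ λ a → sum-0 (h a) (h≈0 a)

  private
    on : ∀ {γ} → (Fin γ → Fin γ → 𝕜) → Fin γ × Fin γ → 𝕜
    on g (x , y) = g x y

  -- The functions (x , y) ↦ ζ x b * ζ y c form a basis of the functions of x and y.
  ζ-determined : ∀ {γ} (v w : Formal (Fin γ × Fin γ)) →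
                 (∀ b c → eval (on λ x y → ζ x b *ₖ ζ y c) v ≈ₖ eval (on λ x y → ζ x b *ₖ ζ y c) w) →
                 ∀ β → eval (on β) v ≈ₖ eval (on β) w
  ζ-determined {γ} v w agree β = begin
    eval (on β) v
      ≈⟨ expansion v ⟩
    sum₂ (λ b c → h b c *ₖ eval (on λ x y → ζ x b *ₖ ζ y c) v)
      ≈⟨ sum₂-cong (λ b c → K.*-congˡ (agree b c)) ⟩
    sum₂ (λ b c → h b c *ₖ eval (on λ x y → ζ x b *ₖ ζ y c) w)
      ≈⟨ expansion w ⟨
    eval (on β) w ∎
    where
    -- `β` is expanded in its first variable for each fixed `y`; the resulting coefficients, as
    -- functions of `y`, are then expanded in turn.
    outer : ∀ y → Σ[ h ∈ (Fin γ → 𝕜) ] ∀ x → sum (λ b → h b *ₖ ζ x b) ≈ₖ β x y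
    outer y = ζ-combination λ x → β x y
    inner : ∀ b → Σ[ h ∈ (Fin γ → 𝕜) ] ∀ y → sum (λ c → h c *ₖ ζ y c) ≈ₖ proj₁ (outer y) b
    inner b = ζ-combination λ y → proj₁ (outer y) b
    h : Fin γ → Fin γ → 𝕜
    h b = proj₁ (inner b)
    expand : ∀ x y → sum₂ (λ b c → h b c *ₖ (ζ x b *ₖ ζ y c)) ≈ₖ β x y
    expand x y = begin
      sum₂ (λ b c → h b c *ₖ (ζ x b *ₖ ζ y c))
        ≈⟨ sum₂-cong (λ b c → K*.x∙yz≈y∙xz (h b c) _ _) ⟩
      sum₂ (λ b c → ζ x b *ₖ (h b c *ₖ ζ y c))
        ≈⟨ sum₂-sep (ζ x) (λ b c → h b c *ₖ ζ y c) ⟩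
      sum (λ b → ζ x b *ₖ sum (λ c → h b c *ₖ ζ y c))
        ≈⟨ sum-cong-≋ (λ b → K.trans (K.*-congˡ (proj₂ (inner b) y)) (K.*-comm _ _)) ⟩
      sum (λ b → proj₁ (outer y) b *ₖ ζ x b)
        ≈⟨ proj₂ (outer y) x ⟩
      β x y ∎
    expansion : ∀ v → eval (on β) v ≈ₖ sum₂ (λ b c → h b c *ₖ eval (on λ x y → ζ x b *ₖ ζ y c) v)
    expansion v = begin
      eval (on β) v
        ≈⟨ eval-cong (λ (x , y) → expand x y) v ⟨
      eval (λ (x , y) → sum₂ λ b c → h b c *ₖ (ζ x b *ₖ ζ y c)) v
        ≈⟨ eval-sum (λ b (x , y) → sum λ c → h b c *ₖ (ζ x b *ₖ ζ y c)) v ⟩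
      sum (λ b → eval (λ (x , y) → sum λ c → h b c *ₖ (ζ x b *ₖ ζ y c)) v)
        ≈⟨ sum-cong-≋ (λ b → eval-sum (λ c (x , y) → h b c *ₖ (ζ x b *ₖ ζ y c)) v) ⟩
      sum₂ (λ b c → eval (λ (x , y) → h b c *ₖ (ζ x b *ₖ ζ y c)) v)
        ≈⟨ sum₂-cong (λ b c → eval-* (h b c) (on λ x y → ζ x b *ₖ ζ y c) v) ⟩
      sum₂ (λ b c → h b c *ₖ eval (on λ x y → ζ x b *ₖ ζ y c) v) ∎

  private
    -- The weight `p x y` is moved to the point `k x y`. Maxima inside the arguments of `β` thus go
    -- into `k`, and the sum becomes a functional of `β` given by one formal sum.
    scatter : ∀ {γ} → (Fin γ → Fin γ → Fin γ × Fin γ) → (Fin γ → Fin γ → 𝕜) → Formal (Fin γ × Fin γ)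
    scatter k p = ⨁ λ x → ⨁ λ y → (p x y , k x y) ∷ []

    eval-scatter : ∀ {γ} g (k : Fin γ → Fin γ → Fin γ × Fin γ) p →
                   eval g (scatter k p) ≈ₖ sum₂ (λ x y → g (k x y) *ₖ p x y)
    eval-scatter g k p = K.trans (eval-⨁ g λ x → ⨁ λ y → (p x y , k x y) ∷ [])
      (sum-cong-≋ λ x → K.trans (eval-⨁ g λ y → (p x y , k x y) ∷ [])
        (sum-cong-≋ λ y → K.trans (K.+-identityʳ (p x y *ₖ g (k x y))) (K.*-comm _ _)))

  sum₂-determined : ∀ {γ} (p q : Fin γ → Fin γ → 𝕜) →
    (∀ b c → sum₂ (λ x y → (ζ x b *ₖ ζ y c) *ₖ p x y) ≈ₖ sum₂ (λ x y → (ζ x b *ₖ ζ y c) *ₖ q x y)) →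
    ∀ β → sum₂ (λ x y → β x y *ₖ p x y) ≈ₖ sum₂ (λ x y → β x y *ₖ q x y)
  sum₂-determined p q segments β = K.trans (K.sym (eval-scatter (on β) _,_ p))
    (K.trans (ζ-determined (scatter _,_ p) (scatter _,_ q) agree β) (eval-scatter (on β) _,_ q))
    where
    agree : ∀ b c → eval (on λ x y → ζ x b *ₖ ζ y c) (scatter _,_ p) ≈ₖ
                    eval (on λ x y → ζ x b *ₖ ζ y c) (scatter _,_ q)
    agree b c = K.trans (eval-scatter (on λ x y → ζ x b *ₖ ζ y c) _,_ p)
      (K.trans (segments b c) (K.sym (eval-scatter (on λ x y → ζ x b *ₖ ζ y c) _,_ q)))

  -- Both sides are linear in `β`, so products of two indicators suffice. On these, `ζ-↑` removes
  -- the maximum and `ζ-⊓` merges the two conditions on `x`, which leaves the hypothesis.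
  sum₂-determined-↑ : ∀ {γ} (p q r : Fin γ → Fin γ → 𝕜) →
    (∀ b c → sum₂ (λ x y → (ζ x b *ₖ ζ y c) *ₖ p x y) ≈ₖ
             sum₂ (λ x y → (ζ x (b ⊓ c) *ₖ ζ y c) *ₖ q x y) +ₖ
             sum₂ (λ x y → (ζ x (b ⊓ c) *ₖ ζ y b) *ₖ r x y)) →
    ∀ β → sum₂ (λ x y → β x y *ₖ p x y) ≈ₖ
          sum₂ (λ x y → β x (x ↑ y) *ₖ q x y) +ₖ sum₂ (λ x y → β (x ↑ y) x *ₖ r x y)
  sum₂-determined-↑ {γ} p q r segments β = K.trans (K.sym (eval-scatter (on β) _,_ p))
    (K.trans (ζ-determined (scatter _,_ p) qr agree β) (eval-qr β))
    where
    qr : Formal (Fin γ × Fin γ)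
    qr = scatter (λ x y → x , x ↑ y) q ++ scatter (λ x y → x ↑ y , x) r
    eval-qr : ∀ g → eval (on g) qr ≈ₖ
      sum₂ (λ x y → g x (x ↑ y) *ₖ q x y) +ₖ sum₂ (λ x y → g (x ↑ y) x *ₖ r x y)
    eval-qr g = K.trans (eval-++ (on g) (scatter (λ x y → x , x ↑ y) q) _)
      (K.+-cong (eval-scatter (on g) (λ x y → x , x ↑ y) q) (eval-scatter (on g) (λ x y → x ↑ y , x) r))
    agree : ∀ b c → eval (on λ x y → ζ x b *ₖ ζ y c) (scatter _,_ p) ≈ₖ eval (on λ x y → ζ x b *ₖ ζ y c) qr
    agree b c = begin
      eval (on λ x y → ζ x b *ₖ ζ y c) (scatter _,_ p)
        ≈⟨ eval-scatter (on λ x y → ζ x b *ₖ ζ y c) _,_ p ⟩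
      sum₂ (λ x y → (ζ x b *ₖ ζ y c) *ₖ p x y)
        ≈⟨ segments b c ⟩
      sum₂ (λ x y → (ζ x (b ⊓ c) *ₖ ζ y c) *ₖ q x y) +ₖ sum₂ (λ x y → (ζ x (b ⊓ c) *ₖ ζ y b) *ₖ r x y)
        ≈⟨ K.+-cong
             (sum₂-cong λ x y → K.*-congʳ (K.trans (K.*-congˡ (K.sym (ζ-↑ x y c)))
               (K.trans (K.sym (K.*-assoc _ _ _)) (K.*-congʳ (ζ-⊓ x b c)))))
             (sum₂-cong λ x y → K.*-congʳ (K.trans (K.*-congʳ (K.sym (ζ-↑ x y b)))
               (K.trans (K*.xy∙z≈xz∙y _ _ _) (K.*-congʳ (ζ-⊓ x b c))))) ⟨
      sum₂ (λ x y → (ζ x b *ₖ ζ (x ↑ y) c) *ₖ q x y) +ₖ sum₂ (λ x y → (ζ (x ↑ y) b *ₖ ζ x c) *ₖ r x y)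
        ≈⟨ eval-qr (λ x y → ζ x b *ₖ ζ y c) ⟨
      eval (on λ x y → ζ x b *ₖ ζ y c) qr ∎

-- Operations on edge-labelled trees

module Model {c ℓ₁ ℓ₂} (𝕂 : HeytingField c ℓ₁ ℓ₂) (γ : ℕ) where

  open FormalSums 𝕂 public
  open EdgeValued γ public
  open SetoidReasoning K.setoid

  -- In terms of the generators of Dendr, s ≺[ b ] t stands for the sum of the s ⊣ a t
  -- with a ≤ b, and s ≻[ b ] t for that of the s ⊢ a t with a ≤ b.
  mutual
    _≺[_]_ : EdgeTree → Fin γ → EdgeTree → Formal EdgeTree
    (l •ᵗ r) ≺[ b ] t = mapᶠ (l •ᵗ_) (r ◁[ b ] t)

    _◁[_]_ : Branch → Fin γ → EdgeTree → Formal Branch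
    ∅       ◁[ b ] t = pure (b – t)
    (d – s) ◁[ b ] t = mapᶠ (b ⊓ d –_) (s ≺[ b ] t ++ s ≻[ d ] t)

    _≻[_]_ : EdgeTree → Fin γ → EdgeTree → Formal EdgeTree
    s ≻[ b ] (l •ᵗ r) = mapᶠ (_•ᵗ r) (s ▷[ b ] l)

    _▷[_]_ : EdgeTree → Fin γ → Branch → Formal Branch
    s ▷[ b ] ∅       = pure (b – s)
    s ▷[ b ] (d – t) = mapᶠ (d ⊓ b –_) (s ≺[ d ] t ++ s ≻[ b ] t)

  -- `≻` alters only the left branch of the middle tree and `≺` only its right branch, so the two
  -- operations commute.
  ≺-≻-assoc : ∀ f s b t d u → eval (λ v → eval f (v ≺[ d ] u)) (s ≻[ b ] t) ≈ₖ
                              eval (λ v → eval f (s ≻[ b ] v)) (t ≺[ d ] u)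
  ≺-≻-assoc f s b (l •ᵗ r) d u = begin
    eval (λ v → eval f (v ≺[ d ] u)) (mapᶠ (_•ᵗ r) (s ▷[ b ] l))
      ≡⟨ eval-mapᶠ _ (_•ᵗ r) (s ▷[ b ] l) ⟩
    eval (λ l′ → eval f (mapᶠ (l′ •ᵗ_) (r ◁[ d ] u))) (s ▷[ b ] l)
      ≈⟨ eval-cong (λ l′ → K.reflexive (eval-mapᶠ f (l′ •ᵗ_) (r ◁[ d ] u))) (s ▷[ b ] l) ⟩
    eval (λ l′ → eval (λ r′ → f (l′ •ᵗ r′)) (r ◁[ d ] u)) (s ▷[ b ] l)
      ≈⟨ eval-swap _ (s ▷[ b ] l) (r ◁[ d ] u) ⟩
    eval (λ r′ → eval (λ l′ → f (l′ •ᵗ r′)) (s ▷[ b ] l)) (r ◁[ d ] u)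
      ≈⟨ eval-cong (λ r′ → K.reflexive (eval-mapᶠ f (_•ᵗ r′) (s ▷[ b ] l))) (r ◁[ d ] u) ⟨
    eval (λ r′ → eval f (mapᶠ (_•ᵗ r′) (s ▷[ b ] l))) (r ◁[ d ] u)
      ≡⟨ eval-mapᶠ _ (l •ᵗ_) (r ◁[ d ] u) ⟨
    eval (λ v → eval f (s ≻[ b ] v)) (mapᶠ (l •ᵗ_) (r ◁[ d ] u)) ∎

  eval-◁ : ∀ f d s b t → eval f ((d – s) ◁[ b ] t) ≈ₖ
           eval (λ v → f (b ⊓ d – v)) (s ≺[ b ] t) +ₖ eval (λ v → f (b ⊓ d – v)) (s ≻[ d ] t)
  eval-◁ f d s b t = K.trans (K.reflexive (eval-mapᶠ f (b ⊓ d –_) (s ≺[ b ] t ++ s ≻[ d ] t)))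
    (eval-++ _ (s ≺[ b ] t) _)

  eval-▷ : ∀ f s b d t → eval f (s ▷[ b ] (d – t)) ≈ₖ
           eval (λ v → f (d ⊓ b – v)) (s ≺[ d ] t) +ₖ eval (λ v → f (d ⊓ b – v)) (s ≻[ b ] t)
  eval-▷ f s b d t = K.trans (K.reflexive (eval-mapᶠ f (d ⊓ b –_) (s ≺[ d ] t ++ s ≻[ b ] t)))
    (eval-++ _ (s ≺[ d ] t) _)

  mutual
    -- One level down, the subtree needs all three associativities, hence the mutual induction with
    -- `≻-≻-assoc`. The middle tree `t` stays fixed and each round shrinks one of the outer trees,
    -- so the recursion ends.
    ≺-≺-assoc : ∀ f s d t b u →
                eval (λ v → eval f (v ≺[ b ] u)) (s ≺[ d ] t) ≈ₖ
                eval (λ v → eval f (s ≺[ b ⊓ d ] v)) (t ≺[ b ] u ++ t ≻[ d ] u)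
    ≺-≺-assoc f (l •ᵗ r) d t b u = begin
      eval (λ v → eval f (v ≺[ b ] u)) (mapᶠ (l •ᵗ_) (r ◁[ d ] t))
        ≡⟨ eval-mapᶠ _ (l •ᵗ_) (r ◁[ d ] t) ⟩
      eval (λ r′ → eval f (mapᶠ (l •ᵗ_) (r′ ◁[ b ] u))) (r ◁[ d ] t)
        ≈⟨ eval-cong (λ r′ → K.reflexive (eval-mapᶠ f (l •ᵗ_) (r′ ◁[ b ] u))) (r ◁[ d ] t) ⟩
      eval (λ r′ → eval (f ∘ (l •ᵗ_)) (r′ ◁[ b ] u)) (r ◁[ d ] t)
        ≈⟨ ◁-≺-assoc (f ∘ (l •ᵗ_)) r d t b u ⟩
      eval (λ v → eval (f ∘ (l •ᵗ_)) (r ◁[ b ⊓ d ] v)) tu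
        ≈⟨ eval-cong (λ v → K.reflexive (eval-mapᶠ f (l •ᵗ_) (r ◁[ b ⊓ d ] v))) tu ⟨
      eval (λ v → eval f (mapᶠ (l •ᵗ_) (r ◁[ b ⊓ d ] v))) tu ∎
      where
      tu : Formal EdgeTree
      tu = t ≺[ b ] u ++ t ≻[ d ] u

    ◁-≺-assoc : ∀ f r d t b u →
                eval (λ r′ → eval f (r′ ◁[ b ] u)) (r ◁[ d ] t) ≈ₖ
                eval (λ v → eval f (r ◁[ b ⊓ d ] v)) (t ≺[ b ] u ++ t ≻[ d ] u)
    ◁-≺-assoc f ∅       d t b u = begin
      eval (λ r′ → eval f (r′ ◁[ b ] u)) (pure (d – t))
        ≈⟨ eval-pure (λ r′ → eval f (r′ ◁[ b ] u)) (d – t) ⟩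
      eval f (mapᶠ (b ⊓ d –_) (t ≺[ b ] u ++ t ≻[ d ] u))
        ≡⟨ eval-mapᶠ f (b ⊓ d –_) (t ≺[ b ] u ++ t ≻[ d ] u) ⟩
      eval (λ v → f (b ⊓ d – v)) (t ≺[ b ] u ++ t ≻[ d ] u)
        ≈⟨ eval-cong (λ v → eval-pure f (b ⊓ d – v)) (t ≺[ b ] u ++ t ≻[ d ] u) ⟨
      eval (λ v → eval f (pure (b ⊓ d – v))) (t ≺[ b ] u ++ t ≻[ d ] u) ∎
    ◁-≺-assoc f (e – w) d t b u = begin
      eval (λ r′ → eval f (r′ ◁[ b ] u)) ((e – w) ◁[ d ] t)
        ≡⟨ eval-mapᶠ _ (d ⊓ e –_) (w ≺[ d ] t ++ w ≻[ e ] t) ⟩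
      eval (λ v → eval f ((d ⊓ e – v) ◁[ b ] u)) (w ≺[ d ] t ++ w ≻[ e ] t)
        ≈⟨ eval-cong (λ v → eval-◁ f (d ⊓ e) v b u) (w ≺[ d ] t ++ w ≻[ e ] t) ⟩
      eval (λ v → eval g (v ≺[ b ] u) +ₖ eval g (v ≻[ d ⊓ e ] u)) (w ≺[ d ] t ++ w ≻[ e ] t)
        ≈⟨ eval-+ _ _ (w ≺[ d ] t ++ w ≻[ e ] t) ⟩
      -- With the labels dropped, this is the computation by which the three relations add up to
      -- associativity of the sum of both operations: `≺-≺-assoc`, `≺-≻-assoc` and `≻-≻-assoc`
      -- account for one term each.
      eval (λ v → eval g (v ≺[ b ] u)) (w ≺[ d ] t ++ w ≻[ e ] t) +ₖ
      eval (λ v → eval g (v ≻[ d ⊓ e ] u)) (w ≺[ d ] t ++ w ≻[ e ] t)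
        ≈⟨ K.+-cong (eval-++ _ (w ≺[ d ] t) _) (K.sym (≻-≻-assoc g w e t d u)) ⟩
      eval (λ v → eval g (v ≺[ b ] u)) (w ≺[ d ] t) +ₖ
      eval (λ v → eval g (v ≺[ b ] u)) (w ≻[ e ] t) +ₖ
      eval (λ v → eval g (w ≻[ e ] v)) (t ≻[ d ] u)
        ≈⟨ K.+-congʳ (K.+-cong (≺-≺-assoc g w d t b u) (≺-≻-assoc g w e t b u)) ⟩
      eval (λ v → eval g (w ≺[ b ⊓ d ] v)) tu +ₖ
      eval (λ v → eval g (w ≻[ e ] v)) (t ≺[ b ] u) +ₖ
      eval (λ v → eval g (w ≻[ e ] v)) (t ≻[ d ] u)
        ≈⟨ K.trans (K.+-assoc _ _ _) (K.+-congˡ (K.sym (eval-++ _ (t ≺[ b ] u) _))) ⟩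
      eval (λ v → eval g (w ≺[ b ⊓ d ] v)) tu +ₖ eval (λ v → eval g (w ≻[ e ] v)) tu
        ≈⟨ eval-+ _ _ tu ⟨
      eval (λ v → eval g (w ≺[ b ⊓ d ] v) +ₖ eval g (w ≻[ e ] v)) tu
        ≈⟨ eval-cong (λ v → K.+-cong (relabel (w ≺[ b ⊓ d ] v)) (relabel (w ≻[ e ] v))) tu ⟩
      eval (λ v → eval (λ x → f (b ⊓ d ⊓ e – x)) (w ≺[ b ⊓ d ] v) +ₖ
                  eval (λ x → f (b ⊓ d ⊓ e – x)) (w ≻[ e ] v)) tu
        ≈⟨ eval-cong (λ v → eval-◁ f e w (b ⊓ d) v) tu ⟨
      eval (λ v → eval f ((e – w) ◁[ b ⊓ d ] v)) tu ∎
      where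
      tu : Formal EdgeTree
      tu = t ≺[ b ] u ++ t ≻[ d ] u
      g : EdgeTree → 𝕜
      g v = f (b ⊓ (d ⊓ e) – v)
      relabel : ∀ v → eval g v ≈ₖ eval (λ x → f (b ⊓ d ⊓ e – x)) v
      relabel = eval-cong λ x → K.reflexive (cong (λ k → f (k – x)) (≡.sym (⊓-assoc b d e)))

    ≻-≻-assoc : ∀ f s b t d u →
                eval (λ v → eval f (s ≻[ b ] v)) (t ≻[ d ] u) ≈ₖ
                eval (λ v → eval f (v ≻[ d ⊓ b ] u)) (s ≺[ d ] t ++ s ≻[ b ] t)
    ≻-≻-assoc f s b t d (l •ᵗ r) = begin
      eval (λ v → eval f (s ≻[ b ] v)) (mapᶠ (_•ᵗ r) (t ▷[ d ] l))
        ≡⟨ eval-mapᶠ _ (_•ᵗ r) (t ▷[ d ] l) ⟩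
      eval (λ l′ → eval f (mapᶠ (_•ᵗ r) (s ▷[ b ] l′))) (t ▷[ d ] l)
        ≈⟨ eval-cong (λ l′ → K.reflexive (eval-mapᶠ f (_•ᵗ r) (s ▷[ b ] l′))) (t ▷[ d ] l) ⟩
      eval (λ l′ → eval (f ∘ (_•ᵗ r)) (s ▷[ b ] l′)) (t ▷[ d ] l)
        ≈⟨ ▷-≻-assoc (f ∘ (_•ᵗ r)) s b t d l ⟩
      eval (λ v → eval (f ∘ (_•ᵗ r)) (v ▷[ d ⊓ b ] l)) st
        ≈⟨ eval-cong (λ v → K.reflexive (eval-mapᶠ f (_•ᵗ r) (v ▷[ d ⊓ b ] l))) st ⟨
      eval (λ v → eval f (mapᶠ (_•ᵗ r) (v ▷[ d ⊓ b ] l))) st ∎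
      where
      st : Formal EdgeTree
      st = s ≺[ d ] t ++ s ≻[ b ] t

    ▷-≻-assoc : ∀ f s b t d l →
                eval (λ l′ → eval f (s ▷[ b ] l′)) (t ▷[ d ] l) ≈ₖ
                eval (λ v → eval f (v ▷[ d ⊓ b ] l)) (s ≺[ d ] t ++ s ≻[ b ] t)
    ▷-≻-assoc f s b t d ∅       = begin
      eval (λ l′ → eval f (s ▷[ b ] l′)) (pure (d – t))
        ≈⟨ eval-pure (λ l′ → eval f (s ▷[ b ] l′)) (d – t) ⟩
      eval f (mapᶠ (d ⊓ b –_) (s ≺[ d ] t ++ s ≻[ b ] t))
        ≡⟨ eval-mapᶠ f (d ⊓ b –_) (s ≺[ d ] t ++ s ≻[ b ] t) ⟩
      eval (λ v → f (d ⊓ b – v)) (s ≺[ d ] t ++ s ≻[ b ] t)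
        ≈⟨ eval-cong (λ v → eval-pure f (d ⊓ b – v)) (s ≺[ d ] t ++ s ≻[ b ] t) ⟨
      eval (λ v → eval f (pure (d ⊓ b – v))) (s ≺[ d ] t ++ s ≻[ b ] t) ∎
    ▷-≻-assoc f s b t d (e – w) = begin
      eval (λ l′ → eval f (s ▷[ b ] l′)) (t ▷[ d ] (e – w))
        ≡⟨ eval-mapᶠ _ (e ⊓ d –_) (t ≺[ e ] w ++ t ≻[ d ] w) ⟩
      eval (λ v → eval f (s ▷[ b ] (e ⊓ d – v))) (t ≺[ e ] w ++ t ≻[ d ] w)
        ≈⟨ eval-cong (λ v → eval-▷ f s b (e ⊓ d) v) (t ≺[ e ] w ++ t ≻[ d ] w) ⟩
      eval (λ v → eval g (s ≺[ e ⊓ d ] v) +ₖ eval g (s ≻[ b ] v)) (t ≺[ e ] w ++ t ≻[ d ] w)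
        ≈⟨ eval-+ _ _ (t ≺[ e ] w ++ t ≻[ d ] w) ⟩
      eval (λ v → eval g (s ≺[ e ⊓ d ] v)) (t ≺[ e ] w ++ t ≻[ d ] w) +ₖ
      eval (λ v → eval g (s ≻[ b ] v)) (t ≺[ e ] w ++ t ≻[ d ] w)
        ≈⟨ K.+-cong (K.sym (≺-≺-assoc g s d t e w)) (eval-++ _ (t ≺[ e ] w) _) ⟩
      eval (λ v → eval g (v ≺[ e ] w)) (s ≺[ d ] t) +ₖ
      (eval (λ v → eval g (s ≻[ b ] v)) (t ≺[ e ] w) +ₖ
       eval (λ v → eval g (s ≻[ b ] v)) (t ≻[ d ] w))
        ≈⟨ K.+-congˡ (K.+-cong (K.sym (≺-≻-assoc g s b t e w)) (≻-≻-assoc g s b t d w)) ⟩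
      eval (λ v → eval g (v ≺[ e ] w)) (s ≺[ d ] t) +ₖ
      (eval (λ v → eval g (v ≺[ e ] w)) (s ≻[ b ] t) +ₖ
       eval (λ v → eval g (v ≻[ d ⊓ b ] w)) st)
        ≈⟨ K.trans (K.sym (K.+-assoc _ _ _)) (K.+-congʳ (K.sym (eval-++ _ (s ≺[ d ] t) _))) ⟩
      eval (λ v → eval g (v ≺[ e ] w)) st +ₖ eval (λ v → eval g (v ≻[ d ⊓ b ] w)) st
        ≈⟨ eval-+ _ _ st ⟨
      eval (λ v → eval g (v ≺[ e ] w) +ₖ eval g (v ≻[ d ⊓ b ] w)) st
        ≈⟨ eval-cong (λ v → K.+-cong (relabel (v ≺[ e ] w)) (relabel (v ≻[ d ⊓ b ] w))) st ⟩
      eval (λ v → eval (λ x → f (e ⊓ (d ⊓ b) – x)) (v ≺[ e ] w) +ₖ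
                  eval (λ x → f (e ⊓ (d ⊓ b) – x)) (v ≻[ d ⊓ b ] w)) st
        ≈⟨ eval-cong (λ v → eval-▷ f v (d ⊓ b) e w) st ⟨
      eval (λ v → eval f (v ▷[ d ⊓ b ] (e – w))) st ∎
      where
      st : Formal EdgeTree
      st = s ≺[ d ] t ++ s ≻[ b ] t
      g : EdgeTree → 𝕜
      g v = f (e ⊓ d ⊓ b – v)
      relabel : ∀ v → eval g v ≈ₖ eval (λ x → f (e ⊓ (d ⊓ b) – x)) v
      relabel = eval-cong λ x → K.reflexive (cong (λ k → f (k – x)) (⊓-assoc e d b))

  -- As `≺[ b ]` and `≻[ b ]` stand for sums over `a ≤ b`, a single generator acts by a difference
  -- of consecutive ones.
  act : DiasGenerator γ → EdgeTree → EdgeTree → Formal EdgeTree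
  act (⊣ a) s t = Δ (λ b → s ≺[ b ] t) a
  act (⊢ a) s t = Δ (λ b → s ≻[ b ] t) a

  -- The composites `x ∘₁ y` and `x ∘₂ y` applied to `s`, `t`, `u`, as seen by `f`.
  act₁ act₂ : (EdgeTree → 𝕜) → DiasGenerator γ → DiasGenerator γ → EdgeTree → EdgeTree → EdgeTree → 𝕜
  act₁ f x y s t u = eval (λ v → eval f (act x v u)) (act y s t)
  act₂ f x y s t u = eval (λ v → eval f (act x s v)) (act y t u)

  sum₂-ζ-Δ : ∀ {X Y : Set} f (q : X → Fin γ → Formal Y) (p : Fin γ → Formal X) b c →
             sum₂ (λ x y → (ζ x b *ₖ ζ y c) *ₖ eval (λ v → eval f (Δ (q v) x)) (Δ p y)) ≈ₖ
             eval (λ v → eval f (q v b)) (p c)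
  sum₂-ζ-Δ f q p b c = begin
    sum₂ (λ x y → (ζ x b *ₖ ζ y c) *ₖ h x y)
      ≈⟨ ∑-comm (λ x y → (ζ x b *ₖ ζ y c) *ₖ h x y) ⟩
    sum₂ (λ y x → (ζ x b *ₖ ζ y c) *ₖ h x y)
      ≈⟨ sum₂-cong (λ y x → K*.xy∙z≈y∙xz (ζ x b) (ζ y c) (h x y)) ⟩
    sum₂ (λ y x → ζ y c *ₖ (ζ x b *ₖ h x y))
      ≈⟨ sum₂-sep (λ y → ζ y c) (λ y x → ζ x b *ₖ h x y) ⟩
    sum (λ y → ζ y c *ₖ sum (λ x → ζ x b *ₖ h x y))
      ≈⟨ sum-cong-≋ (λ y → K.*-congˡ (inner y)) ⟩
    sum (λ y → ζ y c *ₖ eval (λ v → eval f (q v b)) (Δ p y))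
      ≈⟨ sum-ζ-Δ _ p c ⟩
    eval (λ v → eval f (q v b)) (p c) ∎
    where
    h : Fin γ → Fin γ → 𝕜
    h x y = eval (λ v → eval f (Δ (q v) x)) (Δ p y)
    inner : ∀ y → sum (λ x → ζ x b *ₖ h x y) ≈ₖ eval (λ v → eval f (q v b)) (Δ p y)
    inner y = begin
      sum (λ x → ζ x b *ₖ h x y)
        ≈⟨ sum-cong-≋ (λ x → eval-* (ζ x b) (λ v → eval f (Δ (q v) x)) (Δ p y)) ⟨
      sum (λ x → eval (λ v → ζ x b *ₖ eval f (Δ (q v) x)) (Δ p y))
        ≈⟨ eval-sum (λ x v → ζ x b *ₖ eval f (Δ (q v) x)) (Δ p y) ⟨
      eval (λ v → sum (λ x → ζ x b *ₖ eval f (Δ (q v) x))) (Δ p y)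
        ≈⟨ eval-cong (λ v → sum-ζ-Δ f (q v) b) (Δ p y) ⟩
      eval (λ v → eval f (q v b)) (Δ p y) ∎

  module _ (f : EdgeTree → 𝕜) (s t u : EdgeTree) where

    -- Here `β` will be a family of free coefficients of an element of the annihilator. On products
    -- of indicators the differences `Δ` sum back to `≺` and `≻`, and the identity becomes
    -- `≺-≻-assoc`. The next two lemmas reduce in the same way to `≺-≺-assoc` and `≻-≻-assoc`.
    act-⊣⊢ : ∀ β → sum₂ (λ x y → β x y *ₖ act₁ f (⊣ x) (⊢ y) s t u) ≈ₖ
                   sum₂ (λ x y → β x y *ₖ act₂ f (⊢ y) (⊣ x) s t u)
    act-⊣⊢ = sum₂-determined _ _ λ b c → begin
      sum₂ (λ x y → (ζ x b *ₖ ζ y c) *ₖ act₁ f (⊣ x) (⊢ y) s t u)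
        ≈⟨ sum₂-ζ-Δ f (λ v b → v ≺[ b ] u) (λ c → s ≻[ c ] t) b c ⟩
      eval (λ v → eval f (v ≺[ b ] u)) (s ≻[ c ] t)
        ≈⟨ ≺-≻-assoc f s c t b u ⟩
      eval (λ v → eval f (s ≻[ c ] v)) (t ≺[ b ] u)
        ≈⟨ sum₂-ζ-Δ f (λ v c → s ≻[ c ] v) (λ b → t ≺[ b ] u) c b ⟨
      sum₂ (λ y x → (ζ y c *ₖ ζ x b) *ₖ act₂ f (⊢ y) (⊣ x) s t u)
        ≈⟨ ∑-comm (λ y x → (ζ y c *ₖ ζ x b) *ₖ act₂ f (⊢ y) (⊣ x) s t u) ⟩
      sum₂ (λ x y → (ζ y c *ₖ ζ x b) *ₖ act₂ f (⊢ y) (⊣ x) s t u)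
        ≈⟨ sum₂-cong (λ x y → K.*-congʳ {act₂ f (⊢ y) (⊣ x) s t u} (K.*-comm (ζ y c) (ζ x b))) ⟩
      sum₂ (λ x y → (ζ x b *ₖ ζ y c) *ₖ act₂ f (⊢ y) (⊣ x) s t u) ∎

    act-⊣⊣ : ∀ β → sum₂ (λ x y → β x y *ₖ act₁ f (⊣ x) (⊣ y) s t u) ≈ₖ
                   sum₂ (λ x y → β x (x ↑ y) *ₖ act₂ f (⊣ x) (⊢ y) s t u) +ₖ
                   sum₂ (λ x y → β (x ↑ y) x *ₖ act₂ f (⊣ x) (⊣ y) s t u)
    act-⊣⊣ = sum₂-determined-↑ _ _ _ λ b c → begin
      sum₂ (λ x y → (ζ x b *ₖ ζ y c) *ₖ act₁ f (⊣ x) (⊣ y) s t u)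
        ≈⟨ sum₂-ζ-Δ f (λ v b → v ≺[ b ] u) (λ c → s ≺[ c ] t) b c ⟩
      eval (λ v → eval f (v ≺[ b ] u)) (s ≺[ c ] t)
        ≈⟨ ≺-≺-assoc f s c t b u ⟩
      eval (λ v → eval f (s ≺[ b ⊓ c ] v)) (t ≺[ b ] u ++ t ≻[ c ] u)
        ≈⟨ K.trans (eval-++ _ (t ≺[ b ] u) _) (K.+-comm _ _) ⟩
      eval (λ v → eval f (s ≺[ b ⊓ c ] v)) (t ≻[ c ] u) +ₖ
      eval (λ v → eval f (s ≺[ b ⊓ c ] v)) (t ≺[ b ] u)
        ≈⟨ K.+-cong (sum₂-ζ-Δ f (λ v b → s ≺[ b ] v) (λ c → t ≻[ c ] u) (b ⊓ c) c)
                    (sum₂-ζ-Δ f (λ v b → s ≺[ b ] v) (λ c → t ≺[ c ] u) (b ⊓ c) b) ⟨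
      sum₂ (λ x y → (ζ x (b ⊓ c) *ₖ ζ y c) *ₖ act₂ f (⊣ x) (⊢ y) s t u) +ₖ
      sum₂ (λ x y → (ζ x (b ⊓ c) *ₖ ζ y b) *ₖ act₂ f (⊣ x) (⊣ y) s t u) ∎

    act-⊢⊢ : ∀ β → sum₂ (λ x y → β x y *ₖ act₂ f (⊢ x) (⊢ y) s t u) ≈ₖ
                   sum₂ (λ x y → β x (x ↑ y) *ₖ act₁ f (⊢ x) (⊣ y) s t u) +ₖ
                   sum₂ (λ x y → β (x ↑ y) x *ₖ act₁ f (⊢ x) (⊢ y) s t u)
    act-⊢⊢ = sum₂-determined-↑ _ _ _ λ b c → begin
      sum₂ (λ x y → (ζ x b *ₖ ζ y c) *ₖ act₂ f (⊢ x) (⊢ y) s t u)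
        ≈⟨ sum₂-ζ-Δ f (λ v b → s ≻[ b ] v) (λ c → t ≻[ c ] u) b c ⟩
      eval (λ v → eval f (s ≻[ b ] v)) (t ≻[ c ] u)
        ≈⟨ ≻-≻-assoc f s b t c u ⟩
      eval (λ v → eval f (v ≻[ c ⊓ b ] u)) (s ≺[ c ] t ++ s ≻[ b ] t)
        ≡⟨ cong (λ d → eval (λ v → eval f (v ≻[ d ] u)) (s ≺[ c ] t ++ s ≻[ b ] t)) (⊓-comm c b) ⟩
      eval (λ v → eval f (v ≻[ b ⊓ c ] u)) (s ≺[ c ] t ++ s ≻[ b ] t)
        ≈⟨ eval-++ _ (s ≺[ c ] t) _ ⟩
      eval (λ v → eval f (v ≻[ b ⊓ c ] u)) (s ≺[ c ] t) +ₖ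
      eval (λ v → eval f (v ≻[ b ⊓ c ] u)) (s ≻[ b ] t)
        ≈⟨ K.+-cong (sum₂-ζ-Δ f (λ v b → v ≻[ b ] u) (λ c → s ≺[ c ] t) (b ⊓ c) c)
                    (sum₂-ζ-Δ f (λ v b → v ≻[ b ] u) (λ c → s ≻[ c ] t) (b ⊓ c) b) ⟨
      sum₂ (λ x y → (ζ x (b ⊓ c) *ₖ ζ y c) *ₖ act₁ f (⊢ x) (⊣ y) s t u) +ₖ
      sum₂ (λ x y → (ζ x (b ⊓ c) *ₖ ζ y b) *ₖ act₁ f (⊢ x) (⊢ y) s t u) ∎

-- Elements of arity three and the annihilator of the relations of Dias

module _ {G : Set} where

  leaves≢0 : ∀ (t : Tree G) → ¬ leaves t ≡ 0
  leaves≢0 t eq with leaves t | leaves>0 t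
  leaves≢0 t () | suc _ | _

  leaves≡1 : ∀ (t : Tree G) → leaves t ≡ 1 → t ≡ leaf
  leaves≡1 leaf         _  = refl
  leaves≡1 (node _ l r) eq with leaves l in p | leaves r in q
  ... | zero  | _     = contradiction p (leaves≢0 l)
  ... | suc _ | zero  = contradiction q (leaves≢0 r)
  leaves≡1 (node _ l r) () | suc zero | suc _
  leaves≡1 (node _ l r) () | suc (suc _) | suc _

  leaves≡2 : ∀ (t : Tree G) → leaves t ≡ 2 → ∃[ x ] t ≡ node x leaf leaf
  leaves≡2 (node x l r) eq with leaves l in p | leaves r in q
  ... | zero        | _     = contradiction p (leaves≢0 l)
  ... | suc _       | zero  = contradiction q (leaves≢0 r)
  ... | suc zero    | suc zero with refl ← leaves≡1 l p | refl ← leaves≡1 r q = x , refl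
  leaves≡2 (node x l r) () | suc zero | suc (suc _)
  leaves≡2 (node x l r) () | suc (suc zero) | suc _
  leaves≡2 (node x l r) () | suc (suc (suc _)) | suc _

  leftComb rightComb : G → G → TreeOf G 3
  leftComb  x y = node x (node y leaf leaf) leaf , refl
  rightComb x y = node x leaf (node y leaf leaf) , refl

  leaves≡3 : ∀ (t : Tree G) → leaves t ≡ 3 →
             (∃[ x ] ∃[ y ] t ≡ proj₁ (leftComb x y)) ⊎ (∃[ x ] ∃[ y ] t ≡ proj₁ (rightComb x y))
  leaves≡3 (node x l r) eq with leaves l in p | leaves r in q
  ... | zero     | _    = contradiction p (leaves≢0 l)
  ... | suc _    | zero = contradiction q (leaves≢0 r)
  ... | suc zero | suc (suc zero) with refl ← leaves≡1 l p | y , refl ← leaves≡2 r q =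
    inj₂ (x , y , refl)
  leaves≡3 (node x l r) eq | suc (suc zero) | suc zero
    with y , refl ← leaves≡2 l p | refl ← leaves≡1 r q = inj₁ (x , y , refl)
  leaves≡3 (node x l r) () | suc zero | suc zero
  leaves≡3 (node x l r) () | suc zero | suc (suc (suc _))
  leaves≡3 (node x l r) () | suc (suc zero) | suc (suc _)
  leaves≡3 (node x l r) () | suc (suc (suc zero)) | suc _
  leaves≡3 (node x l r) () | suc (suc (suc (suc _))) | suc _

  data Comb : TreeOf G 3 → Set where
    left  : ∀ x y → Comb (leftComb x y)
    right : ∀ x y → Comb (rightComb x y)

  comb : ∀ t → Comb t
  comb (t , eq) with leaves≡3 t eq
  ... | inj₁ (x , y , refl) = ≡.subst Comb (TreeOf-≡ refl) (left x y)
  ... | inj₂ (x , y , refl) = ≡.subst Comb (TreeOf-≡ refl) (right x y)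

module Cubic {c ℓ₁ ℓ₂} (𝕂 : HeytingField c ℓ₁ ℓ₂) (γ : ℕ) where

  open FormalSums 𝕂
  open SetoidReasoning K.setoid

  G : Set
  G = DiasGenerator γ

  Cubic : Set c
  Cubic = Formal (TreeOf G 3)

  module δFin {γ} = FreeSpace (Fin._≟_ {γ})
  module δG = FreeSpace (_≟ᴰ_ {γ})
  module δ₃ = FreeSpace (treeOf-≟ (_≟ᴰ_ {γ}) 3)

  δ-sym : ∀ {X : Set} (_≟_ : DecidableEquality X) x y → FreeSpace.δ _≟_ x y ≡ FreeSpace.δ _≟_ y x
  δ-sym _≟_ x y with x ≟ y | y ≟ x
  ... | yes _   | yes _   = refl
  ... | no _    | no _    = refl
  ... | yes x≡y | no y≢x  = contradiction (≡.sym x≡y) y≢x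
  ... | no x≢y  | yes y≡x = contradiction (≡.sym y≡x) x≢y

  sum-δ : ∀ {γ} (h : Fin γ → 𝕜) j → sum (λ i → δFin.δ i j *ₖ h i) ≈ₖ h j
  sum-δ {suc γ} h zero    = K.trans
    (K.+-cong (K.*-identityˡ _) (sum-0 (λ i → 0ₖ *ₖ h (suc i)) λ i → K.zeroˡ _)) (K.+-identityʳ _)
  sum-δ {suc γ} h (suc j) = K.trans (K.+-cong (K.zeroˡ _) (sum-δ (h ∘ suc) j)) (K.+-identityˡ _)

  sum₂-δ : ∀ (h : Fin γ → Fin γ → 𝕜) a b → sum₂ (λ x y → (δFin.δ x a *ₖ δFin.δ y b) *ₖ h x y) ≈ₖ h a b
  sum₂-δ h a b = begin
    sum₂ (λ x y → (δFin.δ x a *ₖ δFin.δ y b) *ₖ h x y)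
      ≈⟨ sum₂-cong (λ x y → K.*-assoc (δFin.δ x a) (δFin.δ y b) (h x y)) ⟩
    sum₂ (λ x y → δFin.δ x a *ₖ (δFin.δ y b *ₖ h x y))
      ≈⟨ sum₂-sep (λ x → δFin.δ x a) (λ x y → δFin.δ y b *ₖ h x y) ⟩
    sum (λ x → δFin.δ x a *ₖ sum (λ y → δFin.δ y b *ₖ h x y))
      ≈⟨ sum-δ (λ x → sum (λ y → δFin.δ y b *ₖ h x y)) a ⟩
    sum (λ y → δFin.δ y b *ₖ h a y)
      ≈⟨ sum-δ (h a) b ⟩
    h a b ∎

  -- Writing the finite set `G` as a formal sum lets sums over `G` be exchanged with other sums by
  -- `eval-swap`.
  generators : Formal G
  generators = ⨁ (pure ∘ ⊣) ++ ⨁ (pure ∘ ⊢)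

  eval-generators : ∀ h → eval h generators ≈ₖ sum (h ∘ ⊣) +ₖ sum (h ∘ ⊢)
  eval-generators h = K.trans (eval-++ h (⨁ (pure ∘ ⊣)) _) (K.+-cong (half ⊣) (half ⊢))
    where
    half : ∀ (g : Fin γ → G) → eval h (⨁ (pure ∘ g)) ≈ₖ sum (h ∘ g)
    half g = K.trans (eval-⨁ h (pure ∘ g)) (sum-cong-≋ λ a → eval-pure h (g a))

  generators-δ : ∀ h y → eval (λ x → δG.δ x y *ₖ h x) generators ≈ₖ h y
  generators-δ h (⊣ b) = begin
    eval (λ x → δG.δ x (⊣ b) *ₖ h x) generators
      ≈⟨ eval-generators _ ⟩
    sum (λ a → δFin.δ a b *ₖ h (⊣ a)) +ₖ sum (λ a → 0ₖ *ₖ h (⊢ a))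
      ≈⟨ K.+-cong (sum-δ (h ∘ ⊣) b) (sum-0 (λ a → 0ₖ *ₖ h (⊢ a)) λ a → K.zeroˡ _) ⟩
    h (⊣ b) +ₖ 0ₖ
      ≈⟨ K.+-identityʳ _ ⟩
    h (⊣ b) ∎
  generators-δ h (⊢ b) = begin
    eval (λ x → δG.δ x (⊢ b) *ₖ h x) generators
      ≈⟨ eval-generators _ ⟩
    sum (λ a → 0ₖ *ₖ h (⊣ a)) +ₖ sum (λ a → δFin.δ a b *ₖ h (⊢ a))
      ≈⟨ K.+-cong (sum-0 (λ a → 0ₖ *ₖ h (⊣ a)) λ a → K.zeroˡ _) (sum-δ (h ∘ ⊢) b) ⟩
    0ₖ +ₖ h (⊢ b)
      ≈⟨ K.+-identityˡ _ ⟩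
    h (⊢ b) ∎

  eval² : (G → G → 𝕜) → 𝕜
  eval² h = eval (λ x → eval (h x) generators) generators

  eval²-cong : ∀ {g h} → (∀ x y → g x y ≈ₖ h x y) → eval² g ≈ₖ eval² h
  eval²-cong eq = eval-cong (λ x → eval-cong (eq x) generators) generators

  eval²-δ : ∀ (h : G → G → 𝕜) x y → eval² (λ x′ y′ → (δG.δ x′ x *ₖ δG.δ y′ y) *ₖ h x′ y′) ≈ₖ h x y
  eval²-δ h x y = begin
    eval² (λ x′ y′ → (δG.δ x′ x *ₖ δG.δ y′ y) *ₖ h x′ y′)
      ≈⟨ eval-cong (λ x′ → K.trans (eval-cong (λ y′ → K.*-assoc _ _ _) generators)
                                    (eval-* (δG.δ x′ x) _ generators)) generators ⟩
    eval (λ x′ → δG.δ x′ x *ₖ eval (λ y′ → δG.δ y′ y *ₖ h x′ y′) generators) generators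
      ≈⟨ generators-δ _ x ⟩
    eval (λ y′ → δG.δ y′ y *ₖ h x y′) generators
      ≈⟨ generators-δ (h x) y ⟩
    h x y ∎

  eval²-sum₂ : ∀ h → eval² h ≈ₖ
    (sum₂ (λ a b → h (⊣ a) (⊣ b)) +ₖ sum₂ (λ a b → h (⊣ a) (⊢ b))) +ₖ
    (sum₂ (λ a b → h (⊢ a) (⊣ b)) +ₖ sum₂ (λ a b → h (⊢ a) (⊢ b)))
  eval²-sum₂ h = K.trans (eval-generators _) (K.+-cong (half ⊣) (half ⊢))
    where
    half : ∀ (g : Fin γ → G) → sum (λ a → eval (h (g a)) generators) ≈ₖ
           sum₂ (λ a b → h (g a) (⊣ b)) +ₖ sum₂ (λ a b → h (g a) (⊢ b))
    half g = K.trans (sum-cong-≋ λ a → eval-generators (h (g a)))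
      (∑-distrib-+ (λ a → sum (λ b → h (g a) (⊣ b))) (λ a → sum (λ b → h (g a) (⊢ b))))

  δ-left-left : ∀ x y x′ y′ → δ₃.δ (leftComb x y) (leftComb x′ y′) ≈ₖ δG.δ x x′ *ₖ δG.δ y y′
  δ-left-left x y x′ y′ with x ≟ᴰ x′ | y ≟ᴰ y′
  ... | yes refl | yes refl = K.sym (K.*-identityˡ _)
  ... | yes refl | no _     = K.sym (K.zeroʳ _)
  ... | no _     | _        = K.sym (K.zeroˡ _)

  δ-right-right : ∀ x y x′ y′ → δ₃.δ (rightComb x y) (rightComb x′ y′) ≈ₖ δG.δ x x′ *ₖ δG.δ y y′
  δ-right-right x y x′ y′ with x ≟ᴰ x′ | y ≟ᴰ y′
  ... | yes refl | yes refl = K.sym (K.*-identityˡ _)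
  ... | yes refl | no _     = K.sym (K.zeroʳ _)
  ... | no _     | _        = K.sym (K.zeroˡ _)

  δ-left-right : ∀ x y x′ y′ → δ₃.δ (leftComb x y) (rightComb x′ y′) ≈ₖ 0ₖ
  δ-left-right x y x′ y′ with x ≟ᴰ x′
  ... | yes refl = K.refl
  ... | no _     = K.refl

  δ-right-left : ∀ x y x′ y′ → δ₃.δ (rightComb x y) (leftComb x′ y′) ≈ₖ 0ₖ
  δ-right-left x y x′ y′ with x ≟ᴰ x′
  ... | yes refl = K.refl
  ... | no _     = K.refl

  expand : ∀ (F : TreeOf G 3 → 𝕜) t → eval² (λ x y → δ₃.δ (leftComb x y) t *ₖ F (leftComb x y) +ₖ
                                                     δ₃.δ (rightComb x y) t *ₖ F (rightComb x y)) ≈ₖ F t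
  expand F t with comb t
  ... | left x y  = K.trans (eval²-cong λ x′ y′ → K.trans (K.+-cong
      (K.*-congʳ (δ-left-left x′ y′ x y))
      (K.trans (K.*-congʳ (δ-right-left x′ y′ x y)) (K.zeroˡ _))) (K.+-identityʳ _))
    (eval²-δ (λ x y → F (leftComb x y)) x y)
  ... | right x y = K.trans (eval²-cong λ x′ y′ → K.trans (K.+-cong
      (K.trans (K.*-congʳ (δ-left-right x′ y′ x y)) (K.zeroˡ _))
      (K.*-congʳ (δ-right-right x′ y′ x y))) (K.+-identityˡ _))
    (eval²-δ (λ x y → F (rightComb x y)) x y)

  pairing : (c₁ c₂ : G → G → 𝕜) → (TreeOf G 3 → 𝕜) → 𝕜
  pairing c₁ c₂ F = eval² λ x y → c₁ x y *ₖ F (leftComb x y) +ₖ c₂ x y *ₖ F (rightComb x y)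

  leftCoeff rightCoeff : Cubic → G → G → 𝕜
  leftCoeff  v x y = δ₃.coeff v (leftComb x y)
  rightCoeff v x y = δ₃.coeff v (rightComb x y)

  eval-cubic : ∀ F v → eval F v ≈ₖ pairing (leftCoeff v) (rightCoeff v) F
  eval-cubic F v = begin
    eval F v
      ≈⟨ eval-cong (expand F) v ⟨
    eval (λ t → eval² λ x y → term x y t) v
      ≈⟨ eval-swap _ v generators ⟩
    eval (λ x → eval (λ t → eval (λ y → term x y t) generators) v) generators
      ≈⟨ eval-cong (λ x → eval-swap _ v generators) generators ⟩
    eval² (λ x y → eval (term x y) v)
      ≈⟨ eval²-cong (λ x y → K.trans (eval-+ _ _ v) (K.+-cong (pull (leftComb x y)) (pull (rightComb x y)))) ⟩
    pairing (leftCoeff v) (rightCoeff v) F ∎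
    where
    term : G → G → TreeOf G 3 → 𝕜
    term x y t = δ₃.δ (leftComb x y) t *ₖ F (leftComb x y) +ₖ δ₃.δ (rightComb x y) t *ₖ F (rightComb x y)
    pull : ∀ s → eval (λ t → δ₃.δ s t *ₖ F s) v ≈ₖ δ₃.coeff v s *ₖ F s
    pull s = K.trans (eval-cong (λ t → K.*-comm _ _) v) (K.trans (eval-* (F s) (δ₃.δ s) v) (K.*-comm _ _))

  cubic : (c₁ c₂ : G → G → 𝕜) → Cubic
  cubic c₁ c₂ = bind generators λ x → bind generators λ y →
    (c₁ x y , leftComb x y) ∷ (c₂ x y , rightComb x y) ∷ []

  eval-cubic-form : ∀ F c₁ c₂ → eval F (cubic c₁ c₂) ≈ₖ pairing c₁ c₂ F
  eval-cubic-form F c₁ c₂ = K.trans (eval-bind F generators _)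
    (eval-cong (λ x → K.trans (eval-bind F generators _)
      (eval-cong (λ y → K.+-congˡ (K.+-identityʳ _)) generators)) generators)

  leftCoeff-cubic : ∀ c₁ c₂ x y → leftCoeff (cubic c₁ c₂) x y ≈ₖ c₁ x y
  leftCoeff-cubic c₁ c₂ x y = K.trans (eval-cubic-form (δ₃.δ (leftComb x y)) c₁ c₂)
    (K.trans (eval²-cong λ x′ y′ → K.trans (K.+-cong
        (K.trans (K.*-comm _ _) (K.*-congʳ (K.trans (δ-left-left x y x′ y′)
          (K.reflexive (≡.cong₂ _*ₖ_ (δ-sym _≟ᴰ_ x x′) (δ-sym _≟ᴰ_ y y′))))))
        (K.trans (K.*-congˡ (δ-left-right x y x′ y′)) (K.zeroʳ _))) (K.+-identityʳ _))
      (eval²-δ c₁ x y))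

  rightCoeff-cubic : ∀ c₁ c₂ x y → rightCoeff (cubic c₁ c₂) x y ≈ₖ c₂ x y
  rightCoeff-cubic c₁ c₂ x y = K.trans (eval-cubic-form (δ₃.δ (rightComb x y)) c₁ c₂)
    (K.trans (eval²-cong λ x′ y′ → K.trans (K.+-cong
        (K.trans (K.*-congˡ (δ-right-left x y x′ y′)) (K.zeroʳ _))
        (K.trans (K.*-comm _ _) (K.*-congʳ (K.trans (δ-right-right x y x′ y′)
          (K.reflexive (≡.cong₂ _*ₖ_ (δ-sym _≟ᴰ_ x x′) (δ-sym _≟ᴰ_ y y′))))))) (K.+-identityˡ _))
      (eval²-δ c₂ x y))

  -- Sums rather than differences: the form is -1 on right combs, and the right comb has coefficient
  -- -1 in each relation, so the two signs cancel.
  record Orthogonal (c₁ c₂ : G → G → 𝕜) : Set ℓ₁ where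
    field
      orth₁ : ∀ a b → c₁ (⊣ a) (⊢ b) +ₖ c₂ (⊢ b) (⊣ a) ≈ₖ 0ₖ
      orth₂ : ∀ a b → c₁ (⊣ a) (⊣ (a ↑ b)) +ₖ c₂ (⊣ a) (⊢ b) ≈ₖ 0ₖ
      orth₃ : ∀ a b → c₁ (⊢ a) (⊣ b) +ₖ c₂ (⊢ a) (⊢ (a ↑ b)) ≈ₖ 0ₖ
      orth₄ : ∀ a b → c₁ (⊣ (a ↑ b)) (⊣ a) +ₖ c₂ (⊣ a) (⊣ b) ≈ₖ 0ₖ
      orth₅ : ∀ a b → c₁ (⊢ a) (⊢ b) +ₖ c₂ (⊢ (a ↑ b)) (⊢ a) ≈ₖ 0ₖ

  pairing-relation : ∀ x y x′ y′ f →
    ⟨_,_⟩ _≟ᴰ_ (_-ᴹ_ (Operad.space (Free (_≟ᴰ_ {γ})) 3) (_∘₁_ _≟ᴰ_ x y) (_∘₂_ _≟ᴰ_ x′ y′)) f ≈ₖ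
    leftCoeff f x y +ₖ rightCoeff f x′ y′
  pairing-relation x y x′ y′ f = K.+-cong
    (K.trans (K.*-congʳ (K.*-identityˡ _)) (K.trans (K.*-identityˡ _)
      (K.trans (signed (leftComb x y)) (K.*-identityˡ _))))
    (K.trans (K.+-identityʳ _) (K.trans
      (K.*-cong (K.trans (K.*-congˡ (K.*-identityˡ _)) (K.*-identityʳ _)) (signed (rightComb x′ y′)))
      (K.trans (KP.-1*x≈-x _) (K.trans (K.-‿cong (KP.-1*x≈-x _)) (KP.-‿involutive _)))))
    where
    if-* : ∀ (b : Bool) z → (if b then z else 0ₖ) ≈ₖ z *ₖ (if b then 1ₖ else 0ₖ)
    if-* true  z = K.sym (K.*-identityʳ z)
    if-* false z = K.sym (K.zeroʳ z)
    signed : ∀ s → eval (λ t → if does (treeOf-≟ _≟ᴰ_ 3 s t) then sign _≟ᴰ_ s else 0ₖ) f ≈ₖ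
                   sign _≟ᴰ_ s *ₖ δ₃.coeff f s
    signed s = K.trans
      (eval-cong (λ t → if-* (does (treeOf-≟ _≟ᴰ_ 3 s t)) (sign _≟ᴰ_ s)) f) (eval-* _ (δ₃.δ s) f)

  Relations^⊥ : Pred Cubic _
  Relations^⊥ = Presentation.ℜ (diasPresentation 𝕂 γ ^!)

  ⊥⇒orthogonal : ∀ {f} → f ∈ Relations^⊥ → Orthogonal (leftCoeff f) (rightCoeff f)
  ⊥⇒orthogonal {f} f⊥ = record
    { orth₁ = λ a b → at (⊣ a) (⊢ b) (⊢ b) (⊣ a) (rel₁ a b)
    ; orth₂ = λ a b → at (⊣ a) (⊣ (a ↑ b)) (⊣ a) (⊢ b) (rel₂ a b)
    ; orth₃ = λ a b → at (⊢ a) (⊣ b) (⊢ a) (⊢ (a ↑ b)) (rel₃ a b)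
    ; orth₄ = λ a b → at (⊣ (a ↑ b)) (⊣ a) (⊣ a) (⊣ b) (rel₄ a b)
    ; orth₅ = λ a b → at (⊢ a) (⊢ b) (⊢ (a ↑ b)) (⊢ a) (rel₅ a b) }
    where
    at : ∀ x y x′ y′ →
         DiasRelation 𝕂 γ (_-ᴹ_ (Operad.space (Free (_≟ᴰ_ {γ})) 3) (_∘₁_ _≟ᴰ_ x y) (_∘₂_ _≟ᴰ_ x′ y′)) →
         leftCoeff f x y +ₖ rightCoeff f x′ y′ ≈ₖ 0ₖ
    at x y x′ y′ r = K.trans (K.sym (pairing-relation x y x′ y′ f)) (f⊥ _ (gen r))

  -- Pairing with `f` is a linear functional of the other argument, so vanishing passes from the
  -- relations to their span.
  orthogonal⇒⊥ : ∀ {f} → Orthogonal (leftCoeff f) (rightCoeff f) → f ∈ Relations^⊥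
  orthogonal⇒⊥ {f} o _ = go
    where
    open Orthogonal o
    φ : TreeOf G 3 → 𝕜
    φ s = eval (λ t → if does (treeOf-≟ _≟ᴰ_ 3 s t) then sign _≟ᴰ_ s else 0ₖ) f
    go : ∀ {g} → g ∈ Presentation.ℜ (diasPresentation 𝕂 γ) → eval φ g ≈ₖ 0ₖ
    go (gen (rel₁ a b)) = K.trans (pairing-relation _ _ _ _ f) (orth₁ a b)
    go (gen (rel₂ a b)) = K.trans (pairing-relation _ _ _ _ f) (orth₂ a b)
    go (gen (rel₃ a b)) = K.trans (pairing-relation _ _ _ _ f) (orth₃ a b)
    go (gen (rel₄ a b)) = K.trans (pairing-relation _ _ _ _ f) (orth₄ a b)
    go (gen (rel₅ a b)) = K.trans (pairing-relation _ _ _ _ f) (orth₅ a b)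
    go zero = K.refl
    go (add {x} {y} p q) = K.trans (eval-++ φ x y) (K.trans (K.+-cong (go p) (go q)) (K.+-identityˡ _))
    go (scal a {x} p) = K.trans (eval-· φ a x) (K.trans (K.*-congˡ (go p)) (K.zeroʳ a))
    go (resp {x} {y} x≈y p) = K.trans (K.sym (δ₃.eval-resp φ {x} {y} x≈y)) (go p)

  -- An element of the annihilator is determined by three families of coefficients,
  -- one for each kind of word with exactly one letter 0: b0a, 0ba and ba0.
  module _ {c₁ c₂ : G → G → 𝕜} (o : Orthogonal c₁ c₂) (L R : G → G → 𝕜) where

    open Orthogonal o

    private
      opposite : (g h k : Fin γ → Fin γ → 𝕜) → (∀ a b → g a b +ₖ h a b ≈ₖ 0ₖ) →
                 sum₂ (λ a b → h a b *ₖ k a b) ≈ₖ -ₖ sum₂ (λ a b → g a b *ₖ k a b)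
      opposite g h k g+h≈0 = K.trans
        (sum₂-cong λ a b → K.trans (K.*-congʳ (KP.+-inverseʳ-unique (g a b) (h a b) (g+h≈0 a b)))
          (K.trans (K.sym (KP.-‿distribˡ-* _ _)) (K.sym (KP.-1*x≈-x _))))
        (K.trans (sum₂-* (-ₖ 1ₖ) (λ a b → g a b *ₖ k a b)) (KP.-1*x≈-x _))

    -- There are eight families of coefficients, one for each shape of comb and pair of generator
    -- types. Orthogonality expresses five of them through the other three, and the sum falls into
    -- three groups, one per free family. `L` and `R` are arbitrary because the formula serves
    -- twice: for the operations on trees and for composites in the free operad.
    eval²-orthogonal : eval² (λ x y → c₁ x y *ₖ L x y +ₖ c₂ x y *ₖ R x y) ≈ₖ
      (sum₂ (λ a b → c₁ (⊣ a) (⊢ b) *ₖ L (⊣ a) (⊢ b)) +ₖ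
       -ₖ sum₂ (λ a b → c₁ (⊣ a) (⊢ b) *ₖ R (⊢ b) (⊣ a))) +ₖ
      ((sum₂ (λ a b → c₁ (⊣ a) (⊣ b) *ₖ L (⊣ a) (⊣ b)) +ₖ
        -ₖ (sum₂ (λ a b → c₁ (⊣ a) (⊣ (a ↑ b)) *ₖ R (⊣ a) (⊢ b)) +ₖ
            sum₂ (λ a b → c₁ (⊣ (a ↑ b)) (⊣ a) *ₖ R (⊣ a) (⊣ b)))) +ₖ
       (sum₂ (λ a b → c₂ (⊢ a) (⊢ b) *ₖ R (⊢ a) (⊢ b)) +ₖ
        -ₖ (sum₂ (λ a b → c₂ (⊢ a) (⊢ (a ↑ b)) *ₖ L (⊢ a) (⊣ b)) +ₖ
            sum₂ (λ a b → c₂ (⊢ (a ↑ b)) (⊢ a) *ₖ L (⊢ a) (⊢ b)))))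
    eval²-orthogonal = begin
      eval² k
        ≈⟨ eval²-sum₂ _ ⟩
      (sum₂ (λ a b → k (⊣ a) (⊣ b)) +ₖ sum₂ (λ a b → k (⊣ a) (⊢ b))) +ₖ
      (sum₂ (λ a b → k (⊢ a) (⊣ b)) +ₖ sum₂ (λ a b → k (⊢ a) (⊢ b)))
        ≈⟨ K.+-cong (K.+-cong (sum₂-+ (λ a b → k₁ (⊣ a) (⊣ b)) (λ a b → k₂ (⊣ a) (⊣ b)))
                              (sum₂-+ (λ a b → k₁ (⊣ a) (⊢ b)) (λ a b → k₂ (⊣ a) (⊢ b))))
                    (K.+-cong (sum₂-+ (λ a b → k₁ (⊢ a) (⊣ b)) (λ a b → k₂ (⊢ a) (⊣ b)))
                              (sum₂-+ (λ a b → k₁ (⊢ a) (⊢ b)) (λ a b → k₂ (⊢ a) (⊢ b)))) ⟩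
      ((S k₁ ⊣ ⊣ +ₖ S k₂ ⊣ ⊣) +ₖ (S k₁ ⊣ ⊢ +ₖ S k₂ ⊣ ⊢)) +ₖ
      ((S k₁ ⊢ ⊣ +ₖ S k₂ ⊢ ⊣) +ₖ (S k₁ ⊢ ⊢ +ₖ S k₂ ⊢ ⊢))
        ≈⟨ solve 8 (λ a b c d e f g h → ((a ⊞ b) ⊞ (c ⊞ d)) ⊞ ((e ⊞ f) ⊞ (g ⊞ h)) ⊜
                                        (c ⊞ f) ⊞ ((a ⊞ (d ⊞ b)) ⊞ (h ⊞ (e ⊞ g)))) K.refl
             (S k₁ ⊣ ⊣) (S k₂ ⊣ ⊣) (S k₁ ⊣ ⊢) (S k₂ ⊣ ⊢)
             (S k₁ ⊢ ⊣) (S k₂ ⊢ ⊣) (S k₁ ⊢ ⊢) (S k₂ ⊢ ⊢) ⟩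
      (S k₁ ⊣ ⊢ +ₖ S k₂ ⊢ ⊣) +ₖ
      ((S k₁ ⊣ ⊣ +ₖ (S k₂ ⊣ ⊢ +ₖ S k₂ ⊣ ⊣)) +ₖ (S k₂ ⊢ ⊢ +ₖ (S k₁ ⊢ ⊣ +ₖ S k₁ ⊢ ⊢)))
        ≈⟨ K.+-cong
             (K.+-congˡ (K.trans (∑-comm (λ a b → k₂ (⊢ a) (⊣ b)))
               (opposite _ _ (λ a b → R (⊢ b) (⊣ a)) orth₁)))
             (K.+-cong
               (K.+-congˡ (K.trans (K.+-cong (opposite _ _ (λ a b → R (⊣ a) (⊢ b)) orth₂)
                                             (opposite _ _ (λ a b → R (⊣ a) (⊣ b)) orth₄)) (KP.-‿+-comm _ _)))
               (K.+-congˡ (K.trans (K.+-cong (opposite _ _ (λ a b → L (⊢ a) (⊣ b)) λ a b → K.trans (K.+-comm _ _) (orth₃ a b))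
                                             (opposite _ _ (λ a b → L (⊢ a) (⊢ b)) λ a b → K.trans (K.+-comm _ _) (orth₅ a b))) (KP.-‿+-comm _ _)))) ⟩
      _ ∎
      where
      open CommutativeMonoidSolver K.+-commutativeMonoid
        using (solve; _⊜_) renaming (_⊕_ to _⊞_)
      k₁ k₂ k : G → G → 𝕜
      k₁ x y = c₁ x y *ₖ L x y
      k₂ x y = c₂ x y *ₖ R x y
      k x y = k₁ x y +ₖ k₂ x y
      S : (G → G → 𝕜) → (Fin γ → G) → (Fin γ → G) → 𝕜
      S h f g = sum₂ (λ a b → h (f a) (g b))

-- Linear independence

-- The arguments of a tree in which the m arguments from position i on are replaced by e.
splice : ∀ {A : Set} → ℕ → ℕ → A → (ℕ → A) → ℕ → A
splice zero    m e a zero    = e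
splice zero    m e a (suc j) = a (m + j)
splice (suc i) m e a zero    = a 0
splice (suc i) m e a (suc j) = splice i m e (a ∘ suc) j

splice-below : ∀ {A : Set} i m (e : A) a {j} → j < i → splice i m e a j ≡ a j
splice-below (suc i) m e a {zero}  _         = refl
splice-below (suc i) m e a {suc j} (s≤s j<i) = splice-below i m e (a ∘ suc) j<i

splice-above : ∀ {A : Set} i m (e : A) a j → splice i m e a (suc (i + j)) ≡ a (i + (m + j))
splice-above zero    m e a j = refl
splice-above (suc i) m e a j = splice-above i m e (a ∘ suc) j

-- Grafting a tree with `m` leaves at leaf `i` of a left subtree moves the start of the right
-- subtree from `l` to `l′`; splicing the arguments undoes this shift.
splice-above′ : ∀ {A : Set} {i l l′ m} (e : A) a j → i < l → suc l′ ≡ l + m →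
                splice i m e a (l + j) ≡ a (l′ + j)
splice-above′ {i = i} {l} {l′} {m} e a j i<l eq with r , refl ← ℕ.m≤n⇒∃[o]m+o≡n i<l
  rewrite ℕ.suc-injective eq | ℕ.+-assoc i r j =
  ≡.trans (splice-above i m e a (r + j)) (cong a (reorder i m r j))
  where
  reorder : ∀ i m r j → i + (m + (r + j)) ≡ i + r + m + j
  reorder = solve-∀

splice-shift : ∀ {A : Set} l k m (e : A) a j → splice (l + k) m e a (l + j) ≡ splice k m e (a ∘ (l +_)) j
splice-shift zero    k m e a j = refl
splice-shift (suc l) k m e a j = splice-shift l k m e (a ∘ suc) j

module Evaluation {c ℓ₁ ℓ₂} (𝕂 : HeytingField c ℓ₁ ℓ₂) (γ : ℕ) where

  open Model 𝕂 γ public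
  open Cubic 𝕂 γ public
  open SetoidReasoning K.setoid

  -- The arguments form an infinite sequence, of which only the first `leaves t` are read. A right
  -- subtree then receives its arguments by a mere shift, and no lengths have to match.
  ev : Tree G → (ℕ → EdgeTree) → Formal EdgeTree
  ev leaf         a = pure (a 0)
  ev (node g l r) a = bind (ev l a) λ s → bind (ev r (a ∘ (leaves l +_))) (act g s)

  eval-ev-node : ∀ f g l r a → eval f (ev (node g l r) a) ≈ₖ
    eval (λ s → eval (λ t → eval f (act g s t)) (ev r (a ∘ (leaves l +_)))) (ev l a)
  eval-ev-node f g l r a = K.trans (eval-bind f (ev l a) _)
    (eval-cong (λ s → eval-bind f (ev r _) (act g s)) (ev l a))

  ev-cong : ∀ t {a a′} → (∀ j → j < leaves t → a j ≡ a′ j) → ev t a ≡ ev t a′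
  ev-cong leaf         eq = cong pure (eq 0 (s≤s z≤n))
  ev-cong (node g l r) eq = cong₂ (λ v w → bind v λ s → bind w (act g s))
    (ev-cong l λ j j< → eq j (ℕ.<-≤-trans j< (ℕ.m≤m+n _ _)))
    (ev-cong r λ j j< → eq (leaves l + j) (ℕ.+-monoʳ-< (leaves l) j<))

  -- This makes the edge-labelled trees an algebra over the free operad. Induction along the path to
  -- leaf `i`; where the path turns right, `eval-swap` moves the value of `s` out past that of the
  -- left subtree.
  ev-graft : ∀ f t s {i} a → i < leaves t → eval f (ev (graft t i s) a) ≈ₖ
             eval (λ e → eval f (ev t (splice i (leaves s) e a))) (ev s (a ∘ (i +_)))
  ev-graft f leaf s {zero}  a _ = K.sym (eval-cong (eval-pure f) (ev s a))
  ev-graft f leaf s {suc i} a (s≤s ())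
  ev-graft f (node g l r) s {i} a i< with split {G} (leaves l) i
  ... | left i<l rewrite graft-left g l r s i<l = begin
    eval f (ev (node g (graft l i s) r) a)
      ≈⟨ eval-ev-node f g (graft l i s) r a ⟩
    eval (h (a ∘ (leaves (graft l i s) +_))) (ev (graft l i s) a)
      ≈⟨ ev-graft _ l s a i<l ⟩
    eval (λ e → eval (h (a ∘ (leaves (graft l i s) +_))) (ev l (a′ e))) (ev s (a ∘ (i +_)))
      ≈⟨ eval-cong (λ e → eval-cong (λ x → K.reflexive (cong (eval _) (ev-cong r λ j _ →
           splice-above′ e a j i<l (leaves-graft l s i<l)))) (ev l (a′ e))) (ev s (a ∘ (i +_))) ⟨
    eval (λ e → eval (h (a′ e ∘ (leaves l +_))) (ev l (a′ e))) (ev s (a ∘ (i +_)))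
      ≈⟨ eval-cong (λ e → eval-ev-node f g l r (a′ e)) (ev s (a ∘ (i +_))) ⟨
    eval (λ e → eval f (ev (node g l r) (a′ e))) (ev s (a ∘ (i +_))) ∎
    where
    a′ : EdgeTree → ℕ → EdgeTree
    a′ e = splice i (leaves s) e a
    h : (ℕ → EdgeTree) → EdgeTree → 𝕜
    h b x = eval (λ y → eval f (act g x y)) (ev r b)
  ... | right k refl rewrite graft-right g l r k s = begin
    eval f (ev (node g l (graft r k s)) a)
      ≈⟨ eval-ev-node f g l (graft r k s) a ⟩
    eval (λ x → eval (h x) (ev (graft r k s) b)) (ev l a)
      ≈⟨ eval-cong (λ x → ev-graft (h x) r s b (ℕ.+-cancelˡ-< (leaves l) _ _ i<)) (ev l a) ⟩
    eval (λ x → eval (λ e → eval (h x) (ev r (splice k (leaves s) e b))) (ev s (b ∘ (k +_)))) (ev l a)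
      ≈⟨ eval-swap _ (ev l a) (ev s (b ∘ (k +_))) ⟩
    eval (λ e → eval (λ x → eval (h x) (ev r (splice k (leaves s) e b))) (ev l a)) (ev s (b ∘ (k +_)))
      ≡⟨ cong (eval _) (ev-cong s λ j _ → cong a (≡.sym (ℕ.+-assoc (leaves l) k j))) ⟩
    eval (λ e → eval (λ x → eval (h x) (ev r (splice k (leaves s) e b))) (ev l a)) (ev s (a ∘ (leaves l + k +_)))
      ≈⟨ eval-cong (λ e → K.trans (eval-ev-node f g l r (a′ e)) (K.reflexive (cong₂ (λ v w → eval (λ x → eval (h x) w) v)
           (ev-cong l λ j j< → splice-below (leaves l + k) (leaves s) e a (ℕ.<-≤-trans j< (ℕ.m≤m+n _ k)))
           (ev-cong r λ j _ → splice-shift (leaves l) k (leaves s) e a j)))) (ev s (a ∘ (leaves l + k +_))) ⟨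
    eval (λ e → eval f (ev (node g l r) (a′ e))) (ev s (a ∘ (leaves l + k +_))) ∎
    where
    a′ : EdgeTree → ℕ → EdgeTree
    a′ e = splice (leaves l + k) (leaves s) e a
    b : ℕ → EdgeTree
    b = a ∘ (leaves l +_)
    h : EdgeTree → EdgeTree → 𝕜
    h x y = eval f (act g x y)

  Φ : ∀ {n} → (EdgeTree → 𝕜) → (ℕ → EdgeTree) → Formal (TreeOf G n) → 𝕜
  Φ f a = eval λ t → eval f (ev (proj₁ t) a)

  eval-0 : ∀ {X : Set} {f : X → 𝕜} → (∀ x → f x ≈ₖ 0ₖ) → ∀ v → eval f v ≈ₖ 0ₖ
  eval-0 f≈0 v = K.trans (eval-cong f≈0 v) (eval-const0 v)

  Φ-leftComb : ∀ f a x y → eval f (ev (proj₁ (leftComb x y)) a) ≈ₖ act₁ f x y (a 0) (a 1) (a 2)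
  Φ-leftComb f a x y = begin
    eval f (ev (proj₁ (leftComb x y)) a)
      ≈⟨ eval-ev-node f x (node y leaf leaf) leaf a ⟩
    eval (λ v → eval (λ u → eval f (act x v u)) (pure (a 2))) (ev (node y leaf leaf) a)
      ≈⟨ eval-cong (λ v → eval-pure (eval f ∘ act x v) (a 2)) (ev (node y leaf leaf) a) ⟩
    eval (λ v → eval f (act x v (a 2))) (ev (node y leaf leaf) a)
      ≈⟨ eval-ev-node _ y leaf leaf a ⟩
    eval (λ s → eval (h s) (pure (a 1))) (pure (a 0))
      ≈⟨ K.trans (eval-pure (λ s → eval (h s) (pure (a 1))) (a 0)) (eval-pure (h (a 0)) (a 1)) ⟩
    act₁ f x y (a 0) (a 1) (a 2) ∎
    where
    h : EdgeTree → EdgeTree → 𝕜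
    h s t = eval (λ v → eval f (act x v (a 2))) (act y s t)

  Φ-rightComb : ∀ f a x y → eval f (ev (proj₁ (rightComb x y)) a) ≈ₖ act₂ f x y (a 0) (a 1) (a 2)
  Φ-rightComb f a x y = begin
    eval f (ev (proj₁ (rightComb x y)) a)
      ≈⟨ K.trans (eval-ev-node f x leaf (node y leaf leaf) a)
           (eval-pure (λ s → eval (eval f ∘ act x s) (ev (node y leaf leaf) (a ∘ suc))) (a 0)) ⟩
    eval (λ v → eval f (act x (a 0) v)) (ev (node y leaf leaf) (a ∘ suc))
      ≈⟨ eval-ev-node _ y leaf leaf (a ∘ suc) ⟩
    eval (λ s → eval (h s) (pure (a 2))) (pure (a 1))
      ≈⟨ K.trans (eval-pure (λ s → eval (h s) (pure (a 2))) (a 1)) (eval-pure (h (a 1)) (a 2)) ⟩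
    act₂ f x y (a 0) (a 1) (a 2) ∎
    where
    h : EdgeTree → EdgeTree → 𝕜
    h s t = eval (λ v → eval f (act x (a 0) v)) (act y s t)

  -- The three groups given by `eval²-orthogonal` are the differences of the two sides of `act-⊣⊢`,
  -- `act-⊣⊣` and `act-⊢⊢`.
  Φ-relation : ∀ f a {v} → v ∈ Relations^⊥ → Φ f a v ≈ₖ 0ₖ
  Φ-relation f a {v} v⊥ = begin
    Φ f a v
      ≈⟨ eval-cubic _ v ⟩
    pairing (leftCoeff v) (rightCoeff v) (λ t → eval f (ev (proj₁ t) a))
      ≈⟨ eval²-cong (λ x y → K.+-cong (K.*-congˡ (Φ-leftComb f a x y)) (K.*-congˡ (Φ-rightComb f a x y))) ⟩
    eval² (λ x y → leftCoeff v x y *ₖ act₁ f x y (a 0) (a 1) (a 2) +ₖ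
                   rightCoeff v x y *ₖ act₂ f x y (a 0) (a 1) (a 2))
      ≈⟨ eval²-orthogonal (⊥⇒orthogonal {v} v⊥)
           (λ x y → act₁ f x y (a 0) (a 1) (a 2)) (λ x y → act₂ f x y (a 0) (a 1) (a 2)) ⟩
    _
      ≈⟨ K.+-cong (KP.x≈y⇒x∙y⁻¹≈ε (act-⊣⊢ f (a 0) (a 1) (a 2) _))
           (K.+-cong (KP.x≈y⇒x∙y⁻¹≈ε (act-⊣⊣ f (a 0) (a 1) (a 2) _))
                     (KP.x≈y⇒x∙y⁻¹≈ε (act-⊢⊢ f (a 0) (a 1) (a 2) _))) ⟩
    0ₖ +ₖ (0ₖ +ₖ 0ₖ)
      ≈⟨ K.trans (K.+-identityˡ _) (K.+-identityˡ _) ⟩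
    0ₖ ∎

  𝔽 : Operad c ℓ₁
  𝔽 = Free (_≟ᴰ_ {γ})

  module δTree n = FreeSpace (treeOf-≟ (_≟ᴰ_ {γ}) n)

  -- Having all `f` and `a` available carries the induction through composition: with the ideal
  -- element outside, the arguments change; with it inside, the functional changes as well.
  Φ-ideal : ∀ {n v} f a → v ∈ Ideal 𝔽 Relations^⊥ {n} → Φ f a v ≈ₖ 0ₖ
  Φ-ideal f a (gen {v} p) = Φ-relation f a {v} p
  Φ-ideal f a zero = K.refl
  Φ-ideal f a (add {x = v} {w} p q) = K.trans (eval-++ _ v w)
    (K.trans (K.+-cong (Φ-ideal f a p) (Φ-ideal f a q)) (K.+-identityˡ _))
  Φ-ideal f a (scal b {v} p) = K.trans (eval-· _ b v) (K.trans (K.*-congˡ (Φ-ideal f a p)) (K.zeroʳ b))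
  Φ-ideal f a (resp {n} {v} {w} v≈w p) = K.trans (K.sym (δTree.eval-resp n _ {v} {w} v≈w)) (Φ-ideal f a p)
  Φ-ideal f a (compˡ {m} {n} e i {v} w p) = begin
    Φ f a (bilinear (graftOf e i) v w)
      ≈⟨ eval-bilinear (graftOf e i) _ v w ⟩
    eval (λ t → eval (λ s → eval f (ev (graft (proj₁ t) (toℕ i) (proj₁ s)) a)) w) v
      ≈⟨ eval-swap _ v w ⟩
    eval (λ s → eval (λ t → eval f (ev (graft (proj₁ t) (toℕ i) (proj₁ s)) a)) v) w
      ≈⟨ eval-0 (λ s → begin
           eval (λ t → eval f (ev (graft (proj₁ t) (toℕ i) (proj₁ s)) a)) v
             ≈⟨ eval-cong (λ t → ev-graft f (proj₁ t) (proj₁ s) a (index< t i)) v ⟩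
           eval (λ t → eval (λ x → eval f (ev (proj₁ t) (splice (toℕ i) (leaves (proj₁ s)) x a))) (arg s)) v
             ≈⟨ eval-swap _ v (arg s) ⟩
           eval (λ x → Φ f (splice (toℕ i) (leaves (proj₁ s)) x a) v) (arg s)
             ≈⟨ eval-0 (λ x → Φ-ideal f _ p) (arg s) ⟩
           0ₖ ∎) w ⟩
    0ₖ ∎
    where
    arg : TreeOf G n → Formal EdgeTree
    arg s = ev (proj₁ s) (a ∘ (toℕ i +_))
  Φ-ideal f a (compʳ {m} {n} e i v {w} p) = begin
    Φ f a (bilinear (graftOf e i) v w)
      ≈⟨ eval-bilinear (graftOf e i) _ v w ⟩
    eval (λ t → eval (λ s → eval f (ev (graft (proj₁ t) (toℕ i) (proj₁ s)) a)) w) v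
      ≈⟨ eval-0 (λ t → K.trans
           (eval-cong (λ s → K.trans (ev-graft f (proj₁ t) (proj₁ s) a (index< t i))
             -- The leaf count of `s` is replaced by the arity `n`, so that one functional `h t n`
             -- serves all trees of `w` and the induction hypothesis applies to it.
             (K.reflexive (cong (λ k → eval (h t k) (ev (proj₁ s) (a ∘ (toℕ i +_)))) (proj₂ s)))) w)
           (Φ-ideal (h t n) _ p)) v ⟩
    0ₖ ∎
    where
    h : TreeOf G m → ℕ → EdgeTree → 𝕜
    h t k x = eval f (ev (proj₁ t) (splice (toℕ i) k x a))

  nodeOf : ∀ {m n k} → k ≡ m + n → G → TreeOf G m → TreeOf G n → TreeOf G k
  nodeOf e g (t , p) (s , q) = node g t s , ≡.trans (cong₂ _+_ p q) (≡.sym e)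

  op : ∀ {m n k} → k ≡ m + n → G → Formal (TreeOf G m) → Formal (TreeOf G n) → Formal (TreeOf G k)
  op e g = bilinear (nodeOf e g)

  opζ : ∀ {m n k} → k ≡ m + n → (Fin γ → G) → Fin γ →
        Formal (TreeOf G m) → Formal (TreeOf G n) → Formal (TreeOf G k)
  opζ e h b v w = ⨁ λ a → ζ a b · op e (h a) v w

  eval-opζ : ∀ {m n k} (e : k ≡ m + n) h b (v : Formal (TreeOf G m)) (w : Formal (TreeOf G n)) F →
             eval F (opζ e h b v w) ≈ₖ sum (λ a → ζ a b *ₖ eval F (op e (h a) v w))
  eval-opζ e h b v w F = K.trans (eval-⨁ F λ a → ζ a b · op e (h a) v w)
    (sum-cong-≋ λ a → eval-· F (ζ a b) (op e (h a) v w))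

  leafᶠ : ∀ {n} → 1 ≡ n → Formal (TreeOf G n)
  leafᶠ eq = pure (leaf , eq)

  mutual
    -- `ιᵇ l` represents `l •ᵗ ∅`, the factor to which a right branch is then attached. Taking the
    -- arity up to a proof of equality avoids transports.
    ι : ∀ e {n} → size e ≡ n → Formal (TreeOf G n)
    ι (l •ᵗ ∅)       eq = ιᵇ l (≡.trans (cong suc (≡.sym (ℕ.+-identityʳ _))) eq)
    ι (l •ᵗ (b – e)) eq = opζ (≡.sym eq) ⊣ b (ιᵇ l refl) (ι e refl)

    ιᵇ : ∀ l {n} → suc (branchSize l) ≡ n → Formal (TreeOf G n)
    ιᵇ ∅       eq = leafᶠ eq
    ιᵇ (b – e) eq = opζ (≡.trans (≡.sym eq) (ℕ.+-comm 1 _)) ⊢ b (ι e refl) (leafᶠ refl)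

  φ : ∀ {n} → Formal (TreeOf G n) → Formal EdgeTree
  φ v = bind v λ t → ev (proj₁ t) (const (∅ •ᵗ ∅))

  eval-φ : ∀ {n} f (v : Formal (TreeOf G n)) → eval f (φ v) ≈ₖ Φ f (const (∅ •ᵗ ∅)) v
  eval-φ f v = eval-bind f v λ t → ev (proj₁ t) (const (∅ •ᵗ ∅))

  φ-op : ∀ {m n k} (e : k ≡ m + n) g f (v : Formal (TreeOf G m)) (w : Formal (TreeOf G n)) →
         eval f (φ (op e g v w)) ≈ₖ eval (λ s → eval (λ t → eval f (act g s t)) (φ w)) (φ v)
  φ-op {m} {n} e g f v w = begin
    eval f (φ (op e g v w))
      ≈⟨ eval-φ f (op e g v w) ⟩
    Φ f (const (∅ •ᵗ ∅)) (op e g v w)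
      ≈⟨ eval-bilinear (nodeOf e g) _ v w ⟩
    eval (λ t → eval (λ s → eval f (ev (node g (proj₁ t) (proj₁ s)) (const (∅ •ᵗ ∅)))) w) v
      ≈⟨ eval-cong (λ t → eval-cong (λ s → eval-ev-node f g (proj₁ t) (proj₁ s) _) w) v ⟩
    eval (λ t → eval (λ s → eval (λ x → eval (h x) (ev′ s)) (ev′ t)) w) v
      ≈⟨ eval-cong (λ t → eval-swap _ w (ev′ t)) v ⟩
    eval (λ t → eval (λ x → eval (λ s → eval (h x) (ev′ s)) w) (ev′ t)) v
      ≈⟨ eval-cong (λ t → eval-cong (λ x → eval-φ (h x) w) (ev′ t)) v ⟨
    eval (λ t → eval (λ x → eval (h x) (φ w)) (ev′ t)) v
      ≈⟨ eval-φ _ v ⟨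
    eval (λ x → eval (h x) (φ w)) (φ v) ∎
    where
    h : EdgeTree → EdgeTree → 𝕜
    h x y = eval f (act g x y)
    ev′ : ∀ {n} → TreeOf G n → Formal EdgeTree
    ev′ t = ev (proj₁ t) (const (∅ •ᵗ ∅))

  -- Summing over `a ≤ b` undoes `Δ`, so the partial sum `opζ` acts as the operation `p` at `b`
  -- itself.
  φ-opζ : ∀ {m n k} (e : k ≡ m + n) h (p : EdgeTree → EdgeTree → Fin γ → Formal EdgeTree) →
          (∀ a s t → act (h a) s t ≡ Δ (p s t) a) →
          ∀ f b (v : Formal (TreeOf G m)) (w : Formal (TreeOf G n)) →
          eval f (φ (opζ e h b v w)) ≈ₖ eval (λ s → eval (λ t → eval f (p s t b)) (φ w)) (φ v)
  φ-opζ {m} {n} e h p act≡Δ f b v w = begin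
    eval f (φ (opζ e h b v w))
      ≈⟨ eval-φ f (opζ e h b v w) ⟩
    Φ f (const (∅ •ᵗ ∅)) (opζ e h b v w)
      ≈⟨ eval-opζ e h b v w _ ⟩
    sum (λ a → ζ a b *ₖ Φ f (const (∅ •ᵗ ∅)) (op e (h a) v w))
      ≈⟨ sum-cong-≋ (λ a → K.*-congˡ {ζ a b} (K.trans (K.sym (eval-φ f (op e (h a) v w))) (φ-op e (h a) f v w))) ⟩
    sum (λ a → ζ a b *ₖ eval (λ s → eval (λ t → eval f (act (h a) s t)) (φ w)) (φ v))
      ≈⟨ sum-cong-≋ (λ a → K.trans
           (eval-cong (λ s → eval-* (ζ a b) (λ t → eval f (act (h a) s t)) (φ w)) (φ v))
           (eval-* (ζ a b) (λ s → eval (λ t → eval f (act (h a) s t)) (φ w)) (φ v))) ⟨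
    sum (λ a → eval (λ s → eval (λ t → ζ a b *ₖ eval f (act (h a) s t)) (φ w)) (φ v))
      ≈⟨ eval-sum (λ a s → eval (λ t → ζ a b *ₖ eval f (act (h a) s t)) (φ w)) (φ v) ⟨
    eval (λ s → sum (λ a → eval (λ t → ζ a b *ₖ eval f (act (h a) s t)) (φ w))) (φ v)
      ≈⟨ eval-cong (λ s → eval-sum (λ a t → ζ a b *ₖ eval f (act (h a) s t)) (φ w)) (φ v) ⟨
    eval (λ s → eval (λ t → sum (λ a → ζ a b *ₖ eval f (act (h a) s t))) (φ w)) (φ v)
      ≈⟨ eval-cong (λ s → eval-cong (λ t → K.trans
           (sum-cong-≋ λ a → K.*-congˡ {ζ a b} (K.reflexive (cong (eval f) (act≡Δ a s t))))
           (sum-ζ-Δ f (p s t) b)) (φ w)) (φ v) ⟩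
    eval (λ s → eval (λ t → eval f (p s t b)) (φ w)) (φ v) ∎

  φ-leaf : ∀ {n} f (eq : 1 ≡ n) → eval f (φ (leafᶠ eq)) ≈ₖ f (∅ •ᵗ ∅)
  φ-leaf f eq = K.trans (eval-φ f (leafᶠ eq))
    (K.trans (eval-pure {TreeOf G _} (λ t → eval f (ev (proj₁ t) (const (∅ •ᵗ ∅)))) (leaf , eq)) (eval-pure f (∅ •ᵗ ∅)))

  mutual
    -- Building `e` from one-node trees only ever multiplies into an empty branch, where `≺[ b ]`
    -- and `≻[ b ]` return a single tree instead of a sum.
    φ-ι : ∀ f e {n} (eq : size e ≡ n) → eval f (φ (ι e eq)) ≈ₖ f e
    φ-ι f (l •ᵗ ∅)       eq = φ-ιᵇ f l _
    φ-ι f (l •ᵗ (b – e)) eq = begin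
      eval f (φ (opζ (≡.sym eq) ⊣ b (ιᵇ l refl) (ι e refl)))
        ≈⟨ φ-opζ {suc (branchSize l)} (≡.sym eq) ⊣ (λ s t b → s ≺[ b ] t) (λ _ _ _ → refl) f b (ιᵇ l refl) (ι e refl) ⟩
      eval (λ s → eval (λ t → eval f (s ≺[ b ] t)) (φ (ι e refl))) (φ (ιᵇ l refl))
        ≈⟨ φ-ιᵇ (λ s → eval (λ t → eval f (s ≺[ b ] t)) (φ (ι e refl))) l refl ⟩
      eval (λ t → eval f ((l •ᵗ ∅) ≺[ b ] t)) (φ (ι e refl))
        ≈⟨ φ-ι (λ t → eval f ((l •ᵗ ∅) ≺[ b ] t)) e refl ⟩
      eval f ((l •ᵗ ∅) ≺[ b ] e)
        ≈⟨ eval-pure f (l •ᵗ (b – e)) ⟩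
      f (l •ᵗ (b – e)) ∎

    φ-ιᵇ : ∀ f l {n} (eq : suc (branchSize l) ≡ n) → eval f (φ (ιᵇ l eq)) ≈ₖ f (l •ᵗ ∅)
    φ-ιᵇ f ∅       eq = φ-leaf f eq
    φ-ιᵇ f (b – e) eq = begin
      eval f (φ (opζ (≡.trans (≡.sym eq) (ℕ.+-comm 1 _)) ⊢ b (ι e refl) (leafᶠ refl)))
        ≈⟨ φ-opζ (≡.trans (≡.sym eq) (ℕ.+-comm 1 _)) ⊢ (λ s t b → s ≻[ b ] t) (λ _ _ _ → refl) f b (ι e refl) (leafᶠ refl) ⟩
      eval (λ s → eval (λ t → eval f (s ≻[ b ] t)) (φ (leafᶠ refl))) (φ (ι e refl))
        ≈⟨ φ-ι (λ s → eval (λ t → eval f (s ≻[ b ] t)) (φ (leafᶠ refl))) e refl ⟩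
      eval (λ t → eval f (e ≻[ b ] t)) (φ (leafᶠ refl))
        ≈⟨ φ-leaf (λ t → eval f (e ≻[ b ] t)) refl ⟩
      eval f (e ≻[ b ] (∅ •ᵗ ∅))
        ≈⟨ eval-pure f ((b – e) •ᵗ ∅) ⟩
      f ((b – e) •ᵗ ∅) ∎

-- Spanning

module Spanning {c ℓ₁ ℓ₂} (𝕂 : HeytingField c ℓ₁ ℓ₂) (γ : ℕ) where

  open Evaluation 𝕂 γ public
  open SetoidReasoning K.setoid

  Vec : ℕ → Set c
  Vec n = Formal (TreeOf G n)

  infix 4 _≈ᶠ_
  _≈ᶠ_ : ∀ {n} → Vec n → Vec n → Set (c ⊔ ℓ₁)
  v ≈ᶠ w = ∀ F → eval F v ≈ₖ eval F w

  Q : ∀ n → VectorSpace c (c ⊔ ℓ₁)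
  Q = Operad.space (Dendr 𝕂 γ)

  I : ∀ {n} → Pred (Vec n) (c ⊔ ℓ₁)
  I = Ideal 𝔽 Relations^⊥

  I-resp : ∀ {n} {v w : Vec n} → v ≈ᶠ w → v ∈ I → w ∈ I
  I-resp {n} {v} {w} eq = resp {x = v} {w} λ x → eq (δTree.δ n x)

  infix 4 _~_
  -- Unfolds to the equality of the quotient `Q n`.
  _~_ : ∀ {n} → Vec n → Vec n → Set (c ⊔ ℓ₁)
  v ~ w = v ++ (-ₖ 1ₖ) · w ∈ I

  eval-difference : ∀ {n} F (v w : Vec n) → eval F (v ++ (-ₖ 1ₖ) · w) ≈ₖ eval F v +ₖ -ₖ eval F w
  eval-difference F v w = K.trans (eval-++ F v _) (K.+-congˡ (K.trans (eval-· F _ w) (KP.-1*x≈-x _)))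

  ≈ᶠ⇒~ : ∀ {n} {v w : Vec n} → v ≈ᶠ w → v ~ w
  ≈ᶠ⇒~ {v = v} {w} eq = I-resp {v = []} {v ++ (-ₖ 1ₖ) · w}
    (λ F → K.sym (K.trans (eval-difference F v w) (KP.x≈y⇒x∙y⁻¹≈ε (eq F)))) zero

  -- Maps of formal sums with a transpose are linear, and pass to the quotients
  -- if they preserve the ideal.
  record Linear {m n} (T : Vec m → Vec n) : Set (c ⊔ ℓ₁) where
    field
      transpose : (TreeOf G n → 𝕜) → TreeOf G m → 𝕜
      adjoint   : ∀ F v → eval F (T v) ≈ₖ eval (transpose F) v
      ideal     : ∀ {v} → v ∈ I → T v ∈ I

    additive : ∀ v w → T (v ++ w) ≈ᶠ T v ++ T w
    additive v w F = K.trans (adjoint F (v ++ w)) (K.trans (eval-++ _ v w)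
      (K.trans (K.sym (K.+-cong (adjoint F v) (adjoint F w))) (K.sym (eval-++ F (T v) (T w)))))

    homogeneous : ∀ a v → T (a · v) ≈ᶠ a · T v
    homogeneous a v F = K.trans (adjoint F (a · v)) (K.trans (eval-· _ a v)
      (K.trans (K.*-congˡ (K.sym (adjoint F v))) (K.sym (eval-· F a (T v)))))

    preserves-~ : ∀ {v w} → v ~ w → T v ~ T w
    preserves-~ {v} {w} v~w = I-resp {v = T (v ++ (-ₖ 1ₖ) · w)} {T v ++ (-ₖ 1ₖ) · T w}
      (λ F → K.trans (additive v ((-ₖ 1ₖ) · w) F) (K.trans (eval-++ F (T v) _)
        (K.trans (K.+-congˡ (homogeneous (-ₖ 1ₖ) w F)) (K.sym (eval-++ F (T v) _)))))
      (ideal {v ++ (-ₖ 1ₖ) · w} v~w)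

  comp-generator : ∀ {n} → G → Vec n → Vec (suc n)
  comp-generator {n} g w = Operad.comp 𝔽 {2} {n} {suc n} refl (suc zero) (generator _≟ᴰ_ g) w

  -- The right input is filled first: the left one then still sits at position `zero`, and both
  -- graftings compute whatever trees are inserted. This is how the ideal is seen to be stable under
  -- `op`.
  op-as-comp : ∀ {m n k} (e : k ≡ m + n) (e′ : suc k ≡ suc n + m) g (v : Vec m) (w : Vec n) →
    Operad.comp 𝔽 e′ zero (comp-generator g w) v ≈ᶠ op e g v w
  op-as-comp {m} {n} {k} e e′ g v w F = begin
    eval F (Operad.comp 𝔽 e′ zero (comp-generator g w) v)
      ≈⟨ eval-bilinear (graftOf e′ zero) F (comp-generator g w) v ⟩
    eval (λ r → eval (λ s → F (graftOf e′ zero r s)) v) (comp-generator g w)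
      ≈⟨ eval-bilinear (graftOf {_} {2} {n} {suc n} refl (suc zero)) _ (generator _≟ᴰ_ g) w ⟩
    1ₖ *ₖ eval (λ t → eval (λ s → F (graftOf e′ zero (graftOf {_} {2} {n} {suc n} refl (suc zero) (node g leaf leaf , refl) t) s)) v) w +ₖ 0ₖ
      ≈⟨ K.trans (K.+-identityʳ _) (K.*-identityˡ _) ⟩
    eval (λ t → eval (λ s → F (graftOf e′ zero (graftOf {_} {2} {n} {suc n} refl (suc zero) (node g leaf leaf , refl) t) s)) v) w
      ≈⟨ eval-cong (λ t → eval-cong (λ s → K.reflexive (cong F (TreeOf-≡ refl))) v) w ⟩
    eval (λ t → eval (λ s → F (nodeOf e g s t)) v) w
      ≈⟨ eval-swap (λ s t → F (nodeOf e g s t)) v w ⟨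
    eval (λ s → eval (λ t → F (nodeOf e g s t)) w) v
      ≈⟨ eval-bilinear (nodeOf e g) F v w ⟨
    eval F (op e g v w) ∎

  private
    comp-arity : ∀ {m n k} → k ≡ m + n → suc k ≡ suc n + m
    comp-arity {m} {n} e = cong suc (≡.trans e (ℕ.+-comm m n))

  op-linearˡ : ∀ {m n k} (e : k ≡ m + n) g (w : Vec n) → Linear (λ (v : Vec m) → op e g v w)
  op-linearˡ {m} {n} e g w = record
    { transpose = λ F s → eval (λ t → F (nodeOf e g s t)) w
    ; adjoint   = λ F v → eval-bilinear (nodeOf e g) F v w
    ; ideal     = λ {v} p → I-resp {v = Operad.comp 𝔽 (comp-arity {m} e) zero (comp-generator g w) v} {op e g v w}
                    (op-as-comp e (comp-arity {m} e) g v w)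
                    (compʳ (comp-arity {m} e) zero (comp-generator g w) {v} p)
    }

  op-linearʳ : ∀ {m n k} (e : k ≡ m + n) g (v : Vec m) → Linear (λ (w : Vec n) → op e g v w)
  op-linearʳ {m} {n} e g v = record
    { transpose = λ F t → eval (λ s → F (nodeOf e g s t)) v
    ; adjoint   = λ F w → K.trans (eval-bilinear (nodeOf e g) F v w) (eval-swap (λ s t → F (nodeOf e g s t)) v w)
    ; ideal     = λ {w} p → I-resp {v = Operad.comp 𝔽 (comp-arity {m} e) zero (comp-generator g w) v} {op e g v w}
                    (op-as-comp e (comp-arity {m} e) g v w)
                    (compˡ (comp-arity {m} e) zero {comp-generator g w} v
                      (compʳ refl (suc zero) (generator _≟ᴰ_ g) {w} p))
    }

  module _ {n r} {S : Pred (Vec n) r} where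

    W : Pred (Vec n) _
    W = Span (Q n) S

    W-~ : ∀ {v w} → v ~ w → v ∈ W → w ∈ W
    W-~ {v} {w} = resp {x = v} {w}

    W-resp : ∀ {v w} → v ≈ᶠ w → v ∈ W → w ∈ W
    W-resp {v} {w} eq = W-~ {v} {w} (≈ᶠ⇒~ {v = v} {w} eq)

    W-+ : ∀ {v w} → v ∈ W → w ∈ W → v ++ w ∈ W
    W-+ {v} {w} = add {x = v} {w}

    W-· : ∀ a {v} → v ∈ W → a · v ∈ W
    W-· a {v} = scal a {v}

    W-⨁ : ∀ {d} (v : Fin d → Vec n) → (∀ i → v i ∈ W) → ⨁ v ∈ W
    W-⨁ {zero}  v v∈ = zero
    W-⨁ {suc d} v v∈ = W-+ {v zero} {⨁ (v ∘ suc)} (v∈ zero) (W-⨁ (v ∘ suc) (v∈ ∘ suc))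

    W-I : ∀ {v} → v ∈ I → v ∈ W
    W-I {v} p = W-~ {[]} {v} (scal (-ₖ 1ₖ) {v} p) zero

    W-Linear : ∀ {m} {r′} {S′ : Pred (Vec m) r′} {T : Vec m → Vec n} → Linear T →
               (∀ {v} → v ∈ S′ → T v ∈ W) → ∀ {v} → v ∈ Span (Q m) S′ → T v ∈ W
    W-Linear {m} {T = T} lin base = go
      where
      open Linear lin
      go : ∀ {v} → v ∈ Span (Q m) _ → T v ∈ W
      go (gen v∈) = base v∈
      go zero = W-resp {[]} {T []} (λ F → K.sym (adjoint F [])) zero
      go (add {v} {w} p q) = W-resp {T v ++ T w} {T (v ++ w)} (λ F → K.sym (additive v w F)) (W-+ {T v} {T w} (go p) (go q))
      go (scal a {v} p) = W-resp {a · T v} {T (a · v)} (λ F → K.sym (homogeneous a v F)) (W-· a {T v} (go p))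
      go (resp {v} {w} v~w p) = W-~ {T v} {T w} (preserves-~ {v} {w} v~w) (go p)

    W-Linear-⨁ : ∀ {m d} {T : Vec m → Vec n} → Linear T → (z : Fin d → 𝕜) (v : Fin d → Vec m) →
                 (∀ i → T (v i) ∈ W) → T (⨁ λ i → z i · v i) ∈ W
    W-Linear-⨁ {T = T} lin z v T∈ = W-resp {⨁ λ i → z i · T (v i)} {T (⨁ λ i → z i · v i)}
      (λ F → begin
        eval F (⨁ λ i → z i · T (v i))
          ≈⟨ eval-⨁ F (λ i → z i · T (v i)) ⟩
        sum (λ i → eval F (z i · T (v i)))
          ≈⟨ sum-cong-≋ (λ i → K.trans (K.sym (homogeneous (z i) (v i) F)) (adjoint F (z i · v i))) ⟩
        sum (λ i → eval (transpose F) (z i · v i))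
          ≈⟨ eval-⨁ (transpose F) (λ i → z i · v i) ⟨
        eval (transpose F) (⨁ λ i → z i · v i)
          ≈⟨ adjoint F (⨁ λ i → z i · v i) ⟨
        eval F (T (⨁ λ i → z i · v i)) ∎)
      (W-⨁ (λ i → z i · T (v i)) λ i → W-· (z i) {T (v i)} (T∈ i))
      where open Linear lin

    -- A single generator is recovered from the partial sums with the coefficients `z` that write
    -- the indicator of `a` as a combination of the functions `ζ _ b`.
    W-opζ⁻ : ∀ {m p} (e : n ≡ m + p) h (v : Vec m) (w : Vec p) →
             (∀ b → opζ e h b v w ∈ W) → ∀ a → op e (h a) v w ∈ W
    W-opζ⁻ e h v w opζ∈ a = W-resp {⨁ λ b → z b · opζ e h b v w} {op e (h a) v w}
      (λ F → begin
        eval F (⨁ λ b → z b · opζ e h b v w)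
          ≈⟨ eval-⨁ F (λ b → z b · opζ e h b v w) ⟩
        sum (λ b → eval F (z b · opζ e h b v w))
          ≈⟨ sum-cong-≋ (λ b → K.trans (eval-· F (z b) (opζ e h b v w)) (K.*-congˡ (eval-opζ e h b v w F))) ⟩
        sum (λ b → z b *ₖ sum (λ a′ → ζ a′ b *ₖ eval F (op e (h a′) v w)))
          ≈⟨ sum₂-sep z (λ b a′ → ζ a′ b *ₖ eval F (op e (h a′) v w)) ⟨
        sum₂ (λ b a′ → z b *ₖ (ζ a′ b *ₖ eval F (op e (h a′) v w)))
          ≈⟨ ∑-comm (λ b a′ → z b *ₖ (ζ a′ b *ₖ eval F (op e (h a′) v w))) ⟩
        sum₂ (λ a′ b → z b *ₖ (ζ a′ b *ₖ eval F (op e (h a′) v w)))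
          ≈⟨ sum-cong-≋ (λ a′ → K.trans (*-distribʳ-sum (eval F (op e (h a′) v w)) (λ b → z b *ₖ ζ a′ b))
               (sum-cong-≋ λ b → K.*-assoc (z b) (ζ a′ b) _)) ⟨
        sum (λ a′ → sum (λ b → z b *ₖ ζ a′ b) *ₖ eval F (op e (h a′) v w))
          ≈⟨ sum-cong-≋ (λ a′ → K.*-congʳ {eval F (op e (h a′) v w)} (proj₂ (ζ-combination λ a′ → δFin.δ a′ a) a′)) ⟩
        sum (λ a′ → δFin.δ a′ a *ₖ eval F (op e (h a′) v w))
          ≈⟨ sum-δ (λ a′ → eval F (op e (h a′) v w)) a ⟩
        eval F (op e (h a) v w) ∎)
      (W-⨁ (λ b → z b · opζ e h b v w) λ b → W-· (z b) {opζ e h b v w} (opζ∈ b))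
      where
      z : Fin γ → 𝕜
      z = proj₁ (ζ-combination λ a′ → δFin.δ a′ a)

    -- Take for β the indicator function of (a , b).
    W-isolate : ∀ {r s t : Fin γ → Fin γ → Vec n} →
      (∀ β → ∃[ z ] (z ∈ I × ∀ F → eval F z ≈ₖ sum₂ (λ x y → β x y *ₖ eval F (r x y)) +ₖ
        -ₖ (sum₂ (λ x y → β x (x ↑ y) *ₖ eval F (s x y)) +ₖ sum₂ (λ x y → β (x ↑ y) x *ₖ eval F (t x y))))) →
      (∀ x y → s x y ∈ W) → (∀ x y → t x y ∈ W) → ∀ a b → r a b ∈ W
    W-isolate {r} {s} {t} relation s∈ t∈ a b =
      W-resp {z ++ (combination s′ s ++ combination t′ t)} {r a b} (λ F → begin
        eval F (z ++ (combination s′ s ++ combination t′ t))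
          ≈⟨ K.trans (eval-++ F z _) (K.+-cong (proj₂ (proj₂ rel) F) (K.trans (eval-++ F (combination s′ s) _)
               (K.+-cong (eval-combination F s′ s) (eval-combination F t′ t)))) ⟩
        (R F +ₖ -ₖ ST F) +ₖ ST F
          ≈⟨ K.trans (K.+-assoc _ _ _) (K.trans (K.+-congˡ (K.-‿inverseˡ _)) (K.+-identityʳ _)) ⟩
        R F
          ≈⟨ sum₂-δ (λ x y → eval F (r x y)) a b ⟩
        eval F (r a b) ∎)
      (W-+ {z} {combination s′ s ++ combination t′ t} (W-I {z} z∈I)
        (W-+ {combination s′ s} {combination t′ t} (combination∈ s′ s s∈) (combination∈ t′ t t∈)))
      where
      rel = relation λ x y → δFin.δ x a *ₖ δFin.δ y b
      z : Vec n
      z = proj₁ rel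
      z∈I : z ∈ I
      z∈I = proj₁ (proj₂ rel)
      s′ t′ : Fin γ → Fin γ → 𝕜
      s′ x y = δFin.δ x a *ₖ δFin.δ (x ↑ y) b
      t′ x y = δFin.δ (x ↑ y) a *ₖ δFin.δ x b
      combination : (Fin γ → Fin γ → 𝕜) → (Fin γ → Fin γ → Vec n) → Vec n
      combination z v = ⨁ λ x → ⨁ λ y → z x y · v x y
      eval-combination : ∀ F z v → eval F (combination z v) ≈ₖ sum₂ (λ x y → z x y *ₖ eval F (v x y))
      eval-combination F z v = K.trans (eval-⨁ F λ x → ⨁ λ y → z x y · v x y)
        (sum-cong-≋ λ x → K.trans (eval-⨁ F λ y → z x y · v x y) (sum-cong-≋ λ y → eval-· F (z x y) (v x y)))
      combination∈ : ∀ z v → (∀ x y → v x y ∈ W) → combination z v ∈ W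
      combination∈ z v v∈ = W-⨁ (λ x → ⨁ λ y → z x y · v x y) λ x →
        W-⨁ (λ y → z x y · v x y) λ y → W-· (z x y) {v x y} (v∈ x y)
      R ST : (TreeOf G n → 𝕜) → 𝕜
      R F = sum₂ (λ x y → (δFin.δ x a *ₖ δFin.δ y b) *ₖ eval F (r x y))
      ST F = sum₂ (λ x y → s′ x y *ₖ eval F (s x y)) +ₖ sum₂ (λ x y → t′ x y *ₖ eval F (t x y))

  eval-reverse : ∀ {X Y Z : Set} (h : X → Y → Z → 𝕜) u v w →
    eval (λ z → eval (λ y → eval (λ x → h x y z) u) v) w ≈ₖ
    eval (λ x → eval (λ y → eval (h x y) w) v) u
  eval-reverse h u v w = begin
    eval (λ z → eval (λ y → eval (λ x → h x y z) u) v) w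
      ≈⟨ eval-cong (λ z → eval-swap (λ x y → h x y z) u v) w ⟨
    eval (λ z → eval (λ x → eval (λ y → h x y z) v) u) w
      ≈⟨ eval-swap (λ x z → eval (λ y → h x y z) v) u w ⟨
    eval (λ x → eval (λ z → eval (λ y → h x y z) v) w) u
      ≈⟨ eval-cong (λ x → eval-swap (h x) v w) u ⟨
    eval (λ x → eval (λ y → eval (h x y) w) v) u ∎

  zeroᶠ : Fin γ → Fin γ → 𝕜
  zeroᶠ _ _ = 0ₖ

  module Annihilator (α β δ : Fin γ → Fin γ → 𝕜) where

    -- `α`, `β` and `δ` are the free coefficients, and `Orthogonal` forces the other five clauses.
    -- `β` and `δ` are placed on the combs that get rewritten, so that an indicator isolates one
    -- such comb.
    c₁ c₂ : G → G → 𝕜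
    c₁ (⊣ a) (⊢ b) = α a b
    c₁ (⊣ a) (⊣ b) = β a b
    c₁ (⊢ a) (⊣ b) = -ₖ δ a (a ↑ b)
    c₁ (⊢ a) (⊢ b) = -ₖ δ (a ↑ b) a
    c₂ (⊢ b) (⊣ a) = -ₖ α a b
    c₂ (⊣ a) (⊢ b) = -ₖ β a (a ↑ b)
    c₂ (⊣ a) (⊣ b) = -ₖ β (a ↑ b) a
    c₂ (⊢ a) (⊢ b) = δ a b

    c-orthogonal : Orthogonal c₁ c₂
    c-orthogonal = record
      { orth₁ = λ a b → K.-‿inverseʳ _
      ; orth₂ = λ a b → K.-‿inverseʳ _
      ; orth₃ = λ a b → K.-‿inverseˡ _
      ; orth₄ = λ a b → K.-‿inverseʳ _
      ; orth₅ = λ a b → K.-‿inverseˡ _ }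

    element : Cubic
    element = cubic c₁ c₂

    element∈ : element ∈ Relations^⊥
    element∈ = orthogonal⇒⊥ {element} (record
      { orth₁ = λ a b → K.trans (K.+-cong (leftCoeff-cubic c₁ c₂ _ _) (rightCoeff-cubic c₁ c₂ _ _)) (orth₁ a b)
      ; orth₂ = λ a b → K.trans (K.+-cong (leftCoeff-cubic c₁ c₂ _ _) (rightCoeff-cubic c₁ c₂ _ _)) (orth₂ a b)
      ; orth₃ = λ a b → K.trans (K.+-cong (leftCoeff-cubic c₁ c₂ _ _) (rightCoeff-cubic c₁ c₂ _ _)) (orth₃ a b)
      ; orth₄ = λ a b → K.trans (K.+-cong (leftCoeff-cubic c₁ c₂ _ _) (rightCoeff-cubic c₁ c₂ _ _)) (orth₄ a b)
      ; orth₅ = λ a b → K.trans (K.+-cong (leftCoeff-cubic c₁ c₂ _ _) (rightCoeff-cubic c₁ c₂ _ _)) (orth₅ a b) })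
      where open Orthogonal c-orthogonal

  module Composite {m n p q r k} (e₁ : k ≡ q + p) (e₂ : q ≡ m + n) (e₃ : k ≡ m + r) (e₄ : r ≡ n + p)
                   (u : Vec m) (v : Vec n) (w : Vec p) where

    L R : G → G → Vec k
    L x y = op e₁ x (op e₂ y u v) w
    R x y = op e₃ x u (op e₄ y v w)

    private
      e : suc k ≡ (suc p + n) + m
      e = cong suc (≡.trans e₁ (≡.trans (cong (_+ p) e₂) (reorder m n p)))
        where
        reorder : ∀ m n p → m + n + p ≡ p + n + m
        reorder = solve-∀

      -- Inputs are filled from right to left: the positions 2, 1, 0 then do not depend on what has
      -- been inserted, and grafting into a comb computes. `eval-reverse` restores the order of
      -- summation.
      graft₃ : TreeOf G 3 → TreeOf G m → TreeOf G n → TreeOf G p → TreeOf G k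
      graft₃ t x y z = graftOf e zero
        (graftOf {_} {2 + p} {n} {suc p + n} refl (suc zero) (graftOf {_} {3} {p} {2 + p} refl (suc (suc zero)) t z) y) x

      compose₁ : Cubic → Vec (2 + p)
      compose₁ f = Operad.comp 𝔽 {3} {p} {2 + p} refl (suc (suc zero)) f w

      compose₂ : Cubic → Vec (suc p + n)
      compose₂ f = Operad.comp 𝔽 {2 + p} {n} {suc p + n} refl (suc zero) (compose₁ f) v

      compose : Cubic → Vec k
      compose f = Operad.comp 𝔽 e zero (compose₂ f) u

      eval-compose : ∀ F f → eval F (compose f) ≈ₖ
        eval (λ t → eval (λ x → eval (λ y → eval (λ z → F (graft₃ t x y z)) w) v) u) f
      eval-compose F f = begin
        eval F (compose f)
          ≈⟨ eval-bilinear (graftOf e zero) F (compose₂ f) u ⟩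
        eval (λ s → eval (λ x → F (graftOf e zero s x)) u) (compose₂ f)
          ≈⟨ eval-bilinear (graftOf {_} {2 + p} {n} {suc p + n} refl (suc zero)) _ (compose₁ f) v ⟩
        eval (λ s → eval (λ y → eval (λ x → F (graftOf e zero (graftOf {_} {2 + p} {n} {suc p + n} refl (suc zero) s y) x)) u) v) (compose₁ f)
          ≈⟨ eval-bilinear (graftOf {_} {3} {p} {2 + p} refl (suc (suc zero))) _ f w ⟩
        eval (λ t → eval (λ z → eval (λ y → eval (λ x → F (graft₃ t x y z)) u) v) w) f
          ≈⟨ eval-cong (λ t → eval-reverse (λ x y z → F (graft₃ t x y z)) u v w) f ⟩
        eval (λ t → eval (λ x → eval (λ y → eval (λ z → F (graft₃ t x y z)) w) v) u) f ∎

      eval-L : ∀ F x y → eval F (L x y) ≈ₖ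
        eval (λ a → eval (λ b → eval (λ d → F (graft₃ (leftComb x y) a b d)) w) v) u
      eval-L F x y = K.trans (eval-bilinear (nodeOf e₁ x) F (op e₂ y u v) w)
        (K.trans (eval-bilinear (nodeOf e₂ y) _ u v)
          (eval-cong (λ a → eval-cong (λ b → eval-cong (λ d → K.reflexive (cong F (TreeOf-≡ refl))) w) v) u))

      eval-R : ∀ F x y → eval F (R x y) ≈ₖ
        eval (λ a → eval (λ b → eval (λ d → F (graft₃ (rightComb x y) a b d)) w) v) u
      eval-R F x y = K.trans (eval-bilinear (nodeOf e₃ x) F u (op e₄ y v w))
        (eval-cong (λ a → K.trans (eval-bilinear (nodeOf e₄ y) _ v w)
          (eval-cong (λ b → eval-cong (λ d → K.reflexive (cong F (TreeOf-≡ refl))) w) v)) u)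

    module _ (α β δ : Fin γ → Fin γ → 𝕜) where

      open Annihilator α β δ

      relation : Vec k
      relation = compose element

      relation∈ : relation ∈ I
      relation∈ = compˡ e zero {compose₂ element} u
        (compˡ refl (suc zero) {compose₁ element} v
          (compˡ refl (suc (suc zero)) {element} w (gen {x = element} element∈)))

      eval-relation : ∀ F → eval F relation ≈ₖ
        (sum₂ (λ a b → α a b *ₖ eval F (L (⊣ a) (⊢ b))) +ₖ
         -ₖ sum₂ (λ a b → α a b *ₖ eval F (R (⊢ b) (⊣ a)))) +ₖ
        ((sum₂ (λ a b → β a b *ₖ eval F (L (⊣ a) (⊣ b))) +ₖ
          -ₖ (sum₂ (λ a b → β a (a ↑ b) *ₖ eval F (R (⊣ a) (⊢ b))) +ₖ
              sum₂ (λ a b → β (a ↑ b) a *ₖ eval F (R (⊣ a) (⊣ b))))) +ₖ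
         (sum₂ (λ a b → δ a b *ₖ eval F (R (⊢ a) (⊢ b))) +ₖ
          -ₖ (sum₂ (λ a b → δ a (a ↑ b) *ₖ eval F (L (⊢ a) (⊣ b))) +ₖ
              sum₂ (λ a b → δ (a ↑ b) a *ₖ eval F (L (⊢ a) (⊢ b))))))
      eval-relation F = begin
        eval F relation
          ≈⟨ eval-compose F element ⟩
        eval F₃ element
          ≈⟨ eval-cubic-form F₃ c₁ c₂ ⟩
        eval² (λ x y → c₁ x y *ₖ F₃ (leftComb x y) +ₖ c₂ x y *ₖ F₃ (rightComb x y))
          ≈⟨ eval²-cong (λ x y → K.+-cong (K.*-congˡ (eval-L F x y)) (K.*-congˡ (eval-R F x y))) ⟨
        eval² (λ x y → c₁ x y *ₖ eval F (L x y) +ₖ c₂ x y *ₖ eval F (R x y))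
          ≈⟨ eval²-orthogonal c-orthogonal (λ x y → eval F (L x y)) (λ x y → eval F (R x y)) ⟩
        _ ∎
        where
        F₃ : TreeOf G 3 → 𝕜
        F₃ t = eval (λ a → eval (λ b → eval (λ d → F (graft₃ t a b d)) w) v) u

    private
      sum₂-zero : ∀ (h : Fin γ → Fin γ → 𝕜) → sum₂ (λ a b → 0ₖ *ₖ h a b) ≈ₖ 0ₖ
      sum₂-zero h = sum₂-0 (λ a b → 0ₖ *ₖ h a b) λ a b → K.zeroˡ _

      zero₁ : ∀ (g h : Fin γ → Fin γ → 𝕜) →
              sum₂ (λ a b → 0ₖ *ₖ g a b) +ₖ -ₖ sum₂ (λ a b → 0ₖ *ₖ h a b) ≈ₖ 0ₖ
      zero₁ g h = KP.x≈y⇒x∙y⁻¹≈ε (K.trans (sum₂-zero g) (K.sym (sum₂-zero h)))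

      zero₂ : ∀ (f g h : Fin γ → Fin γ → 𝕜) →
              sum₂ (λ a b → 0ₖ *ₖ f a b) +ₖ
              -ₖ (sum₂ (λ a b → 0ₖ *ₖ g a b) +ₖ sum₂ (λ a b → 0ₖ *ₖ h a b)) ≈ₖ 0ₖ
      zero₂ f g h = KP.x≈y⇒x∙y⁻¹≈ε (K.trans (sum₂-zero f) (K.sym
        (K.trans (K.+-cong (sum₂-zero g) (sum₂-zero h)) (K.+-identityˡ _))))

    -- This relation contains no maximum, so the indicator of `(a , b)` as `α`, with the other two
    -- families zero, leaves just two terms.
    L⊣⊢~R⊢⊣ : ∀ a b → L (⊣ a) (⊢ b) ~ R (⊢ b) (⊣ a)
    L⊣⊢~R⊢⊣ a b = I-resp {v = relation α zeroᶠ zeroᶠ} {L (⊣ a) (⊢ b) ++ (-ₖ 1ₖ) · R (⊢ b) (⊣ a)}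
      (λ F → begin
        eval F (relation α zeroᶠ zeroᶠ)
          ≈⟨ eval-relation α zeroᶠ zeroᶠ F ⟩
        _
          ≈⟨ K.+-cong (K.+-cong (sum₂-δ (λ a b → eval F (L (⊣ a) (⊢ b))) a b)
                                (K.-‿cong (sum₂-δ (λ a b → eval F (R (⊢ b) (⊣ a))) a b)))
               (K.trans (K.+-cong (zero₂ _ _ _) (zero₂ _ _ _)) (K.+-identityˡ _)) ⟩
        eval F (L (⊣ a) (⊢ b)) +ₖ -ₖ eval F (R (⊢ b) (⊣ a)) +ₖ 0ₖ
          ≈⟨ K.+-identityʳ _ ⟩
        eval F (L (⊣ a) (⊢ b)) +ₖ -ₖ eval F (R (⊢ b) (⊣ a))
          ≈⟨ eval-difference F (L (⊣ a) (⊢ b)) (R (⊢ b) (⊣ a)) ⟨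
        eval F (L (⊣ a) (⊢ b) ++ (-ₖ 1ₖ) · R (⊢ b) (⊣ a)) ∎)
      (relation∈ α zeroᶠ zeroᶠ)
      where
      α : Fin γ → Fin γ → 𝕜
      α x y = δFin.δ x a *ₖ δFin.δ y b

    -- With `α` and `δ` zero only the middle group of `eval-relation` survives. Only membership in a
    -- span is claimed, so `W-isolate` absorbs the exact combination of right combs.
    L⊣⊣∈W : ∀ {s} {S : Pred (Vec k) s} → (∀ a b → R (⊣ a) (⊢ b) ∈ Span (Q k) S) →
            (∀ a b → R (⊣ a) (⊣ b) ∈ Span (Q k) S) → ∀ a b → L (⊣ a) (⊣ b) ∈ Span (Q k) S
    L⊣⊣∈W = W-isolate λ β → relation zeroᶠ β zeroᶠ , relation∈ zeroᶠ β zeroᶠ , λ F →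
      K.trans (eval-relation zeroᶠ β zeroᶠ F) (K.trans (K.+-cong (zero₁ _ _) (K.+-congˡ (zero₂ _ _ _)))
        (K.trans (K.+-identityˡ _) (K.+-identityʳ _)))

    R⊢⊢∈W : ∀ {s} {S : Pred (Vec k) s} → (∀ a b → L (⊢ a) (⊣ b) ∈ Span (Q k) S) →
            (∀ a b → L (⊢ a) (⊢ b) ∈ Span (Q k) S) → ∀ a b → R (⊢ a) (⊢ b) ∈ Span (Q k) S
    R⊢⊢∈W = W-isolate λ δ → relation zeroᶠ zeroᶠ δ , relation∈ zeroᶠ zeroᶠ δ , λ F →
      K.trans (eval-relation zeroᶠ zeroᶠ δ F) (K.trans (K.+-cong (zero₁ _ _) (K.+-congʳ (zero₂ _ _ _)))
        (K.trans (K.+-identityˡ _) (K.+-identityˡ _)))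

  Treeι : ∀ n → Pred (Vec n) c
  Treeι n v = Σ[ e ∈ EdgeTree ] Σ[ eq ∈ size e ≡ n ] v ≡ ι e eq

  Branchι : ∀ n → Pred (Vec n) c
  Branchι n v = Σ[ l ∈ Branch ] Σ[ eq ∈ suc (branchSize l) ≡ n ] v ≡ ιᵇ l eq

  Trees Branches : ∀ {n} → Pred (Vec n) _
  Trees {n} = Span (Q n) (Treeι n)
  Branches {n} = Span (Q n) (Branchι n)

  ι∈ : ∀ e {n} (eq : size e ≡ n) → ι e eq ∈ Trees
  ι∈ e eq = gen (e , eq , refl)

  ιᵇ∈Trees : ∀ l {n} (eq : suc (branchSize l) ≡ n) → ιᵇ l eq ∈ Trees
  ιᵇ∈Trees l eq = gen (l •ᵗ ∅ , ≡.trans (cong suc (ℕ.+-identityʳ _)) eq , cong (ιᵇ l) (ℕ.≡-irrelevant _ _))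

  Branches⊆Trees : ∀ {n} {v : Vec n} → v ∈ Branches → v ∈ Trees
  Branches⊆Trees (gen (l , eq , refl)) = ιᵇ∈Trees l eq
  Branches⊆Trees zero = zero
  Branches⊆Trees (add p q) = add (Branches⊆Trees p) (Branches⊆Trees q)
  Branches⊆Trees (scal a p) = scal a (Branches⊆Trees p)
  Branches⊆Trees (resp {v} {w} v~w p) = resp {x = v} {w} v~w (Branches⊆Trees p)

  -- By linearity `w` may be taken to be some `ι e`. `W-opζ⁻` passes from the generator to the
  -- partial sums, and `opζ` at `b` is how `ι (l •ᵗ (b – e))` is defined.
  attachʳ : ∀ l {m n k} (eq : suc (branchSize l) ≡ m) (κ : k ≡ m + n) a {w : Vec n} →
            w ∈ Trees → op κ (⊣ a) (ιᵇ l eq) w ∈ Trees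
  attachʳ l {m} {n} {k} eq κ a = W-Linear (op-linearʳ κ (⊣ a) (ιᵇ l eq)) λ (e , eq′ , v≡) →
    ≡.subst (λ v → op κ (⊣ a) (ιᵇ l eq) v ∈ Trees) (≡.sym v≡)
      (W-opζ⁻ κ ⊣ (ιᵇ l eq) (ι e eq′) (λ b → gen (l •ᵗ (b – e) , size≡ eq eq′ κ , ι≡ e b eq eq′ κ)) a)
    where
    size≡ : ∀ {m n k s} → suc (branchSize l) ≡ m → s ≡ n → k ≡ m + n → suc (branchSize l + s) ≡ k
    size≡ refl refl κ = ≡.sym κ
    ι≡ : ∀ e b {m n k} (eq : suc (branchSize l) ≡ m) (eq′ : size e ≡ n) (κ : k ≡ m + n) →
         opζ κ ⊣ b (ιᵇ l eq) (ι e eq′) ≡ ι (l •ᵗ (b – e)) (size≡ eq eq′ κ)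
    ι≡ e b refl refl κ = cong (λ κ → opζ κ ⊣ b (ιᵇ l refl) (ι e refl)) (ℕ.≡-irrelevant _ _)

  attachʳ-Branches : ∀ e {m n k} (eq : size e ≡ n) (κ : k ≡ m + n) a {v : Vec m} →
                     v ∈ Branches → op κ (⊣ a) v (ι e eq) ∈ Trees
  attachʳ-Branches e eq κ a = W-Linear (op-linearˡ κ (⊣ a) (ι e eq)) λ (l , eq′ , v≡) →
    ≡.subst (λ v → op κ (⊣ a) v (ι e eq) ∈ Trees) (≡.sym v≡) (attachʳ l eq′ κ a (ι∈ e eq))

  attachˡ : ∀ {m n k} (eq : 1 ≡ n) (κ : k ≡ m + n) a {v : Vec m} →
            v ∈ Trees → op κ (⊢ a) v (leafᶠ eq) ∈ Branches
  attachˡ {m} {n} {k} eq κ a = W-Linear (op-linearˡ κ (⊢ a) (leafᶠ eq)) λ (e , eq′ , v≡) →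
    ≡.subst (λ v → op κ (⊢ a) v (leafᶠ eq) ∈ Branches) (≡.sym v≡)
      (W-opζ⁻ κ ⊢ (ι e eq′) (leafᶠ eq) (λ b → gen (b – e , size≡ eq′ eq κ , ι≡ e b eq′ eq κ)) a)
    where
    size≡ : ∀ {m n k s} → s ≡ m → 1 ≡ n → k ≡ m + n → suc s ≡ k
    size≡ refl refl κ = ≡.sym (≡.trans κ (ℕ.+-comm _ 1))
    ι≡ : ∀ e b {m n k} (eq′ : size e ≡ m) (eq : 1 ≡ n) (κ : k ≡ m + n) →
         opζ κ ⊢ b (ι e eq′) (leafᶠ eq) ≡ ιᵇ (b – e) (size≡ eq′ eq κ)
    ι≡ e b refl refl κ = cong (λ κ → opζ κ ⊢ b (ι e refl) (leafᶠ refl)) (ℕ.≡-irrelevant _ _)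

  private
    assocʳ : ∀ {m n p q k} → k ≡ q + p → q ≡ m + n → k ≡ m + (n + p)
    assocʳ {m} {n} {p} refl refl = ℕ.+-assoc m n p

    assocˡ : ∀ {m n p r k} → k ≡ m + r → r ≡ n + p → k ≡ m + n + p
    assocˡ {m} {n} {p} refl refl = ≡.sym (ℕ.+-assoc m n p)

  mutual
    -- The rewriting terminates because each call keeps one of the two trees and replaces the other
    -- by one of its branches or subtrees.
    ⊣-closed : ∀ e e′ {m n k} (eq : size e ≡ m) (eq′ : size e′ ≡ n) (κ : k ≡ m + n) a →
               op κ (⊣ a) (ι e eq) (ι e′ eq′) ∈ Trees
    ⊣-closed (l •ᵗ ∅)       e′ eq eq′ κ a = attachʳ l _ κ a (ι∈ e′ eq′)
    ⊣-closed (l •ᵗ (b – e)) e′ eq eq′ κ a = W-Linear-⨁ (op-linearˡ κ (⊣ a) (ι e′ eq′))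
      (λ c → ζ c b) (λ c → op (≡.sym eq) (⊣ c) (ιᵇ l refl) (ι e refl)) λ c →
      L⊣⊣∈W (λ x y → attachʳ l refl _ x (⊢-closed e e′ refl eq′ refl y))
            (λ x y → attachʳ l refl _ x (⊣-closed e e′ refl eq′ refl y)) a c
      where open Composite κ (≡.sym eq) (assocʳ {suc (branchSize l)} {size e} κ (≡.sym eq)) refl (ιᵇ l refl) (ι e refl) (ι e′ eq′)

    ⊢-closed : ∀ e e′ {m n k} (eq : size e ≡ m) (eq′ : size e′ ≡ n) (κ : k ≡ m + n) a →
               op κ (⊢ a) (ι e eq) (ι e′ eq′) ∈ Trees
    ⊢-closed e (l •ᵗ ∅)        eq eq′ κ a = Branches⊆Trees (⊢-closed-Branches e l eq _ κ a)
    ⊢-closed e (l •ᵗ (b – e′)) {m} eq eq′ κ a = W-Linear-⨁ (op-linearʳ κ (⊢ a) (ι e eq))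
      (λ c → ζ c b) (λ c → op (≡.sym eq′) (⊣ c) (ιᵇ l refl) (ι e′ refl)) λ c →
      -- After rebracketing, `e` meets only the left branch `l`, and the right subtree `e′` is
      -- attached afterwards.
      W-~ {v = L (⊣ c) (⊢ a)} {R (⊢ a) (⊣ c)} (L⊣⊢~R⊢⊣ c a)
        (attachʳ-Branches e′ refl _ c (⊢-closed-Branches e l eq refl refl a))
      where open Composite (assocˡ {m} {suc (branchSize l)} {size e′} κ (≡.sym eq′)) refl κ (≡.sym eq′) (ι e eq) (ιᵇ l refl) (ι e′ refl)

    -- Multiplying from the left creates no right branch. The sharper conclusion `Branches` is what
    -- allows `attachʳ-Branches` to attach a right factor to the result.
    ⊢-closed-Branches : ∀ e l {m n k} (eq : size e ≡ m) (eq′ : suc (branchSize l) ≡ n) (κ : k ≡ m + n) a →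
                        op κ (⊢ a) (ι e eq) (ιᵇ l eq′) ∈ Branches
    ⊢-closed-Branches e ∅        eq eq′ κ a = attachˡ eq′ κ a (ι∈ e eq)
    ⊢-closed-Branches e (b – e′) {m} eq eq′ κ a = W-Linear-⨁ (op-linearʳ κ (⊢ a) (ι e eq))
      (λ c → ζ c b) (λ c → op ε (⊢ c) (ι e′ refl) (leafᶠ refl)) λ c →
      R⊢⊢∈W (λ x y → attachˡ refl _ x (⊣-closed e e′ eq refl refl y))
            (λ x y → attachˡ refl _ x (⊢-closed e e′ eq refl refl y)) a c
      where
      ε : _ ≡ size e′ + 1
      ε = ≡.trans (≡.sym eq′) (ℕ.+-comm 1 _)
      open Composite (assocˡ {m} {size e′} {1} κ ε) refl κ ε (ι e eq) (ι e′ refl) (leafᶠ refl)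

  op-closed : ∀ {m n k} (κ : k ≡ m + n) g {v : Vec m} {w : Vec n} →
              v ∈ Trees → w ∈ Trees → op κ g v w ∈ Trees
  op-closed κ g {v} {w} v∈ w∈ = W-Linear (op-linearˡ κ g w) (λ { (e , eq , refl) →
    W-Linear (op-linearʳ κ g (ι e eq)) (λ { (e′ , eq′ , refl) → closed e e′ eq eq′ g }) w∈ }) v∈
    where
    closed : ∀ e e′ eq eq′ g → op κ g (ι e eq) (ι e′ eq′) ∈ Trees
    closed e e′ eq eq′ (⊣ a) = ⊣-closed e e′ eq eq′ κ a
    closed e e′ eq eq′ (⊢ a) = ⊢-closed e e′ eq eq′ κ a

  pure∈Trees : ∀ t {n} (eq : leaves t ≡ n) → pure (t , eq) ∈ Trees
  pure∈Trees leaf         eq = ιᵇ∈Trees ∅ eq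
  pure∈Trees (node g l r) eq = W-resp
    {v = op (≡.sym eq) g (pure (l , refl)) (pure (r , refl))} {pure (node g l r , eq)}
    (λ F → K.+-congʳ (K.*-cong (K.*-identityˡ _) (K.reflexive (cong F (TreeOf-≡ refl)))))
    (op-closed (≡.sym eq) g (pure∈Trees l refl) (pure∈Trees r refl))

  all∈Trees : ∀ {n} (v : Vec n) → v ∈ Trees
  all∈Trees []                  = zero
  all∈Trees ((a , t , eq) ∷ v) = W-resp {v = a · pure (t , eq) ++ v} {(a , t , eq) ∷ v}
    (λ F → K.+-congʳ (K.*-congʳ (K.*-identityʳ a)))
    (W-+ {v = a · pure (t , eq)} {v} (W-· a {pure (t , eq)} (pure∈Trees t eq)) (all∈Trees v))

-- The basis of each component indexed by edge-labelled trees

module Basis {c ℓ₁ ℓ₂} (𝕂 : HeytingField c ℓ₁ ℓ₂) (γ : ℕ) where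

  open Spanning 𝕂 γ
  open SetoidReasoning K.setoid

  module _ (n : ℕ) where

    enum : Fin (count n) → EdgeTree
    enum = lookup (trees n)

    basis : Fin (count n) → Vec n
    basis i = ι (enum i) (∈-trees⁻ n (Mem.∈-lookup i))

    combination : (Fin (count n) → 𝕜) → Vec n
    combination a = ⨁ λ i → a i · basis i

    eval-combination : ∀ F a → eval F (combination a) ≈ₖ sum (λ i → a i *ₖ eval F (basis i))
    eval-combination F a = K.trans (eval-⨁ F λ i → a i · basis i)
      (sum-cong-≋ λ i → eval-· F (a i) (basis i))

    δ-enum : ∀ i j → FreeSpace.δ _≟ᵗ_ (enum i) (enum j) ≡ δFin.δ j i
    δ-enum i j with enum i ≟ᵗ enum j | j Fin.≟ i
    ... | yes _ | yes _    = refl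
    ... | no _  | no _     = refl
    ... | yes p | no j≢i   = contradiction (≡.sym (lookup-injective (Unique-trees n) i j p)) j≢i
    ... | no p  | yes refl = contradiction refl p

    -- Take for `f` the indicator of the `i`-th tree. By `φ-ι` the functional `Φ` reads off the
    -- coefficient `a i`, and by `Φ-ideal` it vanishes on the ideal.
    basis-independent : ∀ a → combination a ~ [] → ∀ i → a i ≈ₖ 0ₖ
    basis-independent a p i = begin
      a i
        ≈⟨ sum-δ a i ⟨
      sum (λ j → δFin.δ j i *ₖ a j)
        ≈⟨ sum-cong-≋ (λ j → K.trans (K.*-congʳ {a j} (K.reflexive (≡.sym (δ-enum i j)))) (K.*-comm _ _)) ⟩
      sum (λ j → a j *ₖ f (enum j))
        ≈⟨ sum-cong-≋ (λ j → K.*-congˡ {a j} (K.trans (K.sym (eval-φ f (basis j))) (φ-ι f (enum j) _))) ⟨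
      sum (λ j → a j *ₖ Φ f (const (∅ •ᵗ ∅)) (basis j))
        ≈⟨ eval-combination _ a ⟨
      Φ f (const (∅ •ᵗ ∅)) (combination a)
        ≈⟨ K.trans (eval-++ _ (combination a) []) (K.+-identityʳ _) ⟨
      Φ f (const (∅ •ᵗ ∅)) (combination a ++ [])
        ≈⟨ Φ-ideal f (const (∅ •ᵗ ∅)) p ⟩
      0ₖ ∎
      where
      f : EdgeTree → 𝕜
      f = FreeSpace.δ _≟ᵗ_ (enum i)

    Combination : Pred (Vec n) _
    Combination v = ∃[ a ] combination a ~ v

    ~-trans : ∀ {u v w} → u ~ v → v ~ w → u ~ w
    ~-trans {u} {v} {w} = LeftModule.≈ᴹ-trans (Q n) {u} {v} {w}

    Combination-resp : ∀ {v w} → v ~ w → v ∈ Combination → w ∈ Combination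
    Combination-resp {v} {w} v~w (a , a~) = a , ~-trans {combination a} {v} {w} a~ v~w

    Combination-ι : ∀ e (eq : size e ≡ n) → ι e eq ∈ Combination
    Combination-ι e eq = (λ j → δFin.δ j i) ,
      ≈ᶠ⇒~ {v = combination λ j → δFin.δ j i} {ι e eq} λ F → K.trans (eval-combination F λ j → δFin.δ j i)
        (K.trans (sum-δ (λ j → eval F (basis j)) i) (K.reflexive (cong (eval F) (basis≡ (Any.lookup-index e∈) (∈-trees⁻ n (Mem.∈-lookup i)) eq))))
      where
      e∈ = ∈-trees⁺ e eq
      i : Fin (count n)
      i = index e∈
      basis≡ : ∀ {e e′} (p : e ≡ e′) (q : size e′ ≡ n) (r : size e ≡ n) → ι e′ q ≡ ι e r
      basis≡ {e} refl q r = cong (ι e) (ℕ.≡-irrelevant q r)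

    Combination-zero : [] ∈ Combination
    Combination-zero = (λ _ → 0ₖ) , ≈ᶠ⇒~ {v = combination λ _ → 0ₖ} {[]} λ F →
      K.trans (eval-combination F λ _ → 0ₖ) (sum-0 (λ i → 0ₖ *ₖ eval F (basis i)) λ i → K.zeroˡ _)

    Combination-+ : ∀ {v w} → v ∈ Combination → w ∈ Combination → v ++ w ∈ Combination
    Combination-+ {v} {w} (a , a~) (b , b~) =
      (λ i → a i +ₖ b i) , ~-trans {combination λ i → a i +ₖ b i} {combination a ++ combination b} {v ++ w}
        (≈ᶠ⇒~ {v = combination λ i → a i +ₖ b i} {combination a ++ combination b} λ F → begin
          eval F (combination λ i → a i +ₖ b i)
            ≈⟨ eval-combination F (λ i → a i +ₖ b i) ⟩
          sum (λ i → (a i +ₖ b i) *ₖ eval F (basis i))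
            ≈⟨ sum-cong-≋ (λ i → K.distribʳ (eval F (basis i)) (a i) (b i)) ⟩
          sum (λ i → a i *ₖ eval F (basis i) +ₖ b i *ₖ eval F (basis i))
            ≈⟨ ∑-distrib-+ (λ i → a i *ₖ eval F (basis i)) (λ i → b i *ₖ eval F (basis i)) ⟩
          sum (λ i → a i *ₖ eval F (basis i)) +ₖ sum (λ i → b i *ₖ eval F (basis i))
            ≈⟨ K.+-cong (eval-combination F a) (eval-combination F b) ⟨
          eval F (combination a) +ₖ eval F (combination b)
            ≈⟨ eval-++ F (combination a) (combination b) ⟨
          eval F (combination a ++ combination b) ∎)
        (LeftModule.+ᴹ-cong (Q n) {combination a} {v} {combination b} {w} a~ b~)

    Combination-· : ∀ x {v} → v ∈ Combination → x · v ∈ Combination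
    Combination-· x {v} (a , a~) =
      (λ i → x *ₖ a i) , ~-trans {combination λ i → x *ₖ a i} {x · combination a} {x · v}
        (≈ᶠ⇒~ {v = combination λ i → x *ₖ a i} {x · combination a} λ F → begin
          eval F (combination λ i → x *ₖ a i)
            ≈⟨ eval-combination F (λ i → x *ₖ a i) ⟩
          sum (λ i → (x *ₖ a i) *ₖ eval F (basis i))
            ≈⟨ sum-cong-≋ (λ i → K.*-assoc x (a i) (eval F (basis i))) ⟩
          sum (λ i → x *ₖ (a i *ₖ eval F (basis i)))
            ≈⟨ *-distribˡ-sum x (λ i → a i *ₖ eval F (basis i)) ⟨
          x *ₖ sum (λ i → a i *ₖ eval F (basis i))
            ≈⟨ K.*-congˡ (eval-combination F a) ⟨
          x *ₖ eval F (combination a)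
            ≈⟨ eval-· F x (combination a) ⟨
          eval F (x · combination a) ∎)
        (LeftModule.*ₗ-congˡ (Q n) {x} {combination a} {v} a~)

    Trees⊆Combination : ∀ {v} → v ∈ Trees {n} → v ∈ Combination
    Trees⊆Combination (gen (e , eq , refl))  = Combination-ι e eq
    Trees⊆Combination zero                   = Combination-zero
    Trees⊆Combination (add {v} {w} p q)      =
      Combination-+ {v} {w} (Trees⊆Combination {v} p) (Trees⊆Combination {w} q)
    Trees⊆Combination (scal x {v} p)         = Combination-· x {v} (Trees⊆Combination {v} p)
    Trees⊆Combination (resp {v} {w} v~w p)   = Combination-resp {v} {w} v~w (Trees⊆Combination {v} p)

    dimension : HasDimension (Q n) (count n)
    dimension = basis , record
      { independent = basis-independent
      ; spanning    = λ v → Trees⊆Combination {v} (all∈Trees v) }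

proposition4p1p2 : ∀ {c ℓ₁ ℓ₂} (𝕂 : HeytingField c ℓ₁ ℓ₂) → OverField.CharacteristicZero 𝕂 →
    (γ : ℕ) →
    Σ[ H ∈ PowerSeries ] (OverField.IsHilbertSeries 𝕂 (Dendr 𝕂 γ) H
    × H ≗ 𝕥 ⊕ (2 * γ) • (𝕥 ⊛ H) ⊕ (γ ^ 2) • (𝕥 ⊛ (H ⊛ H)))
proposition4p1p2 𝕂 _ γ = count , (refl , λ n _ → Basis.dimension 𝕂 γ n) , count-equation
  where open EdgeValued γ
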